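{- Let $m,n,k$ be non-negative integers with $1\le k\le n$. (1) For positive integers $1<b_2<\dots<b_k$ with $b_k\le m+k$, the sum over all $(m,n,k)$-Gog trapezoids with bottom row $(1,b_2,\dots,b_k)$ of $P^{\#\text{minima}}Q^{\#\text{maxima not including }b_k}$ equals the constant term in $x_1,\dots,x_n$ of $$P(1+Px_1)^{ -1}(1+x_1)^2x_1^{ -n+1}\prod_{i=2}^k(1+x_i)^{b_i}x_i^{ -n+1}\prod_{i=k+1}^n(1+Qx_i)(1+x_i)^{m+k}x_i^{ -n+i-k}\prod_{1\le i<j\le n}(x_i-x_j)(1+x_j+x_ix_j).$$ (2) For positive integers $b_1<\dots<b_k$ with $b_k\le m+k$, the sum over all $(m,n,k)$-Gog trapezoids with bottom row $(b_1,\dots,b_k)$ of $Q^{\#\text{maxima not including }b_k}$ equals the constant term of $$\prod_{i=1}^k(1+x_i)^{b_i}x_i^{ -n+1}\prod_{i=k+1}^n(1+Qx_i)(1+x_i)^{m+k}x_i^{ -n+i-k}\prod_{1\le i<j\le n}(x_i-x_j)(1+x_j+x_ix_j).$$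
   Context: For non-negative integers $m,n,k$ with $k\le n$, an $(m,n,k)$-Gog trapezoid is an array $(m_{i,j})$ of positive integers indexed by $1\le i\le n$, $1\le j\le\min(i,k)$ (the $k$ leftmost NE-diagonals of a triangular array with $n$ rows), such that $m_{i+1,j}\le m_{i,j}\le m_{i+1,j+1}$ whenever the entries exist, rows are strictly increasing, and $m_{i,j}\le m+n-i+j$ (the upper bound for the entries of its SE-diagonal). Bottom row: $(m_{n,1},\dots,m_{n,k})$. A minimum is an entry equal to $1$. A maximum is an entry $m_{i,k}$ of the $k$-th NE-diagonal with $m_{i,k}=m+n-i+k$. "Maxima not including $b_k$" means the bottom entry $m_{n,k}=b_k$ is not counted even if it is a maximum. $P,Q$ are indeterminates; $(1+Px_1)^{ -1}$ is expanded as a power series in $x_1$. -}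

module Defs where

open import Data.Bool using (Bool; true; false; _∧_; if_then_else_; T?)
open import Data.Nat as ℕ using (ℕ; zero; suc; _∸_; _⊓_; _≡ᵇ_; _≤ᵇ_; _<ᵇ_)
open import Data.Integer as ℤ using (ℤ; +_; -_)
open import Data.Fin using (Fin; toℕ)
import Data.Fin as Fin
open import Data.List as List using (List; []; _∷_; _++_; map; concatMap; foldr; length; upTo; allFin)
open import Data.Vec as Vec using (Vec; []; _∷_; tabulate; zipWith; replicate)
import Data.Vec.Properties as VecP
open import Data.Product using (_×_; _,_)
open import Relation.Nullary using (does)

-- Laurent polynomials in x_1..x_n (Fin index 0 = x_1) with coefficients
-- in ℤ[P,Q].  A term (c , a , b , e) stands for  c · P^a · Q^b · x^e.
-- A polynomial is a formal (unnormalised) finite sum of terms.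

Term : ℕ → Set
Term n = ℤ × ℕ × ℕ × Vec ℤ n

Poly : ℕ → Set
Poly n = List (Term n)

zeroExp : ∀ {n} → Vec ℤ n
zeroExp = replicate _ (+ 0)

cst : ∀ {n} → ℤ → Poly n
cst c = (c , 0 , 0 , zeroExp) ∷ []

one : ∀ {n} → Poly n
one = cst (+ 1)

𝑷 : ∀ {n} → Poly n
𝑷 = (+ 1 , 1 , 0 , zeroExp) ∷ []

𝑸 : ∀ {n} → Poly n
𝑸 = (+ 1 , 0 , 1 , zeroExp) ∷ []

xpow : ∀ {n} → Fin n → ℤ → Poly n
xpow f z = (+ 1 , 0 , 0 , tabulate (λ g → if does (f Fin.≟ g) then z else + 0)) ∷ []

𝒙 : ∀ {n} → Fin n → Poly n
𝒙 f = xpow f (+ 1)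

infixl 6 _⊕_ _⊖_
infixl 7 _⊗_

_⊕_ : ∀ {n} → Poly n → Poly n → Poly n
p ⊕ q = p ++ q

negP : ∀ {n} → Poly n → Poly n
negP = map (λ { (c , a , b , e) → (ℤ.- c , a , b , e) })

_⊖_ : ∀ {n} → Poly n → Poly n → Poly n
p ⊖ q = p ++ negP q

mulT : ∀ {n} → Term n → Term n → Term n
mulT (c , a , b , e) (c' , a' , b' , e') = (c ℤ.* c' , a ℕ.+ a' , b ℕ.+ b' , zipWith ℤ._+_ e e')

_⊗_ : ∀ {n} → Poly n → Poly n → Poly n
p ⊗ q = concatMap (λ s → map (mulT s) q) p

_^ᴾ_ : ∀ {n} → Poly n → ℕ → Poly n
p ^ᴾ zero = one
p ^ᴾ suc ℓ = p ⊗ (p ^ᴾ ℓ)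

prodP : ∀ {n} → List (Poly n) → Poly n
prodP = foldr _⊗_ one

sumℤ : List ℤ → ℤ
sumℤ = foldr ℤ._+_ (+ 0)

coeff : ∀ {n} → Poly n → ℕ → ℕ → Vec ℤ n → ℤ
coeff p a b e = sumℤ (map (λ { (c , a' , b' , e') →
  if (a' ≡ᵇ a) ∧ (b' ≡ᵇ b) ∧ does (VecP.≡-dec ℤ._≟_ e' e) then c else + 0 }) p)

shift₁ : ∀ {n} → ℤ → Vec ℤ n → Vec ℤ n
shift₁ d [] = []
shift₁ d (z ∷ zs) = (z ℤ.+ d) ∷ zs

-- Coefficient of P^a Q^b x^e in  F · (1 + P x_1)^{-1}, where
-- (1 + P x_1)^{-1} = Σ_{j ≥ 0} (-1)^j P^j x_1^j  as a power series in x_1.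
-- Since all P-exponents in F are ≥ 0, only j ≤ a contribute, so this
-- finite sum is the exact coefficient of the formal product.
coeffGeom : ∀ {n} → Poly n → ℕ → ℕ → Vec ℤ n → ℤ
coeffGeom F a b e = sumℤ (map (λ j →
  ((ℤ.- (+ 1)) ℤ.^ j) ℤ.* coeff F (a ∸ j) b (shift₁ (ℤ.- (+ j)) e)) (upTo (suc a)))

-- The Laurent polynomial of the theorem (part (2)), for bottom-row
-- vector b = (b_1,…,b_k):
--   ∏_{i=1}^k (1+x_i)^{b_i} x_i^{-n+1}
--   ∏_{i=k+1}^n (1+Q x_i)(1+x_i)^{m+k} x_i^{-n+i-k}
--   ∏_{1≤i<j≤n} (x_i - x_j)(1 + x_j + x_i x_j)
-- Paper index i corresponds to f : Fin n with i = toℕ f + 1.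

singleFactor : (m n k : ℕ) → Vec ℕ k → Fin n → Poly n
singleFactor m n k b f with toℕ f ℕ.<? k
... | Relation.Nullary.yes p =
      ((one ⊕ 𝒙 f) ^ᴾ Vec.lookup b (Fin.fromℕ< p)) ⊗ xpow f ((+ 1) ℤ.- (+ n))
... | Relation.Nullary.no _ =
      (one ⊕ (𝑸 ⊗ 𝒙 f)) ⊗ ((one ⊕ 𝒙 f) ^ᴾ (m ℕ.+ k))
        ⊗ xpow f ((+ (toℕ f ℕ.+ 1)) ℤ.- (+ n) ℤ.- (+ k))

pairFactor : ∀ {n} → Fin n → Fin n → Poly n
pairFactor f g = if toℕ f <ᵇ toℕ g
  then (𝒙 f ⊖ 𝒙 g) ⊗ (one ⊕ 𝒙 g ⊕ (𝒙 f ⊗ 𝒙 g))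
  else one

gogCT : (m n k : ℕ) → Vec ℕ k → Poly n
gogCT m n k b =
  prodP (map (singleFactor m n k b) (allFin n))
  ⊗ prodP (concatMap (λ f → map (pairFactor f) (allFin n)) (allFin n))

-- Gog trapezoids.  An array is a list of rows; row i (1-based, i=1..n)
-- is the list (m_{i,1},…,m_{i,min(i,k)}).

Array : Set
Array = List (List ℕ)

atℕ : List ℕ → ℕ → ℕ        -- 1-based, default 0
atℕ [] _ = 0
atℕ (x ∷ xs) zero = 0
atℕ (x ∷ xs) (suc zero) = x
atℕ (x ∷ xs) (suc (suc i)) = atℕ xs (suc i)

row : Array → ℕ → List ℕ     -- 1-based, default []
row [] _ = []
row (r ∷ rs) zero = []
row (r ∷ rs) (suc zero) = r
row (r ∷ rs) (suc (suc i)) = row rs (suc i)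

ent : Array → ℕ → ℕ → ℕ
ent T i j = atℕ (row T i) j

range1 : ℕ → List ℕ
range1 ℓ = map suc (upTo ℓ)

allB : (ℕ → Bool) → List ℕ → Bool
allB p [] = true
allB p (x ∷ xs) = p x ∧ allB p xs

isGog : (m n k : ℕ) → Array → Bool
isGog m n k T =
  (length T ≡ᵇ n)
  ∧ allB (λ i → length (row T i) ≡ᵇ (i ⊓ k)) (range1 n)
  ∧ allB (λ i → allB (λ j → (1 ≤ᵇ ent T i j) ∧ (ent T i j ≤ᵇ (m ℕ.+ n ∸ i ℕ.+ j)))
                     (range1 (i ⊓ k))) (range1 n)
  ∧ allB (λ i → allB (λ j → ent T i j <ᵇ ent T i (suc j)) (range1 (i ⊓ k ∸ 1)))
         (range1 n)
  ∧ allB (λ i → allB (λ j →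
            (ent T (suc i) j ≤ᵇ ent T i j)
            ∧ (if suc j ≤ᵇ (suc i ⊓ k) then ent T i j ≤ᵇ ent T (suc i) (suc j) else true))
         (range1 (i ⊓ k))) (range1 (n ∸ 1))

words : ℕ → List ℕ → List (List ℕ)
words zero A = [] ∷ []
words (suc ℓ) A = concatMap (λ a → map (a ∷_) (words ℓ A)) A

-- all arrays of the trapezoid shape with entries in {1,…,m+n}
-- (every entry of a Gog trapezoid satisfies 1 ≤ m_{i,j} ≤ m+n-i+j ≤ m+n)
candidates : (m n k : ℕ) → List Array
candidates m n k = foldr (λ i rest → concatMap (λ r → map (r ∷_) rest)
                                       (words (i ⊓ k) (range1 (m ℕ.+ n))))
                         ([] ∷ []) (range1 n)

gogs : (m n k : ℕ) → List ℕ → List Array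
gogs m n k bs = List.filter (λ T → T? (isGog m n k T ∧ listEq (row T n) bs))
                            (candidates m n k)
  where
  listEq : List ℕ → List ℕ → Bool
  listEq [] [] = true
  listEq (x ∷ xs) (y ∷ ys) = (x ≡ᵇ y) ∧ listEq xs ys
  listEq _ _ = false

countB : (ℕ → Bool) → List ℕ → ℕ
countB p xs = length (List.filter (λ x → T? (p x)) xs)

#minima : (m n k : ℕ) → Array → ℕ
#minima m n k T = foldr ℕ._+_ 0 (map (λ i → countB (λ j → ent T i j ≡ᵇ 1) (range1 (i ⊓ k))) (range1 n))

-- number of maxima not including b_k: entries m_{i,k}, k ≤ i ≤ n-1,
-- with m_{i,k} = m+n-i+k  (the bottom entry m_{n,k} is excluded)
#maxima : (m n k : ℕ) → Array → ℕ
#maxima m n k T = countB (λ i → (k ≤ᵇ i) ∧ (ent T i k ≡ᵇ (m ℕ.+ n ∸ i ℕ.+ k))) (range1 (n ∸ 1))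

genPQ : (m n k : ℕ) → List ℕ → Poly 0
genPQ m n k bs = map (λ T → (+ 1 , #minima m n k T , #maxima m n k T , [])) (gogs m n k bs)

genQ : (m n k : ℕ) → List ℕ → Poly 0
genQ m n k bs = map (λ T → (+ 1 , 0 , #maxima m n k T , [])) (gogs m n k bs)

module Submission where

-- Removing the bottom row b of an (m,n,k)-Gog trapezoid leaves an (m+1,n-1,k)-
-- (for n > k) or (m+1,n-1,k-1)-trapezoid (for n = k) whose bottom row l
-- interlaces with b.  In the constant term an entry b contributes the series
-- (1+x)^b x^(1-n), and (1+x)^l x^(2-n) = (1+x)^(l+1) x^(1-n) - (1+x)^l x^(1-n),
-- so the sum over each l telescopes.  The weight Q at the upper end turns the
-- last boundary term into (1+Qx)(1+x)^(m+k+1); for minima the first series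
-- φ = P(1+x)^2/(1+Px) satisfies P x φ + φ = P(1+x)^2, which telescopes too.
-- The product of the sums differs from the sum over strictly increasing rows
-- by terms which, at two neighbouring variables x, y, carry the factor
-- (1+x+xy)(1+y+xy)(x-y) and a symmetric rest, hence vanish.
-- What remains is Σⱼ ± (n-1 variables, xⱼ omitted).  This is the constant term
-- in n variables: expand the Vandermonde product along the powers xⱼ^(n-1);
-- modulo xⱼ^n the factors 1+x_b+x_a x_b containing xⱼ become Π_{i>j} (1+xᵢ).

open import Level using (0ℓ)
open import Algebra.Bundles using (CommutativeRing; RawRing)
import Algebra.Solver.Ring
open import Algebra.Solver.Ring.AlmostCommutativeRing using (fromCommutativeRing; _-Raw-AlmostCommutative⟶_)
import Algebra.Properties.Ring
import Algebra.Properties.AbelianGroup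
import Algebra.Properties.Semiring.Mult.TCOptimised
import Algebra.Properties.CommutativeSemigroup
open import Data.Nat as ℕ using (ℕ; zero; suc; _≤ᵇ_; _<ᵇ_; _≡ᵇ_; s≤s; z≤n; _∸_; _⊓_)
open import Data.Integer as ℤ using (ℤ; -[1+_])
import Data.Integer.Properties as ℤP
import Data.Nat.Properties as ℕP
open import Data.Sign as Sign using (Sign)
open import Data.Maybe using (Maybe; just; nothing)
open import Data.List as List using (List; []; _∷_; _++_; concatMap; applyUpTo; upTo; length; _∷ʳ_; foldr)
open import Data.Product using (_×_; _,_; proj₁; proj₂)
open import Relation.Nullary using (yes; no)
import Relation.Binary.PropositionalEquality as ≡
open ≡ using (_≡_; _≢_)
import Relation.Binary.Reasoning.Setoid
open import Algebra.Structures using (IsCommutativeMonoid)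
open import Data.Vec as Vec using (Vec; []; _∷_; toList; fromList)
open import Data.Vec.Relation.Unary.All as All using (All; []; _∷_)
open import Data.Vec.Relation.Binary.Pointwise.Inductive as PW using (Pointwise; []; _∷_)
import Data.Vec.Properties as VecP
open import Data.Vec.Relation.Unary.Any using (Any; here; there)
open import Data.Unit using (⊤; tt)
import Data.Vec.Relation.Unary.All.Properties as AllP
import Data.List.Properties as LP
open import Defs using (range1; allB; countB; Array; row; ent; atℕ; words; isGog; #minima; #maxima; candidates; gogs)
open import Data.Bool using (Bool; true; false; _∧_; T; if_then_else_; T?)
open import Data.Bool.Properties using (T-≡; ∧-zeroʳ; ∧-assoc; ∧-identityʳ)
open import Data.Empty using (⊥; ⊥-elim)
open import Data.Sum using (inj₁; inj₂; _⊎_)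
open import Function using (_∘_; Equivalence)
open import Relation.Binary using (tri<; tri≈; tri>)
open import Data.List.Relation.Binary.Pointwise as LPW using ([]; _∷_) renaming (Pointwise to PointwiseL)

-- The obstacle is that the rows above must be strictly increasing and that the upper end of each
-- sum depends on the next bottom entry, so the sum over a row is not a product. Both sides are
-- therefore brought to the same alternating sum with one term per position j: lower interval ends
-- before j, upper interval ends from j on. In the Vandermonde expansion this shape arises because
-- the factors 1 + x_i with i > j turn the series of b_i into the upper boundary value of the
-- interval from b_(i-1) to b_i.
--
-- The number m + n is held fixed during the induction, so that all rows use one alphabet. For n = k
-- the row above is shorter, and the last bottom entry takes over the role of the diagonal bound,
-- with weight 1 instead of Q.
--
-- The weights p and q are elements of an arbitrary commutative ring, specialised at the end to p =
-- P or p = 1 and q = Q. At p = 1 the series p(1+x)^2/(1+px) is 1 + x, the ordinary series of an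
-- entry 1, so the second part is a specialisation of the same recursion. Since x - y need not be
-- cancellable in the truncated rings, the Vandermonde identities are proved without division.

Ring₀ : Set₁
Ring₀ = CommutativeRing 0ℓ 0ℓ

-- Integer coefficients for the ring solver, and finite sums

module RingKit (𝕂 : Ring₀) where
  open CommutativeRing 𝕂
  open Algebra.Properties.Ring ring
  open Algebra.Properties.AbelianGroup +-abelianGroup using (⁻¹-∙-comm)
  open Algebra.Properties.Semiring.Mult.TCOptimised semiring renaming (_×_ to _⋆_)
  open Algebra.Properties.CommutativeSemigroup +-commutativeSemigroup using (interchange)
  open Relation.Binary.Reasoning.Setoid setoid

  private
    -- The canonical map from ℤ. With ℤ as coefficient ring the solver can compare constants,
    -- although equality in 𝕂 is not decidable.
    fromℤ : ℤ → Carrier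
    fromℤ (ℤ.+ n)    = n ⋆ 1#
    fromℤ -[1+ n ] = - (suc n ⋆ 1#)

    ⋆-suc : ∀ n → suc n ⋆ 1# ≈ 1# + n ⋆ 1#
    ⋆-suc n = 1+× n 1#

    fromℤ-⊖ : ∀ m n → fromℤ (m ℤ.⊖ n) ≈ m ⋆ 1# - n ⋆ 1#
    fromℤ-⊖ m zero = sym (trans (+-congˡ -0#≈0#) (+-identityʳ _))
    fromℤ-⊖ zero (suc n) = sym (+-identityˡ _)
    fromℤ-⊖ (suc m) (suc n) = begin
      fromℤ (suc m ℤ.⊖ suc n)                ≡⟨ ≡.cong fromℤ (ℤP.[1+m]⊖[1+n]≡m⊖n m n) ⟩
      fromℤ (m ℤ.⊖ n)                        ≈⟨ fromℤ-⊖ m n ⟩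
      m ⋆ 1# - n ⋆ 1#                        ≈⟨ +-identityˡ _ ⟨
      0# + (m ⋆ 1# - n ⋆ 1#)                 ≈⟨ +-congʳ (-‿inverseʳ 1#) ⟨
      (1# - 1#) + (m ⋆ 1# - n ⋆ 1#)          ≈⟨ interchange _ _ _ _ ⟩
      (1# + m ⋆ 1#) + (- 1# - n ⋆ 1#)        ≈⟨ +-congˡ (⁻¹-∙-comm _ _) ⟩
      (1# + m ⋆ 1#) - (1# + n ⋆ 1#)          ≈⟨ +-cong (⋆-suc m) (-‿cong (⋆-suc n)) ⟨
      suc m ⋆ 1# - suc n ⋆ 1#                ∎

    fromℤ-+ : ∀ i j → fromℤ (i ℤ.+ j) ≈ fromℤ i + fromℤ j
    fromℤ-+ (ℤ.+ m) (ℤ.+ n) = ×-homo-+ 1# m n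
    fromℤ-+ (ℤ.+ m) -[1+ n ] = fromℤ-⊖ m (suc n)
    fromℤ-+ -[1+ m ] (ℤ.+ n) = trans (fromℤ-⊖ n (suc m)) (+-comm _ _)
    fromℤ-+ -[1+ m ] -[1+ n ] = begin
      - (suc (suc (m ℕ.+ n)) ⋆ 1#)           ≡⟨ ≡.cong (λ x → - (suc x ⋆ 1#)) (≡.sym (ℕP.+-suc m n)) ⟩
      - ((suc m ℕ.+ suc n) ⋆ 1#)             ≈⟨ -‿cong (×-homo-+ 1# (suc m) (suc n)) ⟩
      - (suc m ⋆ 1# + suc n ⋆ 1#)            ≈⟨ ⁻¹-∙-comm _ _ ⟨
      - (suc m ⋆ 1#) - (suc n ⋆ 1#)          ∎

    fromℤ-◃+ : ∀ n → fromℤ (Sign.+ ℤ.◃ n) ≈ n ⋆ 1#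
    fromℤ-◃+ zero = refl
    fromℤ-◃+ (suc n) = refl

    fromℤ-◃- : ∀ n → fromℤ (Sign.- ℤ.◃ n) ≈ - (n ⋆ 1#)
    fromℤ-◃- zero = sym -0#≈0#
    fromℤ-◃- (suc n) = refl

    fromℤ-* : ∀ i j → fromℤ (i ℤ.* j) ≈ fromℤ i * fromℤ j
    fromℤ-* (ℤ.+ m) (ℤ.+ n) = trans (fromℤ-◃+ (m ℕ.* n)) (×1-homo-* m n)
    fromℤ-* (ℤ.+ m) -[1+ n ] = begin
      fromℤ (Sign.- ℤ.◃ (m ℕ.* suc n))       ≈⟨ fromℤ-◃- (m ℕ.* suc n) ⟩
      - ((m ℕ.* suc n) ⋆ 1#)                 ≈⟨ -‿cong (×1-homo-* m (suc n)) ⟩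
      - (m ⋆ 1# * suc n ⋆ 1#)                ≈⟨ -‿distribʳ-* _ _ ⟩
      m ⋆ 1# * - (suc n ⋆ 1#)                ∎
    fromℤ-* -[1+ m ] (ℤ.+ n) = begin
      fromℤ (Sign.- ℤ.◃ (suc m ℕ.* n))       ≈⟨ fromℤ-◃- (suc m ℕ.* n) ⟩
      - ((suc m ℕ.* n) ⋆ 1#)                 ≈⟨ -‿cong (×1-homo-* (suc m) n) ⟩
      - (suc m ⋆ 1# * n ⋆ 1#)                ≈⟨ -‿distribˡ-* _ _ ⟩
      - (suc m ⋆ 1#) * n ⋆ 1#                ∎
    fromℤ-* -[1+ m ] -[1+ n ] = begin
      fromℤ (Sign.+ ℤ.◃ (suc m ℕ.* suc n))   ≈⟨ ×1-homo-* (suc m) (suc n) ⟩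
      suc m ⋆ 1# * suc n ⋆ 1#                ≈⟨ -‿involutive _ ⟨
      - - (suc m ⋆ 1# * suc n ⋆ 1#)          ≈⟨ -‿cong (-‿distribˡ-* _ _) ⟩
      - (- (suc m ⋆ 1#) * suc n ⋆ 1#)        ≈⟨ -‿distribʳ-* _ _ ⟩
      - (suc m ⋆ 1#) * - (suc n ⋆ 1#)        ∎

    fromℤ-neg : ∀ i → fromℤ (ℤ.- i) ≈ - fromℤ i
    fromℤ-neg (ℤ.+ zero) = sym -0#≈0#
    fromℤ-neg (ℤ.+ suc n) = refl
    fromℤ-neg -[1+ n ] = sym (-‿involutive _)

    ℤ-raw : RawRing 0ℓ 0ℓ
    ℤ-raw = CommutativeRing.rawRing ℤP.+-*-commutativeRing

    ℤ⟶𝕂 : ℤ-raw -Raw-AlmostCommutative⟶ fromCommutativeRing 𝕂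
    ℤ⟶𝕂 = record
      { ⟦_⟧ = fromℤ ; +-homo = fromℤ-+ ; *-homo = fromℤ-* ; -‿homo = fromℤ-neg
      ; 0-homo = refl ; 1-homo = refl }

    fromℤ-≟ : ∀ i j → Maybe (fromℤ i ≈ fromℤ j)
    fromℤ-≟ i j with i ℤ.≟ j
    ... | yes eq = just (reflexive (≡.cong fromℤ eq))
    ... | no _   = nothing

  open Algebra.Solver.Ring ℤ-raw (fromCommutativeRing 𝕂) ℤ⟶𝕂 fromℤ-≟ public
    using (solve; _:=_; _:+_; _:*_; _:-_; :-_; con; Polynomial)

  :1 : ∀ {n} → Polynomial n
  :1 = con (ℤ.+ 1)

  :0 : ∀ {n} → Polynomial n
  :0 = con (ℤ.+ 0)

  sumL : {X : Set} → List X → (X → Carrier) → Carrier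
  sumL []       f = 0#
  sumL (x ∷ xs) f = f x + sumL xs f

  module _ {X : Set} where

    sum-cong : ∀ (xs : List X) {f g} → (∀ x → f x ≈ g x) → sumL xs f ≈ sumL xs g
    sum-cong []       f≈g = refl
    sum-cong (x ∷ xs) f≈g = +-cong (f≈g x) (sum-cong xs f≈g)

    sum-0 : ∀ (xs : List X) → sumL xs (λ _ → 0#) ≈ 0#
    sum-0 []       = refl
    sum-0 (x ∷ xs) = trans (+-identityˡ _) (sum-0 xs)

    sum-+ : ∀ (xs : List X) f g → sumL xs (λ x → f x + g x) ≈ sumL xs f + sumL xs g
    sum-+ []       f g = sym (+-identityˡ _)
    sum-+ (x ∷ xs) f g = trans (+-congˡ (sum-+ xs f g)) (interchange _ _ _ _)

    sum-*ˡ : ∀ (xs : List X) a f → sumL xs (λ x → a * f x) ≈ a * sumL xs f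
    sum-*ˡ []       a f = sym (zeroʳ a)
    sum-*ˡ (x ∷ xs) a f = trans (+-congˡ (sum-*ˡ xs a f)) (sym (distribˡ _ _ _))

    sum-neg : ∀ (xs : List X) f → sumL xs (λ x → - f x) ≈ - sumL xs f
    sum-neg []       f = sym -0#≈0#
    sum-neg (x ∷ xs) f = trans (+-congˡ (sum-neg xs f)) (⁻¹-∙-comm _ _)

    sum-++ : ∀ (xs ys : List X) f → sumL (xs ++ ys) f ≈ sumL xs f + sumL ys f
    sum-++ []       ys f = sym (+-identityˡ _)
    sum-++ (x ∷ xs) ys f = trans (+-congˡ (sum-++ xs ys f)) (sym (+-assoc _ _ _))

  sum-map : ∀ {X Y : Set} (h : X → Y) xs f → sumL (List.map h xs) f ≡ sumL xs (λ x → f (h x))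
  sum-map h []       f = ≡.refl
  sum-map h (x ∷ xs) f = ≡.cong (λ s → f (h x) + s) (sum-map h xs f)

  sum-concatMap : ∀ {X Y : Set} (h : X → List Y) xs f →
    sumL (concatMap h xs) f ≈ sumL xs (λ x → sumL (h x) f)
  sum-concatMap h []       f = refl
  sum-concatMap h (x ∷ xs) f =
    trans (sum-++ (h x) (concatMap h xs) f) (+-congˡ (sum-concatMap h xs f))

  sum-swap : ∀ {X Y : Set} (xs : List X) (ys : List Y) (f : X → Y → Carrier) →
    sumL xs (λ x → sumL ys (f x)) ≈ sumL ys (λ y → sumL xs (λ x → f x y))
  sum-swap []       ys f = sym (sum-0 ys)
  sum-swap (x ∷ xs) ys f = trans (+-congˡ (sum-swap xs ys f)) (sym (sum-+ ys _ _))

-- Monoid algebras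

module MonoidAlgebra
  (𝕂 : Ring₀) {M : Set} (_∙_ : M → M → M) (ε : M) (isCM : IsCommutativeMonoid _≡_ _∙_ ε)
  where

  open CommutativeRing 𝕂
  open RingKit 𝕂
  open Algebra.Properties.Ring ring
  open Relation.Binary.Reasoning.Setoid setoid
  private module CM = IsCommutativeMonoid isCM

  Elem : Set
  Elem = List (Carrier × M)

  mono : Carrier → M → Elem
  mono c m = (c , m) ∷ []

  infixl 7 _⊛_
  mulTerm : Carrier × M → Carrier × M → Carrier × M
  mulTerm s t = proj₁ s * proj₁ t , proj₂ s ∙ proj₂ t

  _⊛_ : Elem → Elem → Elem
  p ⊛ q = concatMap (λ s → List.map (mulTerm s) q) p

  neg : Elem → Elem
  neg = List.map (λ t → - proj₁ t , proj₂ t)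

  unit : Elem
  unit = mono 1# ε

  -- The linear extension of φ from the monoid to formal sums. Elements are compared only through
  -- such functionals, never as lists.
  pair : Elem → (M → Carrier) → Carrier
  pair p φ = sumL p (λ t → proj₁ t * φ (proj₂ t))

  pair-cong : ∀ p {φ ψ} → (∀ m → φ m ≈ ψ m) → pair p φ ≈ pair p ψ
  pair-cong p φ≈ψ = sum-cong p (λ t → *-congˡ (φ≈ψ (proj₂ t)))

  pair-mono : ∀ c m φ → pair (mono c m) φ ≈ c * φ m
  pair-mono c m φ = +-identityʳ _

  pair-++ : ∀ p q φ → pair (p ++ q) φ ≈ pair p φ + pair q φ
  pair-++ p q φ = sum-++ p q _

  pair-neg : ∀ p φ → pair (neg p) φ ≈ - pair p φ
  pair-neg p φ = begin
    pair (neg p) φ                               ≡⟨ sum-map _ p _ ⟩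
    sumL p (λ t → - proj₁ t * φ (proj₂ t))       ≈⟨ sum-cong p (λ t → sym (-‿distribˡ-* _ _)) ⟩
    sumL p (λ t → - (proj₁ t * φ (proj₂ t)))     ≈⟨ sum-neg p _ ⟩
    - pair p φ                                   ∎

  pair-⊛ : ∀ p q φ → pair (p ⊛ q) φ ≈ pair p (λ m → pair q (λ m′ → φ (m ∙ m′)))
  pair-⊛ p q φ = begin
    pair (p ⊛ q) φ
      ≈⟨ sum-concatMap _ p _ ⟩
    sumL p (λ s → sumL (List.map (mulTerm s) q) (λ t → proj₁ t * φ (proj₂ t)))
      ≈⟨ sum-cong p (λ s → trans (reflexive (sum-map (mulTerm s) q _))
           (trans (sum-cong q (λ t → *-assoc _ _ _)) (sum-*ˡ q _ _))) ⟩
    pair p (λ m → pair q (λ m′ → φ (m ∙ m′))) ∎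

  pair-+ : ∀ p φ ψ → pair p (λ m → φ m + ψ m) ≈ pair p φ + pair p ψ
  pair-+ p φ ψ = trans (sum-cong p (λ t → distribˡ _ _ _)) (sum-+ p _ _)

  pair-* : ∀ p c φ → pair p (λ m → c * φ m) ≈ c * pair p φ
  pair-* p c φ = trans (sum-cong p (λ t → solve 3 (λ x y z → x :* (y :* z) := y :* (x :* z)) refl _ _ _))
                       (sum-*ˡ p c _)

  pair-0 : ∀ p → pair p (λ _ → 0#) ≈ 0#
  pair-0 p = trans (sum-cong p (λ t → zeroʳ _)) (sum-0 p)

  pair-sum : ∀ {X : Set} p (xs : List X) (f : X → M → Carrier) →
    pair p (λ m → sumL xs (λ x → f x m)) ≈ sumL xs (λ x → pair p (f x))
  pair-sum p xs f = trans (sum-cong p (λ t → sym (sum-*ˡ xs _ _))) (sum-swap p xs _)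

  -- Holds at every functional, so it is available in each quotient; there it turns congruence in
  -- the right factor into congruence in the left one.
  ⊛-comm-pair : ∀ p q φ → pair (p ⊛ q) φ ≈ pair (q ⊛ p) φ
  ⊛-comm-pair p q φ = begin
    pair (p ⊛ q) φ                             ≈⟨ pair-⊛ p q φ ⟩
    pair p (λ m → pair q (λ m′ → φ (m ∙ m′)))  ≈⟨ sum-cong p (λ s → sym (pair-* q _ _)) ⟩
    sumL p (λ s → pair q (λ m′ → proj₁ s * φ (proj₂ s ∙ m′)))
      ≈⟨ pair-sum q p (λ s m′ → proj₁ s * φ (proj₂ s ∙ m′)) ⟨
    pair q (λ m′ → pair p (λ m → φ (m ∙ m′)))
      ≈⟨ pair-cong q (λ m′ → pair-cong p (λ m → reflexive (≡.cong φ (CM.comm m m′)))) ⟩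
    pair q (λ m′ → pair p (λ m → φ (m′ ∙ m)))  ≈⟨ pair-⊛ q p φ ⟨
    pair (q ⊛ p) φ                             ∎

  -- Elements are unnormalised formal sums; two are equal when no functional in
  -- the family Φ separates them, so a smaller Φ gives a quotient ring.
  module Quotient
    (Φ : (M → Carrier) → Set) (Φ-shift : ∀ {φ} m → Φ φ → Φ (λ x → φ (m ∙ x))) where

    infix 4 _≋_
    record _≋_ (p q : Elem) : Set where
      constructor same
      field at : ∀ φ → Φ φ → pair p φ ≈ pair q φ
    open _≋_ public

    -- Pairing p ⊛ q with φ pairs q with the shifts of φ by the monomials of p. This is why Φ has to
    -- be closed under shifts: its annihilator is then an ideal.
    ⊛-congˡ : ∀ p {q q′} → q ≋ q′ → p ⊛ q ≋ p ⊛ q′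
    ⊛-congˡ p {q} {q′} eq .at φ h = begin
      pair (p ⊛ q) φ                              ≈⟨ pair-⊛ p q φ ⟩
      pair p (λ m → pair q (λ m′ → φ (m ∙ m′)))   ≈⟨ pair-cong p (λ m → at eq _ (Φ-shift m h)) ⟩
      pair p (λ m → pair q′ (λ m′ → φ (m ∙ m′)))  ≈⟨ pair-⊛ p q′ φ ⟨
      pair (p ⊛ q′) φ                             ∎

    ⊛-cong : ∀ {p p′ q q′} → p ≋ p′ → q ≋ q′ → p ⊛ q ≋ p′ ⊛ q′
    ⊛-cong {p} {p′} {q} {q′} e e′ .at φ h = begin
      pair (p ⊛ q) φ   ≈⟨ at (⊛-congˡ p e′) φ h ⟩
      pair (p ⊛ q′) φ  ≈⟨ ⊛-comm-pair p q′ φ ⟩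
      pair (q′ ⊛ p) φ  ≈⟨ at (⊛-congˡ q′ e) φ h ⟩
      pair (q′ ⊛ p′) φ ≈⟨ ⊛-comm-pair q′ p′ φ ⟩
      pair (p′ ⊛ q′) φ ∎

    ⊛-assoc : ∀ p q r → (p ⊛ q) ⊛ r ≋ p ⊛ (q ⊛ r)
    ⊛-assoc p q r .at φ _ = begin
      pair ((p ⊛ q) ⊛ r) φ
        ≈⟨ pair-⊛ (p ⊛ q) r φ ⟩
      pair (p ⊛ q) (λ m → pair r (λ z → φ (m ∙ z)))
        ≈⟨ pair-⊛ p q _ ⟩
      pair p (λ x → pair q (λ y → pair r (λ z → φ ((x ∙ y) ∙ z))))
        ≈⟨ pair-cong p (λ x → pair-cong q (λ y → pair-cong r (λ z → reflexive (≡.cong φ (CM.assoc x y z))))) ⟩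
      pair p (λ x → pair q (λ y → pair r (λ z → φ (x ∙ (y ∙ z)))))
        ≈⟨ pair-cong p (λ x → pair-⊛ q r _) ⟨
      pair p (λ x → pair (q ⊛ r) (λ y → φ (x ∙ y)))
        ≈⟨ pair-⊛ p (q ⊛ r) φ ⟨
      pair (p ⊛ (q ⊛ r)) φ ∎

    ⊛-identityˡ : ∀ p → unit ⊛ p ≋ p
    ⊛-identityˡ p .at φ _ = begin
      pair (unit ⊛ p) φ                   ≈⟨ pair-⊛ unit p φ ⟩
      pair unit (λ m → pair p (λ m′ → φ (m ∙ m′))) ≈⟨ pair-mono 1# ε (λ m → pair p (λ m′ → φ (m ∙ m′))) ⟩
      1# * pair p (λ m → φ (ε ∙ m))       ≈⟨ *-identityˡ _ ⟩
      pair p (λ m → φ (ε ∙ m))            ≈⟨ pair-cong p (λ m → reflexive (≡.cong φ (CM.identityˡ m))) ⟩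
      pair p φ                            ∎

    ⊛-distribʳ : ∀ p q r → (q ++ r) ⊛ p ≋ (q ⊛ p) ++ (r ⊛ p)
    ⊛-distribʳ p q r .at φ _ = begin
      pair ((q ++ r) ⊛ p) φ                 ≈⟨ pair-⊛ (q ++ r) p φ ⟩
      pair (q ++ r) _                       ≈⟨ pair-++ q r _ ⟩
      pair q _ + pair r _                   ≈⟨ +-cong (pair-⊛ q p φ) (pair-⊛ r p φ) ⟨
      pair (q ⊛ p) φ + pair (r ⊛ p) φ       ≈⟨ pair-++ (q ⊛ p) (r ⊛ p) φ ⟨
      pair ((q ⊛ p) ++ (r ⊛ p)) φ           ∎

    algebra : Ring₀
    algebra = record
      { Carrier = Elem ; _≈_ = _≋_ ; _+_ = _++_ ; _*_ = _⊛_ ; -_ = neg ; 0# = [] ; 1# = unit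
      ; isCommutativeRing = record
        { isRing = record
          { +-isAbelianGroup = record
            { isGroup = record
              { isMonoid = record
                { isSemigroup = record
                  { isMagma = record
                    { isEquivalence = record
                      { refl  = same (λ φ _ → refl)
                      ; sym   = λ e → same (λ φ h → sym (at e φ h))
                      ; trans = λ e e′ → same (λ φ h → trans (at e φ h) (at e′ φ h)) }
                    ; ∙-cong = λ {p} {p′} {q} {q′} e e′ → same (λ φ h →
                        trans (pair-++ p q φ) (trans (+-cong (at e φ h) (at e′ φ h)) (sym (pair-++ p′ q′ φ)))) }
                  ; assoc = λ p q r → same (λ φ _ → begin
                      pair ((p ++ q) ++ r) φ            ≈⟨ trans (pair-++ (p ++ q) r φ) (+-congʳ (pair-++ p q φ)) ⟩
                      pair p φ + pair q φ + pair r φ    ≈⟨ +-assoc _ _ _ ⟩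
                      pair p φ + (pair q φ + pair r φ)  ≈⟨ trans (pair-++ p (q ++ r) φ) (+-congˡ (pair-++ q r φ)) ⟨
                      pair (p ++ (q ++ r)) φ            ∎) }
                ; identity = (λ p → same (λ φ _ → refl))
                           , (λ p → same (λ φ _ → trans (pair-++ p [] φ) (+-identityʳ _))) }
              ; inverse = (λ p → same (λ φ _ → trans (pair-++ (neg p) p φ) (trans (+-congʳ (pair-neg p φ)) (-‿inverseˡ _))))
                        , (λ p → same (λ φ _ → trans (pair-++ p (neg p) φ) (trans (+-congˡ (pair-neg p φ)) (-‿inverseʳ _))))
              ; ⁻¹-cong = λ {p} {q} e → same (λ φ h → trans (pair-neg p φ) (trans (-‿cong (at e φ h)) (sym (pair-neg q φ)))) }
            ; comm = λ p q → same (λ φ _ → trans (pair-++ p q φ) (trans (+-comm _ _) (sym (pair-++ q p φ)))) }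
          ; *-cong = ⊛-cong
          ; *-assoc = ⊛-assoc
          ; *-identity = ⊛-identityˡ
                       , (λ p → same (λ φ h → trans (⊛-comm-pair p unit φ) (at (⊛-identityˡ p) φ h)))
          ; distrib = (λ p q r → same (λ φ h → begin
                         pair (p ⊛ (q ++ r)) φ              ≈⟨ ⊛-comm-pair p (q ++ r) φ ⟩
                         pair ((q ++ r) ⊛ p) φ              ≈⟨ at (⊛-distribʳ p q r) φ h ⟩
                         pair ((q ⊛ p) ++ (r ⊛ p)) φ        ≈⟨ pair-++ (q ⊛ p) (r ⊛ p) φ ⟩
                         pair (q ⊛ p) φ + pair (r ⊛ p) φ    ≈⟨ +-cong (⊛-comm-pair q p φ) (⊛-comm-pair r p φ) ⟩
                         pair (p ⊛ q) φ + pair (p ⊛ r) φ    ≈⟨ pair-++ (p ⊛ q) (p ⊛ r) φ ⟨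
                         pair ((p ⊛ q) ++ (p ⊛ r)) φ        ∎))
                    , ⊛-distribʳ }
        ; *-comm = λ p q → same (λ φ _ → ⊛-comm-pair p q φ) } }

-- Vandermonde products and their Laplace expansion

swapAt : ∀ {A : Set} {n} → ℕ → Vec A n → Vec A n
swapAt zero    []           = []
swapAt (suc i) []           = []
swapAt zero    (x ∷ [])     = x ∷ []
swapAt zero    (x ∷ y ∷ xs) = y ∷ x ∷ xs
swapAt (suc i) (x ∷ xs)     = x ∷ swapAt i xs

module Vandermonde (𝕂 : Ring₀) where
  open CommutativeRing 𝕂
  open RingKit 𝕂
  open Relation.Binary.Reasoning.Setoid setoid

  private variable n : ℕ

  pow : Carrier → ℕ → Carrier
  pow x zero    = 1#
  pow x (suc p) = x * pow x p

  pairTerm : Carrier → Carrier → Carrier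
  pairTerm x y = (x - y) * (1# + y + x * y)

  -- V collects the factors x - y, W the factors 1 + y + xy, and D both. They are kept apart because
  -- V is expanded along powers, while W only simplifies after one variable is raised to its highest
  -- surviving power.
  rowV rowW rowD : Carrier → Vec Carrier n → Carrier
  rowV x []       = 1#
  rowV x (y ∷ ys) = (x - y) * rowV x ys
  rowW x []       = 1#
  rowW x (y ∷ ys) = (1# + y + x * y) * rowW x ys
  rowD x []       = 1#
  rowD x (y ∷ ys) = pairTerm x y * rowD x ys

  prodV prodW prodD : Vec Carrier n → Carrier
  prodV []       = 1#
  prodV (x ∷ xs) = rowV x xs * prodV xs
  prodW []       = 1#
  prodW (x ∷ xs) = rowW x xs * prodW xs
  prodD []       = 1#
  prodD (x ∷ xs) = rowD x xs * prodD xs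

  rowD≈ : ∀ x (ys : Vec Carrier n) → rowD x ys ≈ rowW x ys * rowV x ys
  rowD≈ x []       = sym (*-identityˡ _)
  rowD≈ x (y ∷ ys) = trans (*-congˡ (rowD≈ x ys))
    (solve 4 (λ a b c d → (a :* b) :* (c :* d) := (b :* c) :* (a :* d)) refl
       (x - y) (1# + y + x * y) (rowW x ys) (rowV x ys))

  prodD≈ : ∀ (xs : Vec Carrier n) → prodD xs ≈ prodW xs * prodV xs
  prodD≈ []       = sym (*-identityˡ _)
  prodD≈ (x ∷ xs) = trans (*-cong (rowD≈ x xs) (prodD≈ xs))
    (solve 4 (λ a b c d → (a :* b) :* (c :* d) := (a :* c) :* (b :* d)) refl
       (rowW x xs) (rowV x xs) (prodW xs) (prodV xs))

  -- Σⱼ (-1)ʲ f(xⱼ) Ψ(xs without xⱼ)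
  altSum : (Carrier → Carrier) → Vec Carrier (suc n) → (Vec Carrier n → Carrier) → Carrier
  altSum f (x ∷ [])     Ψ = f x * Ψ []
  altSum f (x ∷ y ∷ ys) Ψ = f x * Ψ (y ∷ ys) - altSum f (y ∷ ys) (λ zs → Ψ (x ∷ zs))

  altSum-cong : ∀ {f g} (xs : Vec Carrier (suc n)) {Ψ Θ} →
    All (λ x → f x ≈ g x) xs → (∀ zs → Ψ zs ≈ Θ zs) → altSum f xs Ψ ≈ altSum g xs Θ
  altSum-cong (x ∷ [])     (e ∷ _)  eΨ = *-cong e (eΨ _)
  altSum-cong (x ∷ y ∷ ys) (e ∷ es) eΨ =
    +-cong (*-cong e (eΨ _)) (-‿cong (altSum-cong (y ∷ ys) es (λ zs → eΨ (x ∷ zs))))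

  altSum-congˡ : ∀ {f g} (xs : Vec Carrier (suc n)) {Ψ} →
    (∀ x → f x ≈ g x) → altSum f xs Ψ ≈ altSum g xs Ψ
  altSum-congˡ xs e = altSum-cong xs (All.universal e xs) (λ _ → refl)

  altSum-+ : ∀ f g (xs : Vec Carrier (suc n)) Ψ →
    altSum (λ x → f x + g x) xs Ψ ≈ altSum f xs Ψ + altSum g xs Ψ
  altSum-+ f g (x ∷ [])     Ψ = distribʳ _ _ _
  altSum-+ f g (x ∷ y ∷ ys) Ψ = trans (+-congˡ (-‿cong (altSum-+ f g (y ∷ ys) _)))
    (solve 5 (λ a b c d e → (a :+ b) :* c :- (d :+ e) := (a :* c :- d) :+ (b :* c :- e)) refl _ _ _ _ _)

  altSum-*ˡ : ∀ c f (xs : Vec Carrier (suc n)) Ψ →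
    altSum (λ x → c * f x) xs Ψ ≈ c * altSum f xs Ψ
  altSum-*ˡ c f (x ∷ [])     Ψ = *-assoc _ _ _
  altSum-*ˡ c f (x ∷ y ∷ ys) Ψ = trans (+-congˡ (-‿cong (altSum-*ˡ c f (y ∷ ys) _)))
    (solve 4 (λ c a b d → (c :* a) :* b :- c :* d := c :* (a :* b :- d)) refl _ _ _ _)

  altSum-*ʳ : ∀ c f (xs : Vec Carrier (suc n)) Ψ →
    altSum f xs (λ zs → c * Ψ zs) ≈ c * altSum f xs Ψ
  altSum-*ʳ c f (x ∷ [])     Ψ = solve 3 (λ a b c → a :* (b :* c) := b :* (a :* c)) refl _ _ _
  altSum-*ʳ c f (x ∷ y ∷ ys) Ψ = trans (+-congˡ (-‿cong (altSum-*ʳ c f (y ∷ ys) _)))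
    (solve 4 (λ c a b d → a :* (c :* b) :- c :* d := c :* (a :* b :- d)) refl _ _ _ _)

  -- For each omitted y the factor x - y completes the product over the remaining entries to the
  -- full `rowV x ys`, which then comes out of the sum.
  altSum-rowV : ∀ x f (ys : Vec Carrier (suc n)) Ψ →
    altSum (λ y → (x - y) * f y) ys (λ zs → rowV x zs * Ψ zs) ≈ rowV x ys * altSum f ys Ψ
  altSum-rowV x f (y ∷ [])     Ψ =
    solve 3 (λ a b c → (a :* b) :* (:1 :* c) := (a :* :1) :* (b :* c)) refl _ _ _
  altSum-rowV x f (y ∷ z ∷ zs) Ψ = begin
    (x - y) * f y * (rowV x (z ∷ zs) * Ψ (z ∷ zs)) - altSum _ (z ∷ zs) (λ ws → (x - y) * rowV x ws * Ψ (y ∷ ws))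
      ≈⟨ +-congˡ (-‿cong (trans (altSum-cong (z ∷ zs) (All.universal (λ _ → refl) _) (λ ws → *-assoc _ _ _))
           (altSum-*ʳ (x - y) _ (z ∷ zs) (λ ws → rowV x ws * Ψ (y ∷ ws))))) ⟩
    (x - y) * f y * (rowV x (z ∷ zs) * Ψ (z ∷ zs)) - (x - y) * altSum _ (z ∷ zs) (λ ws → rowV x ws * Ψ (y ∷ ws))
      ≈⟨ +-congˡ (-‿cong (*-congˡ (altSum-rowV x f (z ∷ zs) _))) ⟩
    (x - y) * f y * (rowV x (z ∷ zs) * Ψ (z ∷ zs)) - (x - y) * (rowV x (z ∷ zs) * altSum f (z ∷ zs) (λ ws → Ψ (y ∷ ws)))
      ≈⟨ solve 5 (λ d f r p s → d :* f :* (r :* p) :- d :* (r :* s) := (d :* r) :* (f :* p :- s)) refl _ _ _ _ _ ⟩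
    (x - y) * rowV x (z ∷ zs) * (f y * Ψ (z ∷ zs) - altSum f (z ∷ zs) (λ ws → Ψ (y ∷ ws))) ∎

  -- The quotient (R(x) - R(y)) / (x - y) with R = Π (· - r); at y = rⱼ it is
  -- the product over the remaining roots.
  diffQuot : Carrier → Vec Carrier n → Carrier → Carrier
  diffQuot x []       y = 0#
  diffQuot x (r ∷ rs) y = rowV x rs + (y - r) * diffQuot x rs y

  -- R(y) = 0 at a root y, so R(x) - R(y) is R(x) there.
  diffQuot-root : ∀ x (rs : Vec Carrier n) → All (λ y → rowV x rs ≈ (x - y) * diffQuot x rs y) rs
  diffQuot-root x []       = []
  diffQuot-root x (r ∷ rs) =
    -- At y = r the factor r - r removes the recursive part of the quotient, whatever its value.
    solve 4 (λ x r v g → (x :- r) :* v := (x :- r) :* (v :+ (r :- r) :* g)) refl _ _ _ _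
    ∷ All.map (λ {y} e → begin
        (x - r) * rowV x rs
          ≈⟨ solve 4 (λ x r y v → (x :- r) :* v := (x :- y) :* v :+ (y :- r) :* v) refl x r y _ ⟩
        (x - y) * rowV x rs + (y - r) * rowV x rs
          ≈⟨ +-congˡ (*-congˡ e) ⟩
        (x - y) * rowV x rs + (y - r) * ((x - y) * diffQuot x rs y)
          ≈⟨ solve 5 (λ x r y v g → (x :- y) :* v :+ (y :- r) :* ((x :- y) :* g)
                       := (x :- y) :* (v :+ (y :- r) :* g)) refl x r y _ _ ⟩
        (x - y) * (rowV x rs + (y - r) * diffQuot x rs y) ∎) (diffQuot-root x rs)

  -- The product over the entries other than y becomes the value at y of one polynomial that no
  -- longer depends on which entry is omitted. This replaces a division by x - y, which may be a
  -- zero divisor.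
  altSum-diffQuot : ∀ x f (rs : Vec Carrier (suc n)) Ψ →
    altSum f rs (λ zs → rowV x zs * Ψ zs) ≈ altSum (λ y → f y * diffQuot x rs y) rs Ψ
  altSum-diffQuot x f (r ∷ []) Ψ =
    solve 3 (λ a b r → a :* (:1 :* b) := a :* (:1 :+ (r :- r) :* :0) :* b) refl (f r) (Ψ []) r
  altSum-diffQuot x f (r ∷ s ∷ ss) Ψ = +-cong
    (solve 5 (λ a v r g b → a :* (v :* b) := a :* (v :+ (r :- r) :* g) :* b) refl _ _ _ _ _)
    (-‿cong (begin
      altSum f (s ∷ ss) (λ zs → (x - r) * rowV x zs * Ψ (r ∷ zs))
        ≈⟨ altSum-cong (s ∷ ss) (All.universal (λ _ → refl) _) (λ zs → *-assoc _ _ _) ⟩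
      altSum f (s ∷ ss) (λ zs → (x - r) * (rowV x zs * Ψ (r ∷ zs)))
        ≈⟨ altSum-*ʳ (x - r) f (s ∷ ss) (λ zs → rowV x zs * Ψ (r ∷ zs)) ⟩
      (x - r) * altSum f (s ∷ ss) (λ zs → rowV x zs * Ψ (r ∷ zs))
        ≈⟨ *-congˡ (altSum-diffQuot x f (s ∷ ss) _) ⟩
      (x - r) * altSum (λ y → f y * diffQuot x (s ∷ ss) y) (s ∷ ss) _
        ≈⟨ altSum-*ˡ (x - r) _ (s ∷ ss) _ ⟨
      altSum (λ y → (x - r) * (f y * diffQuot x (s ∷ ss) y)) (s ∷ ss) _
        ≈⟨ altSum-cong (s ∷ ss) (All.map (λ {y} e → begin
             (x - r) * (f y * diffQuot x (s ∷ ss) y)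
               ≈⟨ solve 5 (λ x r y a g → (x :- r) :* (a :* g) := a :* ((x :- y) :* g :+ (y :- r) :* g))
                    refl x r y _ _ ⟩
             f y * ((x - y) * diffQuot x (s ∷ ss) y + (y - r) * diffQuot x (s ∷ ss) y)
               ≈⟨ *-congˡ (+-congʳ (sym e)) ⟩
             f y * diffQuot x (r ∷ s ∷ ss) y ∎) (diffQuot-root x (s ∷ ss))) (λ _ → refl) ⟩
      altSum (λ y → f y * diffQuot x (r ∷ s ∷ ss) y) (s ∷ ss) _ ∎))

  -- diffQuot x rs is monic of degree |rs| - 1 in its last argument.
  altSum-monic : ∀ x {d} (rs : Vec Carrier (suc d)) (xs : Vec Carrier (suc n)) →
    (∀ p → p ℕ.< n → altSum (λ y → pow y p) xs prodV ≈ 0#) →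
    ∀ p → p ℕ.+ d ℕ.≤ n →
    altSum (λ y → pow y p * diffQuot x rs y) xs prodV ≈ altSum (λ y → pow y (p ℕ.+ d)) xs prodV
  altSum-monic x (r ∷ []) xs low p p+d≤n = altSum-congˡ xs (λ y → trans
    (solve 3 (λ a y r → a :* (:1 :+ (y :- r) :* :0) := a) refl (pow y p) y r)
    (reflexive (≡.cong (pow y) (≡.sym (ℕP.+-identityʳ p)))))
  altSum-monic {n} x {suc d} (r ∷ s ∷ ss) xs low p p+d≤n = begin
    S (λ y → pow y p * (rowV x rs + (y - r) * q y))
      ≈⟨ altSum-congˡ xs (λ y → solve 5 (λ a v y r g → a :* (v :+ (y :- r) :* g)
           := (v :* a :+ :- r :* (a :* g)) :+ (y :* a) :* g) refl (pow y p) (rowV x rs) y r (q y)) ⟩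
    S (λ y → (rowV x rs * pow y p + - r * (pow y p * q y)) + pow y (suc p) * q y)
      ≈⟨ trans (altSum-+ _ _ xs _) (+-congʳ (trans (altSum-+ _ _ xs _)
           (+-cong (altSum-*ˡ _ _ xs _) (altSum-*ˡ _ _ xs _)))) ⟩
    (rowV x rs * S (λ y → pow y p) + - r * S (λ y → pow y p * q y)) + S (λ y → pow y (suc p) * q y)
      -- The first two sums have degree below n in y and vanish by `low`, the second after the
      -- induction hypothesis has reduced it to a single power. Only the last one keeps the top
      -- degree.
      ≈⟨ +-cong (+-cong (*-congˡ (low p (ℕP.m+n≤o⇒m≤o (suc p) p+d<n)))
           (*-congˡ (trans (altSum-monic x rs xs low p (ℕP.<⇒≤ p+d<n)) (low (p ℕ.+ d) p+d<n))))
           (altSum-monic x rs xs low (suc p) p+d<n) ⟩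
    (rowV x rs * 0# + - r * 0#) + S (λ y → pow y (suc p ℕ.+ d))
      ≈⟨ solve 3 (λ a b c → (a :* :0 :+ :- b :* :0) :+ c := c) refl _ _ _ ⟩
    S (λ y → pow y (suc p ℕ.+ d))
      ≈⟨ altSum-congˡ xs (λ y → reflexive (≡.cong (pow y) (≡.sym (ℕP.+-suc p d)))) ⟩
    S (λ y → pow y (p ℕ.+ suc d)) ∎
    where
    rs = s ∷ ss
    q : Carrier → Carrier
    q = diffQuot x rs
    S : (Carrier → Carrier) → Carrier
    S f = altSum f xs prodV
    p+d<n : suc (p ℕ.+ d) ℕ.≤ n
    p+d<n = ≡.subst (ℕ._≤ n) (ℕP.+-suc p d) p+d≤n

  -- Expansion of the Vandermonde determinant along a row of p-th powers: two equal rows for p < n,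
  -- the determinant itself for p = n. One induction gives both. Raising p uses y·y^p = x·y^p - (x -
  -- y)·y^p, where x - y moves the second part to the shorter vector. For p = 0 the quotient
  -- `diffQuot`, monic of degree n, reduces the sum over the shorter vector to the case of its top
  -- power.
  vandermonde : ∀ n (xs : Vec Carrier (suc n)) →
    (∀ p → p ℕ.< n → altSum (λ y → pow y p) xs prodV ≈ 0#)
    × altSum (λ y → pow y n) xs prodV ≈ prodV xs
  vandermonde zero (x ∷ []) = (λ p ()) , refl
  vandermonde (suc n) (x ∷ xs@(x₁ ∷ xs₁)) = low , (begin
      S (suc n)                                     ≈⟨ step n ⟩
      x * S n + rowV x xs * S′ n                    ≈⟨ +-cong (*-congˡ (low n ℕP.≤-refl)) (*-congˡ (proj₂ IH)) ⟩
      x * 0# + rowV x xs * prodV xs                 ≈⟨ trans (+-congʳ (zeroʳ x)) (+-identityˡ _) ⟩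
      rowV x xs * prodV xs                          ∎)
    where
    IH = vandermonde n xs
    S S′ : ℕ → Carrier
    S p = altSum (λ y → pow y p) (x ∷ xs) prodV
    S′ p = altSum (λ y → pow y p) xs prodV
    step : ∀ p → S (suc p) ≈ x * S p + rowV x xs * S′ p
    step p = begin
      x * pow x p * prodV xs - altSum (λ y → y * pow y p) xs (λ zs → rowV x zs * prodV zs)
        ≈⟨ +-congˡ (-‿cong (trans
             (altSum-congˡ xs (λ y → solve 3 (λ x y a → y :* a := x :* a :+ :- :1 :* ((x :- y) :* a)) refl x y (pow y p)))
             (trans (altSum-+ _ _ xs _) (+-cong (altSum-*ˡ x _ xs _)
               (trans (altSum-*ˡ (- 1#) _ xs _) (*-congˡ (altSum-rowV x _ xs prodV))))))) ⟩
      x * pow x p * prodV xs - (x * altSum (λ y → pow y p) xs (λ zs → rowV x zs * prodV zs) + - 1# * (rowV x xs * S′ p))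
        ≈⟨ solve 5 (λ x a v s t → x :* a :* v :- (x :* s :+ :- :1 :* t) := x :* (a :* v :- s) :+ t) refl x _ _ _ _ ⟩
      x * S p + rowV x xs * S′ p ∎
    low : ∀ p → p ℕ.< suc n → S p ≈ 0#
    low zero _ = begin
      1# * prodV xs - altSum (λ _ → 1#) xs (λ zs → rowV x zs * prodV zs)
        ≈⟨ +-cong (*-identityˡ _) (-‿cong (altSum-diffQuot x _ xs prodV)) ⟩
      prodV xs - altSum (λ y → 1# * diffQuot x xs y) xs prodV
        ≈⟨ +-congˡ (-‿cong (trans (altSum-monic x xs xs (proj₁ IH) 0 ℕP.≤-refl) (proj₂ IH))) ⟩
      prodV xs - prodV xs
        ≈⟨ -‿inverseʳ _ ⟩
      0# ∎
    low (suc p) (ℕ.s≤s p<n) = begin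
      S (suc p)                        ≈⟨ step p ⟩
      x * S p + rowV x xs * S′ p       ≈⟨ +-cong (*-congˡ (low p (ℕP.m≤n⇒m≤1+n p<n))) (*-congˡ (proj₁ IH p p<n)) ⟩
      x * 0# + rowV x xs * 0#          ≈⟨ trans (+-cong (zeroʳ _) (zeroʳ _)) (+-identityˡ _) ⟩
      0#                               ∎

  prodUp : Vec Carrier n → Carrier
  prodUp []       = 1#
  prodUp (y ∷ ys) = (1# + y) * prodUp ys

  -- An alternating sum of N-th powers in which the omitted variable also leaves behind the product
  -- of 1 + y over the variables after it. This is the remnant of the W-factors containing that
  -- variable when its power N + 1 is zero.
  laplace : ℕ → Vec Carrier (suc n) → (Vec Carrier n → Carrier) → Carrier
  laplace N (x ∷ [])     Ψ = pow x N * Ψ []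
  laplace N (x ∷ y ∷ ys) Ψ =
    pow x N * (prodUp (y ∷ ys) * Ψ (y ∷ ys)) - laplace N (y ∷ ys) (λ zs → Ψ (x ∷ zs))

  laplace-cong : ∀ N (xs : Vec Carrier (suc n)) {Ψ Θ} → (∀ zs → Ψ zs ≈ Θ zs) →
    laplace N xs Ψ ≈ laplace N xs Θ
  laplace-cong N (x ∷ [])     e = *-congˡ (e _)
  laplace-cong N (x ∷ y ∷ ys) e =
    +-cong (*-congˡ (*-congˡ (e _))) (-‿cong (laplace-cong N (y ∷ ys) (λ zs → e (x ∷ zs))))

  laplace-* : ∀ N (xs : Vec Carrier (suc n)) c Ψ → laplace N xs (λ zs → c * Ψ zs) ≈ c * laplace N xs Ψ
  laplace-* N (x ∷ [])     c Ψ = solve 3 (λ a c p → a :* (c :* p) := c :* (a :* p)) refl _ _ _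
  laplace-* N (x ∷ y ∷ ys) c Ψ = trans (+-congˡ (-‿cong (laplace-* N (y ∷ ys) c _)))
    (solve 5 (λ a u c p l → a :* (u :* (c :* p)) :- c :* l := c :* (a :* (u :* p) :- l)) refl _ _ _ _ _)

  laplace-+ : ∀ N (xs : Vec Carrier (suc n)) Ψ Θ →
    laplace N xs (λ zs → Ψ zs + Θ zs) ≈ laplace N xs Ψ + laplace N xs Θ
  laplace-+ N (x ∷ [])     Ψ Θ = distribˡ _ _ _
  laplace-+ N (x ∷ y ∷ ys) Ψ Θ = trans (+-congˡ (-‿cong (laplace-+ N (y ∷ ys) _ _)))
    (solve 6 (λ a u p q l m → a :* (u :* (p :+ q)) :- (l :+ m) := (a :* (u :* p) :- l) :+ (a :* (u :* q) :- m))
      refl _ _ _ _ _ _)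

  laplace-0 : ∀ N (xs : Vec Carrier (suc n)) → laplace N xs (λ _ → 0#) ≈ 0#
  laplace-0 N (x ∷ [])     = zeroʳ _
  laplace-0 N (x ∷ y ∷ ys) = trans (+-cong (trans (*-congˡ (zeroʳ _)) (zeroʳ _)) (-‿cong (laplace-0 N (y ∷ ys))))
    (solve 0 (:0 :- :0 := :0) refl)

  laplace-sum : ∀ {X : Set} N (xs : Vec Carrier (suc n)) (ts : List X) (Ψ : X → Vec Carrier n → Carrier) →
    laplace N xs (λ zs → sumL ts (λ t → Ψ t zs)) ≈ sumL ts (λ t → laplace N xs (Ψ t))
  laplace-sum N xs []       Ψ = laplace-0 N xs
  laplace-sum N xs (t ∷ ts) Ψ = trans (laplace-+ N xs _ _) (+-congˡ (laplace-sum N xs ts Ψ))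

  module _ (N : ℕ) where

    Nil : Carrier → Set
    Nil x = x * pow x N ≈ 0#

    -- Here 1 + y + xy = 1 + (1 + x)y, so a nilpotent second variable leaves the factor 1. In
    -- `pow-rowW` the nilpotent variable comes first and 1 + y survives. This asymmetry is why
    -- `prodUp` runs only over later variables.
    rowW-nil : ∀ x y → Nil y → ∀ r → (1# + y + x * y) * (pow y N * r) ≈ pow y N * r
    rowW-nil x y nil r = begin
      (1# + y + x * y) * (pow y N * r)
        ≈⟨ solve 4 (λ x y a r → (:1 :+ y :+ x :* y) :* (a :* r) := a :* r :+ (:1 :+ x) :* (y :* a) :* r) refl x y _ r ⟩
      pow y N * r + (1# + x) * (y * pow y N) * r
        ≈⟨ +-congˡ (*-congʳ (*-congˡ nil)) ⟩
      pow y N * r + (1# + x) * 0# * r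
        ≈⟨ solve 3 (λ a x r → a :+ (:1 :+ x) :* :0 :* r := a) refl _ x r ⟩
      pow y N * r ∎

    pow-rowW : ∀ x → Nil x → ∀ (ys : Vec Carrier n) r → pow x N * (rowW x ys * r) ≈ pow x N * (prodUp ys * r)
    pow-rowW x nil []       r = refl
    pow-rowW x nil (y ∷ ys) r = begin
      pow x N * ((1# + y + x * y) * rowW x ys * r)
        ≈⟨ solve 5 (λ x y a w r → a :* ((:1 :+ y :+ x :* y) :* w :* r)
             := (:1 :+ y) :* (a :* (w :* r)) :+ y :* (x :* a) :* (w :* r)) refl x y _ _ r ⟩
      (1# + y) * (pow x N * (rowW x ys * r)) + y * (x * pow x N) * (rowW x ys * r)
        ≈⟨ +-cong (*-congˡ (pow-rowW x nil ys r)) (*-congʳ (*-congˡ nil)) ⟩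
      (1# + y) * (pow x N * (prodUp ys * r)) + y * 0# * (rowW x ys * r)
        ≈⟨ solve 5 (λ y a u r z → (:1 :+ y) :* (a :* (u :* r)) :+ y :* :0 :* z
             := a :* ((:1 :+ y) :* u :* r)) refl y _ _ r _ ⟩
      pow x N * ((1# + y) * prodUp ys * r) ∎

    laplace-rowW : ∀ x (ys : Vec Carrier (suc n)) → All Nil ys → ∀ Ψ →
      rowW x ys * laplace N ys Ψ ≈ laplace N ys (λ zs → rowW x zs * Ψ zs)
    laplace-rowW x (y ∷ []) (nil ∷ []) Ψ = begin
      (1# + y + x * y) * 1# * (pow y N * Ψ [])   ≈⟨ *-congʳ (*-identityʳ _) ⟩
      (1# + y + x * y) * (pow y N * Ψ [])        ≈⟨ rowW-nil x y nil _ ⟩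
      pow y N * Ψ []                             ≈⟨ *-congˡ (*-identityˡ _) ⟨
      pow y N * (1# * Ψ [])                      ∎
    laplace-rowW x (y ∷ ys@(_ ∷ _)) (nil ∷ nils) Ψ = begin
      u * w * (pow y N * (prodUp ys * Ψ ys) - laplace N ys (λ zs → Ψ (y ∷ zs)))
        ≈⟨ solve 6 (λ u w a p s l → u :* w :* (a :* (p :* s) :- l) := u :* (a :* (p :* (w :* s))) :- u :* (w :* l))
             refl u w _ _ _ _ ⟩
      u * (pow y N * (prodUp ys * (w * Ψ ys))) - u * (w * laplace N ys (λ zs → Ψ (y ∷ zs)))
        ≈⟨ +-cong (rowW-nil x y nil _) (-‿cong (*-congˡ (laplace-rowW x ys nils _))) ⟩
      pow y N * (prodUp ys * (w * Ψ ys)) - u * laplace N ys (λ zs → rowW x zs * Ψ (y ∷ zs))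
        ≈⟨ +-congˡ (-‿cong (trans (laplace-cong N ys (λ zs → *-assoc _ _ _)) (laplace-* N ys u _))) ⟨
      pow y N * (prodUp ys * (w * Ψ ys)) - laplace N ys (λ zs → u * rowW x zs * Ψ (y ∷ zs)) ∎
      where
      u w : Carrier
      u = 1# + y + x * y
      w = rowW x ys

    altSum-prodW : ∀ (xs : Vec Carrier (suc n)) → All Nil xs → ∀ Ψ →
      prodW xs * altSum (λ y → pow y N) xs Ψ ≈ laplace N xs (λ zs → prodW zs * Ψ zs)
    altSum-prodW (x ∷ [])     _ Ψ = solve 2 (λ a b → :1 :* :1 :* (a :* b) := a :* (:1 :* b)) refl _ _
    altSum-prodW (x ∷ xs@(_ ∷ _)) (nil ∷ nils) Ψ = begin
      rowW x xs * prodW xs * (pow x N * Ψ xs - altSum (λ y → pow y N) xs (λ zs → Ψ (x ∷ zs)))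
        ≈⟨ solve 5 (λ r w a s l → r :* w :* (a :* s :- l) := a :* (r :* (w :* s)) :- r :* (w :* l)) refl _ _ _ _ _ ⟩
      pow x N * (rowW x xs * (prodW xs * Ψ xs)) - rowW x xs * (prodW xs * altSum (λ y → pow y N) xs (λ zs → Ψ (x ∷ zs)))
        ≈⟨ +-cong (pow-rowW x nil xs _) (-‿cong (*-congˡ (altSum-prodW xs nils _))) ⟩
      pow x N * (prodUp xs * (prodW xs * Ψ xs)) - rowW x xs * laplace N xs (λ zs → prodW zs * Ψ (x ∷ zs))
        ≈⟨ +-congˡ (-‿cong (trans (laplace-rowW x xs nils _) (laplace-cong N xs (λ zs → sym (*-assoc _ _ _))))) ⟩
      pow x N * (prodUp xs * (prodW xs * Ψ xs)) - laplace N xs (λ zs → rowW x zs * prodW zs * Ψ (x ∷ zs)) ∎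

  prodD-laplace : ∀ n (xs : Vec Carrier (suc n)) → All (Nil n) xs → prodD xs ≈ laplace n xs prodD
  prodD-laplace n xs nils = begin
    prodD xs                                      ≈⟨ prodD≈ xs ⟩
    prodW xs * prodV xs                           ≈⟨ *-congˡ (proj₂ (vandermonde n xs)) ⟨
    prodW xs * altSum (λ y → pow y n) xs prodV    ≈⟨ altSum-prodW n xs nils prodV ⟩
    laplace n xs (λ zs → prodW zs * prodV zs)     ≈⟨ laplace-cong n xs (λ zs → sym (prodD≈ zs)) ⟩
    laplace n xs prodD                            ∎

  mon : Vec Carrier n → Vec ℕ n → Carrier
  mon []       _ = 1#
  mon (x ∷ xs) e = pow x (Vec.head e) * mon xs (Vec.tail e)

  pow-+ : ∀ x a b → pow x (a ℕ.+ b) ≈ pow x a * pow x b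
  pow-+ x zero    b = sym (*-identityˡ _)
  pow-+ x (suc a) b = trans (*-congˡ (pow-+ x a b)) (sym (*-assoc _ _ _))

  mon-+ : ∀ (xs : Vec Carrier n) e e′ → mon xs (Vec.zipWith ℕ._+_ e e′) ≈ mon xs e * mon xs e′
  mon-+ []       e        e′         = sym (*-identityˡ _)
  mon-+ (x ∷ xs) (a ∷ as) (a′ ∷ as′) = trans (*-cong (pow-+ x a a′) (mon-+ xs as as′))
    (solve 4 (λ a b c d → (a :* b) :* (c :* d) := (a :* c) :* (b :* d)) refl _ _ _ _)

  mon-0 : ∀ (xs : Vec Carrier n) → mon xs (Vec.replicate n 0) ≈ 1#
  mon-0 []       = refl
  mon-0 (x ∷ xs) = trans (*-identityˡ _) (mon-0 xs)

  pairTerm-cong : ∀ {x x′ y y′} → x ≈ x′ → y ≈ y′ → pairTerm x y ≈ pairTerm x′ y′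
  pairTerm-cong e e′ = *-cong (+-cong e (-‿cong e′)) (+-cong (+-congˡ e′) (*-cong e e′))

  rowD-cong : ∀ {x x′} {ys ys′ : Vec Carrier n} → x ≈ x′ → Pointwise _≈_ ys ys′ → rowD x ys ≈ rowD x′ ys′
  rowD-cong e []        = refl
  rowD-cong e (e′ ∷ es) = *-cong (pairTerm-cong e e′) (rowD-cong e es)

  prodD-cong : ∀ {xs xs′ : Vec Carrier n} → Pointwise _≈_ xs xs′ → prodD xs ≈ prodD xs′
  prodD-cong []       = refl
  prodD-cong (e ∷ es) = *-cong (rowD-cong e es) (prodD-cong es)

  rowD-swap : ∀ x i (ys : Vec Carrier n) → rowD x (swapAt i ys) ≈ rowD x ys
  rowD-swap x zero    []           = refl
  rowD-swap x (suc i) []           = refl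
  rowD-swap x zero    (y ∷ [])     = refl
  rowD-swap x zero    (y ∷ z ∷ ys) = solve 3 (λ a b c → a :* (b :* c) := b :* (a :* c)) refl _ _ _
  rowD-swap x (suc i) (y ∷ ys)     = *-congˡ (rowD-swap x i ys)

-- Source and target equalities are not related: the maps below are applied to
-- explicit ring expressions only.
record Hom (R S : Ring₀) : Set where
  private
    module R = CommutativeRing R
    module S = CommutativeRing S
  field
    ⟦_⟧    : R.Carrier → S.Carrier
    +-homo : ∀ x y → ⟦ x R.+ y ⟧ S.≈ ⟦ x ⟧ S.+ ⟦ y ⟧
    *-homo : ∀ x y → ⟦ x R.* y ⟧ S.≈ ⟦ x ⟧ S.* ⟦ y ⟧
    -‿homo : ∀ x → ⟦ R.- x ⟧ S.≈ S.- ⟦ x ⟧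
    1-homo : ⟦ R.1# ⟧ S.≈ S.1#

module HomProperties {R S : Ring₀} (h : Hom R S) where
  open Hom h
  private
    module R = CommutativeRing R
    module VR = Vandermonde R
    module VS = Vandermonde S
  open CommutativeRing S
  private variable n : ℕ

  pow-hom : ∀ x p → VS.pow ⟦ x ⟧ p ≈ ⟦ VR.pow x p ⟧
  pow-hom x zero    = sym 1-homo
  pow-hom x (suc p) = trans (*-congˡ (pow-hom x p)) (sym (*-homo _ _))

  mon-hom : ∀ (xs : Vec R.Carrier n) e → VS.mon (Vec.map ⟦_⟧ xs) e ≈ ⟦ VR.mon xs e ⟧
  mon-hom []       e = sym 1-homo
  mon-hom (x ∷ xs) e = trans (*-cong (pow-hom x (Vec.head e)) (mon-hom xs (Vec.tail e))) (sym (*-homo _ _))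

  prodUp-hom : ∀ (xs : Vec R.Carrier n) → VS.prodUp (Vec.map ⟦_⟧ xs) ≈ ⟦ VR.prodUp xs ⟧
  prodUp-hom []       = sym 1-homo
  prodUp-hom (x ∷ xs) = trans
    (*-cong (sym (trans (+-homo _ _) (+-congʳ 1-homo))) (prodUp-hom xs)) (sym (*-homo _ _))

  rowD-hom : ∀ x (ys : Vec R.Carrier n) → VS.rowD ⟦ x ⟧ (Vec.map ⟦_⟧ ys) ≈ ⟦ VR.rowD x ys ⟧
  rowD-hom x []       = sym 1-homo
  rowD-hom x (y ∷ ys) = trans (*-cong
    (sym (trans (*-homo _ _) (*-cong
      (trans (+-homo _ _) (+-congˡ (-‿homo y)))
      (trans (+-homo _ _) (+-cong (trans (+-homo _ _) (+-congʳ 1-homo)) (*-homo x y))))))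
    (rowD-hom x ys)) (sym (*-homo _ _))

  prodD-hom : ∀ (xs : Vec R.Carrier n) → VS.prodD (Vec.map ⟦_⟧ xs) ≈ ⟦ VR.prodD xs ⟧
  prodD-hom []       = sym 1-homo
  prodD-hom (x ∷ xs) = trans (*-cong (rowD-hom x xs) (prodD-hom xs)) (sym (*-homo _ _))

  laplace-hom : ∀ N (xs : Vec R.Carrier (suc n)) {Ψ Θ} → (∀ zs → Ψ (Vec.map ⟦_⟧ zs) ≈ ⟦ Θ zs ⟧) →
    VS.laplace N (Vec.map ⟦_⟧ xs) Ψ ≈ ⟦ VR.laplace N xs Θ ⟧
  laplace-hom N (x ∷ [])     e = trans (*-cong (pow-hom x N) (e _)) (sym (*-homo _ _))
  laplace-hom N (x ∷ y ∷ ys) e = trans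
    (+-cong (trans (*-cong (pow-hom x N) (trans (*-cong (prodUp-hom (y ∷ ys)) (e _)) (sym (*-homo _ _)))) (sym (*-homo _ _)))
      (trans (-‿cong (laplace-hom N (y ∷ ys) (λ zs → e (x ∷ zs)))) (sym (-‿homo _))))
    (sym (+-homo _ _))

-- The umbral form of the constant term

infixl 6 _+ᵉ_
_+ᵉ_ : ∀ {n} → Vec ℕ n → Vec ℕ n → Vec ℕ n
_+ᵉ_ = Vec.zipWith ℕ._+_

0ᵉ : ∀ {n} → Vec ℕ n
0ᵉ = Vec.replicate _ 0

+ᵉ-isCommutativeMonoid : ∀ n → IsCommutativeMonoid _≡_ (_+ᵉ_ {n}) 0ᵉ
+ᵉ-isCommutativeMonoid n = record
  { isMonoid = record
    { isSemigroup = record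
      { isMagma = record { isEquivalence = ≡.isEquivalence ; ∙-cong = ≡.cong₂ _+ᵉ_ }
      ; assoc = VecP.zipWith-assoc ℕP.+-assoc }
    ; identity = VecP.zipWith-identityˡ ℕP.+-identityˡ , VecP.zipWith-identityʳ ℕP.+-identityʳ }
  ; comm = VecP.zipWith-comm ℕP.+-comm }

module Polynomials (𝕂 : Ring₀) where
  open CommutativeRing 𝕂
  open RingKit 𝕂
  open Relation.Binary.Reasoning.Setoid setoid

  private variable n : ℕ

  module MA (n : ℕ) = MonoidAlgebra 𝕂 _+ᵉ_ 0ᵉ (+ᵉ-isCommutativeMonoid n)
  open module MA′ {n : ℕ} = MA n public

  module Full (n : ℕ) = MA.Quotient n (λ _ → ⊤) (λ _ _ → tt)

  Pol : ℕ → Ring₀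
  Pol n = Full.algebra n

  infix 4 _≃_
  _≃_ : Elem {n} → Elem {n} → Set
  _≃_ {n} = Full._≋_ n

  -- Functionals vanishing on the ideal generated by the (N+1)-st powers of
  -- the variables.
  Killing : ℕ → ∀ {n} → (Vec ℕ n → Carrier) → Set
  Killing N φ = ∀ e → Any (N ℕ.<_) e → φ e ≈ 0#

  Killing-shift : ∀ N {n} {φ : Vec ℕ n → Carrier} m → Killing N φ → Killing N (λ e → φ (m +ᵉ e))
  Killing-shift N m k e big = k _ (grow m big)
    where
    grow : ∀ {n} (m : Vec ℕ n) {e} → Any (N ℕ.<_) e → Any (N ℕ.<_) (m +ᵉ e)
    grow (a ∷ m) (here N<b) = here (ℕP.≤-trans N<b (ℕP.m≤n+m _ a))
    grow (a ∷ m) (there i)  = there (grow m i)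

  module Trunc (N n : ℕ) = MA.Quotient n (Killing N) (Killing-shift N)

  push : ∀ {n m} → (Vec ℕ n → Vec ℕ m) → Elem {n} → Elem {m}
  push f = List.map (λ t → proj₁ t , f (proj₂ t))

  pair-push : ∀ {n m} (f : Vec ℕ n → Vec ℕ m) p φ → pair (push f p) φ ≡ pair p (λ e → φ (f e))
  pair-push f p φ = sum-map _ p _

  push-⊛ : ∀ {n m} (f : Vec ℕ n → Vec ℕ m) → (∀ e e′ → f (e +ᵉ e′) ≡ f e +ᵉ f e′) →
    ∀ p q φ → pair (push f (p ⊛ q)) φ ≈ pair (push f p ⊛ push f q) φ
  push-⊛ f f-+ p q φ = begin
    pair (push f (p ⊛ q)) φ                              ≡⟨ pair-push f (p ⊛ q) φ ⟩
    pair (p ⊛ q) (λ e → φ (f e))                         ≈⟨ pair-⊛ p q _ ⟩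
    pair p (λ e → pair q (λ e′ → φ (f (e +ᵉ e′))))
      ≈⟨ pair-cong p (λ e → pair-cong q (λ e′ → reflexive (≡.cong φ (f-+ e e′)))) ⟩
    pair p (λ e → pair q (λ e′ → φ (f e +ᵉ f e′)))       ≈⟨ pair-cong p (λ e → reflexive (pair-push f q _)) ⟨
    pair p (λ e → pair (push f q) (λ e′ → φ (f e +ᵉ e′))) ≡⟨ pair-push f p _ ⟨
    pair (push f p) (λ e → pair (push f q) (λ e′ → φ (e +ᵉ e′))) ≈⟨ pair-⊛ (push f p) (push f q) φ ⟨
    pair (push f p ⊛ push f q) φ ∎

  -- Each law is verified at every functional, so relabelling exponents is a homomorphism for full
  -- and truncated rings alike. It is used for adding a variable and for exchanging two neighbours.
  pushHom : ∀ {n m} (f : Vec ℕ n → Vec ℕ m) → (∀ e e′ → f (e +ᵉ e′) ≡ f e +ᵉ f e′) → f 0ᵉ ≡ 0ᵉ →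
    (Φ : (Vec ℕ n → Carrier) → Set) (Φ-shift : ∀ {φ} e → Φ φ → Φ (λ x → φ (e +ᵉ x))) →
    (Θ : (Vec ℕ m → Carrier) → Set) (Θ-shift : ∀ {φ} e → Θ φ → Θ (λ x → φ (e +ᵉ x))) →
    Hom (MA.Quotient.algebra n Φ (λ {φ} → Φ-shift {φ})) (MA.Quotient.algebra m Θ (λ {φ} → Θ-shift {φ}))
  pushHom {m = m} f f-+ f-0 _ _ Θ Θ-shift = record
    { ⟦_⟧    = push f
    ; +-homo = λ p q → same λ φ _ → trans (reflexive (pair-push f (p ++ q) φ)) (trans (pair-++ p q _)
        (sym (trans (pair-++ (push f p) (push f q) φ) (+-cong (reflexive (pair-push f p φ)) (reflexive (pair-push f q φ))))))
    ; *-homo = λ p q → same λ φ _ → push-⊛ f f-+ p q φ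
    ; -‿homo = λ p → same λ φ _ → trans (reflexive (pair-push f (neg p) φ)) (trans (pair-neg p _)
        (sym (trans (pair-neg (push f p) φ) (-‿cong (reflexive (pair-push f p φ))))))
    ; 1-homo = same λ φ _ → reflexive (≡.cong (λ e → pair (mono 1# e) φ) f-0) }
    where open MA.Quotient m Θ (λ {φ} → Θ-shift {φ})

  ι : Elem {n} → Elem {suc n}
  ι = push (0 ∷_)

  var₀ : Elem {suc n}
  var₀ = mono 1# (1 ∷ 0ᵉ)

  vars : ∀ n → Vec (Elem {n}) n
  vars zero    = []
  vars (suc n) = var₀ ∷ Vec.map ι (vars n)

  module Evaluation {S : Ring₀} (κ : Hom 𝕂 S) where
    open Hom κ renaming (⟦_⟧ to ⟦_⟧ᴷ)
    private
      module S = CommutativeRing S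
      module SK = RingKit S
      module V = Vandermonde S

    ev : Vec S.Carrier n → Elem {n} → S.Carrier
    ev ys p = SK.sumL p (λ t → ⟦ proj₁ t ⟧ᴷ S.* V.mon ys (proj₂ t))

    open Relation.Binary.Reasoning.Setoid S.setoid renaming (begin_ to beginS_; _∎ to _∎S)

    ev-* : ∀ (ys : Vec S.Carrier n) p q → ev ys (p ⊛ q) S.≈ ev ys p S.* ev ys q
    ev-* ys []      q = S.sym (S.zeroˡ _)
    ev-* ys (s ∷ p) q = S.trans (SK.sum-++ (List.map (mulTerm s) q) (p ⊛ q) _)
      (S.trans (S.+-cong
        (S.trans (S.reflexive (SK.sum-map (mulTerm s) q _)) (S.trans
          (SK.sum-cong q (λ t → S.trans (S.*-cong (*-homo _ _) (V.mon-+ ys _ _))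
            (SK.solve 4 (λ a b c d → (a SK.:* b) SK.:* (c SK.:* d) SK.:= (a SK.:* c) SK.:* (b SK.:* d)) S.refl _ _ _ _)))
          (SK.sum-*ˡ q _ _)))
        (ev-* ys p q)) (S.sym (S.distribʳ _ _ _)))

    ev-neg : ∀ (ys : Vec S.Carrier n) p → ev ys (neg p) S.≈ S.- ev ys p
    ev-neg ys p = S.trans (S.reflexive (SK.sum-map _ p _))
      (S.trans (SK.sum-cong p (λ t → S.trans (S.*-congʳ (-‿homo _))
        (SK.solve 2 (λ a b → SK.:- a SK.:* b SK.:= SK.:- (a SK.:* b)) S.refl _ _)))
      (SK.sum-neg p _))

    evHom : Vec S.Carrier n → Hom (Pol n) S
    evHom ys = record
      { ⟦_⟧    = ev ys
      ; +-homo = λ p q → SK.sum-++ p q _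
      ; *-homo = ev-* ys
      ; -‿homo = ev-neg ys
      ; 1-homo = S.trans (S.+-identityʳ _) (S.trans (S.*-cong 1-homo (V.mon-0 ys)) (S.*-identityˡ _)) }

    ev-ι : ∀ y (ys : Vec S.Carrier n) p → ev (y ∷ ys) (ι p) S.≈ ev ys p
    ev-ι y ys p = S.trans (S.reflexive (SK.sum-map _ p _))
      (SK.sum-cong p (λ t → S.*-congˡ (S.*-identityˡ _)))

    ev-vars : ∀ (ys : Vec S.Carrier n) → Pointwise S._≈_ (Vec.map (ev ys) (vars n)) ys
    ev-vars []                = []
    ev-vars {suc n} (y ∷ ys) =
      S.trans (S.+-identityʳ _) (S.trans (S.*-cong 1-homo (S.trans (S.*-cong (S.*-identityʳ y) (V.mon-0 ys)) (S.*-identityʳ y)))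
        (S.*-identityˡ y))
      ∷ ≡.subst (λ zs → Pointwise S._≈_ zs ys) (VecP.map-∘ _ _ (vars n))
          (PW.trans S.trans (pointwise-map (vars n)) (ev-vars ys))
      where
      pointwise-map : ∀ {m} (ps : Vec (Elem {n}) m) →
        Pointwise S._≈_ (Vec.map (λ p → ev (y ∷ ys) (ι p)) ps) (Vec.map (ev ys) ps)
      pointwise-map []       = []
      pointwise-map (p ∷ ps) = ev-ι y ys p ∷ pointwise-map ps

    -- Makes the product over arbitrary ring elements a value of one fixed polynomial, which linear
    -- functionals can treat monomial by monomial. It serves both for the variables left over in the
    -- Laplace expansion and for the Laurent variables of the theorem.
    prodD-ev : ∀ (ys : Vec S.Carrier n) → V.prodD ys S.≈ ev ys (Vandermonde.prodD (Pol n) (vars n))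
    prodD-ev {n} ys = S.trans (V.prodD-cong (PW.sym S.sym (ev-vars ys)))
      (HomProperties.prodD-hom (evHom ys) (vars n))

-- Constant terms as multilinear forms in slots, and their Laplace expansion

module SlotFunctionals (𝕂 : Ring₀) where
  open CommutativeRing 𝕂
  open RingKit 𝕂
  open Polynomials 𝕂
  open Relation.Binary.Reasoning.Setoid setoid

  private variable n : ℕ

  -- A slot is the linear functional x^e ↦ g e on polynomials in one variable;
  -- composing it with multiplication by 1 + x or x gives up g or dn g.
  Slot : Set
  Slot = ℕ → Carrier

  up dn : Slot → Slot
  up g e = g e + g (suc e)
  dn g e = g (suc e)

  -- Exponents are read through `Vec.head` and `Vec.tail` so that `tens (g ∷ gs)` unfolds at an
  -- unknown exponent vector, as evaluation one slot at a time requires.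
  tens : Vec Slot n → Vec ℕ n → Carrier
  tens []       e = 1#
  tens (g ∷ gs) e = g (Vec.head e) * tens gs (Vec.tail e)

  umbral : Vec Slot n → Elem {n} → Carrier
  umbral gs p = pair p (tens gs)

  opaque
    -- The constant term with its single-variable factors made abstract: slot i sends x_i^e to the
    -- coefficient of x_i^(-e) in the i-th factor, and only the product over pairs is left as a
    -- polynomial.
    gogForm : ∀ n → Vec Slot n → Carrier
    gogForm n gs = umbral gs (Vandermonde.prodD (Pol n) (vars n))

  Short : ℕ → Slot → Set
  Short N g = ∀ e → N ℕ.< e → g e ≈ 0#

  -- Links slots to the truncated ring: short slots cannot distinguish polynomials that agree modulo
  -- the powers x_i^(N+1).
  tens-killing : ∀ {N} {gs : Vec Slot n} → All (Short N) gs → Killing N (tens gs)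
  tens-killing (s ∷ ss) (a ∷ e) (here N<a) = trans (*-congʳ (s a N<a)) (zeroˡ _)
  tens-killing (s ∷ ss) (a ∷ e) (there i)  = trans (*-congˡ (tens-killing ss e i)) (zeroʳ _)

  -- The dual of `laplace`: the power x_j^N becomes the value `g N`, and the factors 1 + y become
  -- `up` on the slots after position j.
  lapSlots : ℕ → Vec Slot (suc n) → (Vec Slot n → Carrier) → Carrier
  lapSlots N (g ∷ [])      Ψ = g N * Ψ []
  lapSlots N (g ∷ g′ ∷ gs) Ψ =
    g N * Ψ (Vec.map up (g′ ∷ gs)) - lapSlots N (g′ ∷ gs) (λ hs → Ψ (g ∷ hs))

  lapSlots-cong : ∀ N (gs : Vec Slot (suc n)) {Ψ Θ} → (∀ hs → Ψ hs ≈ Θ hs) → lapSlots N gs Ψ ≈ lapSlots N gs Θ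
  lapSlots-cong N (g ∷ [])      e = *-congˡ (e _)
  lapSlots-cong N (g ∷ g′ ∷ gs) e = +-cong (*-congˡ (e _)) (-‿cong (lapSlots-cong N (g′ ∷ gs) (λ hs → e _)))

  lapSlots-* : ∀ N (gs : Vec Slot (suc n)) c Ψ → lapSlots N gs (λ hs → c * Ψ hs) ≈ c * lapSlots N gs Ψ
  lapSlots-* N (g ∷ [])      c Ψ = solve 3 (λ a c p → a :* (c :* p) := c :* (a :* p)) refl _ _ _
  lapSlots-* N (g ∷ g′ ∷ gs) c Ψ = trans (+-congˡ (-‿cong (lapSlots-* N (g′ ∷ gs) c _)))
    (solve 4 (λ a c p l → a :* (c :* p) :- c :* l := c :* (a :* p :- l)) refl _ _ _ _)

  lapSlots-+ : ∀ N (gs : Vec Slot (suc n)) Ψ Θ →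
    lapSlots N gs (λ hs → Ψ hs + Θ hs) ≈ lapSlots N gs Ψ + lapSlots N gs Θ
  lapSlots-+ N (g ∷ [])      Ψ Θ = distribˡ _ _ _
  lapSlots-+ N (g ∷ g′ ∷ gs) Ψ Θ = trans (+-congˡ (-‿cong (lapSlots-+ N (g′ ∷ gs) _ _)))
    (solve 5 (λ a p q l m → a :* (p :+ q) :- (l :+ m) := (a :* p :- l) :+ (a :* q :- m)) refl _ _ _ _ _)

  lapSlots-0 : ∀ N (gs : Vec Slot (suc n)) → lapSlots N gs (λ _ → 0#) ≈ 0#
  lapSlots-0 N (g ∷ [])      = zeroʳ _
  lapSlots-0 N (g ∷ g′ ∷ gs) = trans (+-cong (zeroʳ _) (-‿cong (lapSlots-0 N (g′ ∷ gs))))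
    (solve 0 (:0 :- :0 := :0) refl)

  lapSlots-sum : ∀ {X : Set} N (gs : Vec Slot (suc n)) (xs : List X) (Ψ : X → Vec Slot n → Carrier) →
    lapSlots N gs (λ hs → sumL xs (λ x → Ψ x hs)) ≈ sumL xs (λ x → lapSlots N gs (Ψ x))
  lapSlots-sum N gs []       Ψ = lapSlots-0 N gs
  lapSlots-sum N gs (x ∷ xs) Ψ = trans (lapSlots-+ N gs _ _) (+-congˡ (lapSlots-sum N gs xs Ψ))

  module Truncated (N : ℕ) where

    Q : ℕ → Ring₀
    Q n = Trunc.algebra N n

    module Q {n : ℕ} = CommutativeRing (Q n)
    module V {n : ℕ} = Vandermonde (Q n)
    open module T {n : ℕ} = Trunc N n using (_≋_; same; at)

    ιHom : ∀ n → Hom (Q n) (Q (suc n))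
    ιHom n = pushHom (0 ∷_) (λ _ _ → ≡.refl) ≡.refl (Killing N) (Killing-shift N) (Killing N) (Killing-shift N)

    module ιP {n : ℕ} = HomProperties (ιHom n)

    pair-var₀ : ∀ a q (φ : Vec ℕ (suc n) → Carrier) →
      pair (V.pow var₀ a ⊛ ι q) φ ≈ pair q (λ e → φ (a ∷ e))
    pair-var₀ {n} zero q φ = begin
      pair (unit ⊛ ι q) φ  ≈⟨ Full.at (Full.⊛-identityˡ (suc n) (ι q)) φ tt ⟩
      pair (ι q) φ         ≡⟨ pair-push (0 ∷_) q φ ⟩
      pair q (λ e → φ (0 ∷ e)) ∎
    pair-var₀ {n} (suc a) q φ = begin
      pair (var₀ ⊛ V.pow var₀ a ⊛ ι q) φ
        ≈⟨ Full.at (Full.⊛-assoc (suc n) var₀ (V.pow var₀ a) (ι q)) φ tt ⟩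
      pair (var₀ ⊛ (V.pow var₀ a ⊛ ι q)) φ
        ≈⟨ pair-⊛ var₀ (V.pow var₀ a ⊛ ι q) φ ⟩
      pair var₀ (λ m → pair (V.pow var₀ a ⊛ ι q) (λ e → φ (m +ᵉ e)))
        ≈⟨ trans (pair-mono 1# (1 ∷ 0ᵉ) (λ m → pair (V.pow var₀ a ⊛ ι q) (λ e → φ (m +ᵉ e)))) (*-identityˡ _) ⟩
      pair (V.pow var₀ a ⊛ ι q) (λ e → φ ((1 ∷ 0ᵉ) +ᵉ e))
        ≈⟨ pair-var₀ a q _ ⟩
      pair q (λ e → φ (suc a ∷ 0ᵉ +ᵉ e))
        ≈⟨ pair-cong q (λ e → reflexive (≡.cong (λ e → φ (suc a ∷ e)) (VecP.zipWith-identityˡ ℕP.+-identityˡ e))) ⟩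
      pair q (λ e → φ (suc a ∷ e)) ∎

    umbral-var₀ : ∀ a q g (gs : Vec Slot n) → umbral (g ∷ gs) (V.pow var₀ a ⊛ ι q) ≈ g a * umbral gs q
    umbral-var₀ a q g gs = trans (pair-var₀ a q (tens (g ∷ gs))) (pair-* q _ _)

    vars-nil : ∀ n → All (V.Nil N) (vars n)
    vars-nil zero    = []
    vars-nil (suc n) = nil₀ ∷ AllP.map⁺ (All.map (λ {p} → nilι {p}) (vars-nil n))
      where
      nil₀ : V.Nil {suc n} N var₀
      nil₀ = same λ φ k → begin
        pair (V.pow var₀ (suc N)) φ            ≈⟨ at (Q.*-identityʳ (V.pow {suc n} var₀ (suc N))) φ k ⟨
        pair (V.pow var₀ (suc N) ⊛ ι unit) φ   ≈⟨ pair-var₀ (suc N) unit φ ⟩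
        pair unit (λ e → φ (suc N ∷ e))        ≈⟨ pair-mono 1# 0ᵉ (λ e → φ (suc N ∷ e)) ⟩
        1# * φ (suc N ∷ 0ᵉ)                    ≈⟨ trans (*-identityˡ _) (k _ (here ℕP.≤-refl)) ⟩
        0#                                     ∎
      nilι : ∀ {p} → V.Nil {n} N p → V.Nil {suc n} N (ι p)
      nilι {p} nil = same λ φ k → begin
        pair (V.pow (ι p) (suc N)) φ             ≈⟨ at (ιP.pow-hom p (suc N)) φ k ⟩
        pair (ι (V.pow p (suc N))) φ             ≡⟨ pair-push (0 ∷_) (V.pow p (suc N)) φ ⟩
        pair (V.pow p (suc N)) (λ e → φ (0 ∷ e)) ≈⟨ at nil _ (λ e i → k _ (there i)) ⟩
        0#                                       ∎

    umbral-cong : ∀ {gs : Vec Slot n} {p q} → All (Short N) gs → p ≋ q → umbral gs p ≈ umbral gs q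
    umbral-cong ss e = at e _ (tens-killing ss)

    umbral-prodUp : ∀ (gs : Vec Slot n) → All (Short N) gs → ∀ e →
      umbral gs (V.prodUp (vars n) ⊛ V.mon (vars n) e) ≈ tens (Vec.map up gs) e
    umbral-prodUp [] _ e = trans (at (Q.*-identityˡ {0} unit) (tens []) (λ _ ())) (trans (pair-mono 1# [] (λ _ → 1#)) (*-identityˡ 1#))
    umbral-prodUp {suc n} (g ∷ gs) ss@(_ ∷ ss′) (a ∷ e) = begin
      umbral (g ∷ gs) (((unit ++ var₀) ⊛ V.prodUp ιvs) ⊛ (x^ a ⊛ V.mon ιvs e))
        ≈⟨ umbral-cong ss (QK.solve 4 (λ x u p m → (QK.:1 QK.:+ x) QK.:* u QK.:* (p QK.:* m)
             QK.:= p QK.:* (u QK.:* m) QK.:+ x QK.:* p QK.:* (u QK.:* m)) Q.refl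
             var₀ (V.prodUp ιvs) (x^ a) (V.mon ιvs e)) ⟩
      umbral (g ∷ gs) ((x^ a ⊛ (V.prodUp ιvs ⊛ V.mon ιvs e)) ++ (x^ (suc a) ⊛ (V.prodUp ιvs ⊛ V.mon ιvs e)))
        ≈⟨ pair-++ (x^ a ⊛ (V.prodUp ιvs ⊛ V.mon ιvs e)) _ _ ⟩
      umbral (g ∷ gs) (x^ a ⊛ (V.prodUp ιvs ⊛ V.mon ιvs e)) + umbral (g ∷ gs) (x^ (suc a) ⊛ (V.prodUp ιvs ⊛ V.mon ιvs e))
        ≈⟨ +-cong (each a) (each (suc a)) ⟩
      g a * umbral gs pm + g (suc a) * umbral gs pm
        ≈⟨ distribʳ _ _ _ ⟨
      (g a + g (suc a)) * umbral gs pm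
        ≈⟨ *-congˡ (umbral-prodUp gs ss′ e) ⟩
      (g a + g (suc a)) * tens (Vec.map up gs) e ∎
      where
      module QK = RingKit (Q (suc n))
      ιvs = Vec.map ι (vars n)
      x^ : ℕ → Elem {suc n}
      x^ = V.pow var₀
      pm = V.prodUp (vars n) ⊛ V.mon (vars n) e
      each : ∀ a → umbral (g ∷ gs) (x^ a ⊛ (V.prodUp ιvs ⊛ V.mon ιvs e)) ≈ g a * umbral gs pm
      each a = trans
        (umbral-cong ss (Q.*-congˡ {x = x^ a} (Q.trans (Q.*-cong (ιP.prodUp-hom (vars n)) (ιP.mon-hom (vars n) e))
          (Q.sym (Hom.*-homo (ιHom n) (V.prodUp (vars n)) (V.mon (vars n) e))))))
        (umbral-var₀ a pm g gs)

    -- Each summand is a power of the first variable times a polynomial in the others, so the first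
    -- slot is evaluated separately: at N if its variable is omitted, at the first exponent of e
    -- otherwise.
    umbral-laplace-mon : ∀ (gs : Vec Slot (suc n)) → All (Short N) gs → ∀ e →
      umbral gs (V.laplace N (vars (suc n)) (λ zs → V.mon zs e)) ≈ lapSlots N gs (λ hs → tens hs e)
    umbral-laplace-mon (g ∷ []) ss [] = trans (umbral-var₀ N unit g []) (*-congˡ (trans (pair-mono 1# [] (λ _ → 1#)) (*-identityˡ 1#)))
    umbral-laplace-mon {suc n} (g ∷ gs@(_ ∷ _)) ss@(_ ∷ ss′) (a ∷ e) = begin
      umbral (g ∷ gs) ((V.pow var₀ N ⊛ (V.prodUp ιvs ⊛ V.mon ιvs (a ∷ e)))
                        ++ neg (V.laplace N ιvs (λ zs → V.pow var₀ a ⊛ V.mon zs e)))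
        ≈⟨ trans (pair-++ (V.pow var₀ N ⊛ (V.prodUp ιvs ⊛ V.mon ιvs (a ∷ e))) _ _) (+-congˡ (pair-neg (V.laplace N ιvs (λ zs → V.pow var₀ a ⊛ V.mon zs e)) _)) ⟩
      umbral (g ∷ gs) (V.pow var₀ N ⊛ (V.prodUp ιvs ⊛ V.mon ιvs (a ∷ e)))
        - umbral (g ∷ gs) (V.laplace N ιvs (λ zs → V.pow var₀ a ⊛ V.mon zs e))
        ≈⟨ +-cong
             (trans (umbral-cong ss (Q.*-congˡ {x = V.pow var₀ N} (Q.trans (Q.*-cong (ιP.prodUp-hom vs) (ιP.mon-hom vs (a ∷ e)))
               (Q.sym (Hom.*-homo (ιHom (suc n)) (V.prodUp vs) (V.mon vs (a ∷ e)))))))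
               (umbral-var₀ N (V.prodUp vs ⊛ V.mon vs (a ∷ e)) g gs))
             (-‿cong (trans (umbral-cong ss (Q.trans (V.laplace-* N ιvs (V.pow var₀ a) (λ zs → V.mon zs e))
               (Q.*-congˡ {x = V.pow var₀ a} (ιP.laplace-hom N vs (λ zs → ιP.mon-hom zs e)))))
               (umbral-var₀ a (V.laplace N vs (λ zs → V.mon zs e)) g gs))) ⟩
      g N * umbral gs (V.prodUp vs ⊛ V.mon vs (a ∷ e)) - g a * umbral gs (V.laplace N vs (λ zs → V.mon zs e))
        ≈⟨ +-cong (*-congˡ (umbral-prodUp gs ss′ (a ∷ e)))
             (-‿cong (trans (*-congˡ (umbral-laplace-mon gs ss′ e)) (sym (lapSlots-* N gs (g a) _)))) ⟩
      g N * tens (Vec.map up gs) (a ∷ e) - lapSlots N gs (λ hs → g a * tens hs e) ∎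
      where
      vs = vars (suc n)
      ιvs = Vec.map ι vs

    constHom : ∀ n → Hom 𝕂 (Q n)
    constHom n = record
      { ⟦_⟧    = λ c → mono c 0ᵉ
      ; +-homo = λ x y → same λ φ _ → trans (pair-mono (x + y) 0ᵉ φ) (trans (distribʳ _ _ _)
          (sym (trans (pair-++ (mono x 0ᵉ) (mono y 0ᵉ) φ) (+-cong (pair-mono x 0ᵉ φ) (pair-mono y 0ᵉ φ)))))
      ; *-homo = λ x y → same λ φ _ → reflexive (≡.cong (λ e → pair (mono (x * y) e) φ)
          (≡.sym (VecP.zipWith-identityˡ ℕP.+-identityˡ 0ᵉ)))
      ; -‿homo = λ x → same λ φ _ → refl
      ; 1-homo = same λ φ _ → refl }

    umbral-const : ∀ c p (gs : Vec Slot n) → umbral gs (mono c 0ᵉ ⊛ p) ≈ c * umbral gs p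
    umbral-const c p gs = begin
      pair (mono c 0ᵉ ⊛ p) (tens gs)                               ≈⟨ pair-⊛ (mono c 0ᵉ) p (tens gs) ⟩
      pair (mono c 0ᵉ) (λ m → pair p (λ e → tens gs (m +ᵉ e)))     ≈⟨ pair-mono c 0ᵉ (λ m → pair p (λ e → tens gs (m +ᵉ e))) ⟩
      c * pair p (λ e → tens gs (0ᵉ +ᵉ e))
        ≈⟨ *-congˡ (pair-cong p (λ e → reflexive (≡.cong (tens gs) (VecP.zipWith-identityˡ ℕP.+-identityˡ e)))) ⟩
      c * umbral gs p ∎

    umbral-laplace : ∀ (gs : Vec Slot (suc n)) → All (Short N) gs → ∀ p →
      umbral gs (V.laplace N (vars (suc n)) (λ zs → Evaluation.ev (constHom (suc n)) zs p))
        ≈ lapSlots N gs (λ hs → umbral hs p)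
    umbral-laplace {n} gs ss p = begin
      umbral gs (V.laplace N vs (λ zs → QK.sumL p (λ t → mono (proj₁ t) 0ᵉ ⊛ V.mon zs (proj₂ t))))
        ≈⟨ umbral-cong ss (V.laplace-sum N vs p (λ t zs → mono (proj₁ t) 0ᵉ ⊛ V.mon zs (proj₂ t))) ⟩
      umbral gs (QK.sumL p (λ t → V.laplace N vs (λ zs → mono (proj₁ t) 0ᵉ ⊛ V.mon zs (proj₂ t))))
        ≈⟨ umbral-sum p _ ⟩
      sumL p (λ t → umbral gs (V.laplace N vs (λ zs → mono (proj₁ t) 0ᵉ ⊛ V.mon zs (proj₂ t))))
        ≈⟨ sum-cong p (λ t → trans
             (umbral-cong ss (V.laplace-* N vs (mono (proj₁ t) 0ᵉ) (λ zs → V.mon zs (proj₂ t))))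
             (trans (umbral-const (proj₁ t) (V.laplace N vs (λ zs → V.mon zs (proj₂ t))) gs)
               (*-congˡ (umbral-laplace-mon gs ss (proj₂ t))))) ⟩
      sumL p (λ t → proj₁ t * lapSlots N gs (λ hs → tens hs (proj₂ t)))
        ≈⟨ sum-cong p (λ t → lapSlots-* N gs (proj₁ t) _) ⟨
      sumL p (λ t → lapSlots N gs (λ hs → proj₁ t * tens hs (proj₂ t)))
        ≈⟨ lapSlots-sum N gs p _ ⟨
      lapSlots N gs (λ hs → umbral hs p) ∎
      where
      module QK = RingKit (Q (suc n))
      vs = vars (suc n)
      umbral-sum : ∀ {X : Set} (xs : List X) (f : X → Elem {suc n}) →
        umbral gs (QK.sumL xs f) ≈ sumL xs (λ x → umbral gs (f x))
      umbral-sum []       f = refl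
      umbral-sum (x ∷ xs) f = trans (pair-++ (f x) _ _) (+-congˡ (umbral-sum xs f))

  opaque
    unfolding gogForm

    -- With n + 1 variables the Vandermonde product is expanded along n-th powers, and slots
    -- vanishing beyond exponent n allow x^(n+1) = 0 to be imposed: the truncation is exactly the
    -- one under which the remaining factors simplify.
    gogForm-laplace : ∀ n (gs : Vec Slot (suc n)) → All (Short n) gs →
      gogForm (suc n) gs ≈ lapSlots n gs (gogForm n)
    gogForm-laplace n gs ss = begin
      umbral gs (Vandermonde.prodD (Pol (suc n)) vs)
        ≈⟨ umbral-cong ss (HomProperties.prodD-hom idHom vs) ⟨
      umbral gs (V.prodD (Vec.map (λ p → p) vs))
        ≡⟨ ≡.cong (λ xs → umbral gs (V.prodD xs)) (VecP.map-id vs) ⟩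
      umbral gs (V.prodD vs)
        ≈⟨ umbral-cong ss (V.prodD-laplace n vs (vars-nil (suc n))) ⟩
      umbral gs (V.laplace n vs V.prodD)
        ≈⟨ umbral-cong ss (V.laplace-cong n vs (Evaluation.prodD-ev (constHom (suc n)))) ⟩
      umbral gs (V.laplace n vs (λ zs → Evaluation.ev (constHom (suc n)) zs (Vandermonde.prodD (Pol n) (vars n))))
        ≈⟨ umbral-laplace gs ss (Vandermonde.prodD (Pol n) (vars n)) ⟩
      lapSlots n gs (gogForm n) ∎
      where
      open Truncated n
      vs : Vec (Elem {suc n}) (suc n)
      vs = vars (suc n)
      idHom : Hom (Pol (suc n)) (Q (suc n))
      idHom = record
        { ⟦_⟧ = λ p → p ; +-homo = λ _ _ → Q.refl ; *-homo = λ _ _ → Q.refl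
        ; -‿homo = λ _ → Q.refl ; 1-homo = Q.refl }

swapAt-+ᵉ : ∀ {n} i (e e′ : Vec ℕ n) → swapAt i (e +ᵉ e′) ≡ swapAt i e +ᵉ swapAt i e′
swapAt-+ᵉ zero    []          []            = ≡.refl
swapAt-+ᵉ (suc i) []          []            = ≡.refl
swapAt-+ᵉ zero    (x ∷ [])    (y ∷ [])      = ≡.refl
swapAt-+ᵉ zero    (_ ∷ _ ∷ _) (_ ∷ _ ∷ _)   = ≡.refl
swapAt-+ᵉ (suc i) (x ∷ e)     (y ∷ e′)      = ≡.cong (_ ∷_) (swapAt-+ᵉ i e e′)

swapAt-0ᵉ : ∀ i n → swapAt i (0ᵉ {n}) ≡ 0ᵉ
swapAt-0ᵉ zero    zero          = ≡.refl
swapAt-0ᵉ (suc i) zero          = ≡.refl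
swapAt-0ᵉ zero    (suc zero)    = ≡.refl
swapAt-0ᵉ zero    (suc (suc n)) = ≡.refl
swapAt-0ᵉ (suc i) (suc n)       = ≡.cong (0 ∷_) (swapAt-0ᵉ i n)

swapAt-map : ∀ {A B : Set} {n} (f : A → B) i (v : Vec A n) → swapAt i (Vec.map f v) ≡ Vec.map f (swapAt i v)
swapAt-map f zero    []          = ≡.refl
swapAt-map f (suc i) []          = ≡.refl
swapAt-map f zero    (x ∷ [])    = ≡.refl
swapAt-map f zero    (_ ∷ _ ∷ _) = ≡.refl
swapAt-map f (suc i) (x ∷ v)     = ≡.cong (f x ∷_) (swapAt-map f i v)

-- Symmetry of the pair product and cancellation at neighbouring slots

module Junctions (𝕂 : Ring₀) where
  open CommutativeRing 𝕂
  open RingKit 𝕂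
  open Polynomials 𝕂
  open SlotFunctionals 𝕂
  open Relation.Binary.Reasoning.Setoid setoid

  private variable n : ℕ

  module P {n : ℕ} = CommutativeRing (Pol n)
  module PV {n : ℕ} = Vandermonde (Pol n)
  open module F {n : ℕ} = Full n using (same; at)

  record LinearFirst (Ψ : Vec Slot (suc n) → Carrier) : Set where
    field
      slot-cong  : ∀ {g h} gs → (∀ e → g e ≈ h e) → Ψ (g ∷ gs) ≈ Ψ (h ∷ gs)
      slot-+     : ∀ g h gs → Ψ ((λ e → g e + h e) ∷ gs) ≈ Ψ (g ∷ gs) + Ψ (h ∷ gs)
      slot-*     : ∀ c g gs → Ψ ((λ e → c * g e) ∷ gs) ≈ c * Ψ (g ∷ gs)

  Multilinear : (Vec Slot n → Carrier) → Set
  Multilinear {zero}  Ψ = ⊤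
  Multilinear {suc n} Ψ = LinearFirst Ψ × (∀ g → Multilinear (λ gs → Ψ (g ∷ gs)))

  -- At the first two variables x, y the relation says that h ⊗ h annihilates (1 + x + xy) times the
  -- polynomial: `up h ∷ h` accounts for 1 + x, and `dn h ∷ dn h` for xy. The recursion imposes it
  -- at every adjacent pair.
  Junction : (Vec Slot n → Carrier) → Set
  Junction {zero}        Ψ = ⊤
  Junction {suc zero}    Ψ = ⊤
  Junction {suc (suc n)} Ψ =
    (∀ h gs → Ψ (up h ∷ h ∷ gs) + Ψ (dn h ∷ dn h ∷ gs) ≈ 0#) × (∀ g → Junction (λ gs → Ψ (g ∷ gs)))

  Multilinear-cong : ∀ {n} {Ψ Θ : Vec Slot n → Carrier} → (∀ gs → Ψ gs ≈ Θ gs) → Multilinear Ψ → Multilinear Θ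
  Multilinear-cong {zero}  e _ = tt
  Multilinear-cong {suc n} e (l , ls) = record
    { slot-cong = λ gs g≈h → trans (sym (e _)) (trans (slot-cong gs g≈h) (e _))
    ; slot-+ = λ g h gs → trans (sym (e _)) (trans (slot-+ g h gs) (+-cong (e _) (e _)))
    ; slot-* = λ c g gs → trans (sym (e _)) (trans (slot-* c g gs) (*-congˡ (e _))) }
    , (λ g → Multilinear-cong (λ gs → e (g ∷ gs)) (ls g))
    where open LinearFirst l

  Junction-cong : ∀ {n} {Ψ Θ : Vec Slot n → Carrier} → (∀ gs → Ψ gs ≈ Θ gs) → Junction Ψ → Junction Θ
  Junction-cong {zero}        e _ = tt
  Junction-cong {suc zero}    e _ = tt
  Junction-cong {suc (suc n)} e (j , js) =
    (λ h gs → trans (+-cong (sym (e _)) (sym (e _))) (j h gs)) ,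
    (λ g → Junction-cong (λ gs → e (g ∷ gs)) (js g))

  -- Evaluates the first variable only and keeps a polynomial in the others, which makes induction
  -- over the slots possible.
  plug : Slot → Elem {suc n} → Elem {n}
  plug g = List.map (λ t → proj₁ t * g (Vec.head (proj₂ t)) , Vec.tail (proj₂ t))

  pair-plug : ∀ g (p : Elem {suc n}) φ → pair (plug g p) φ ≈ pair p (λ e → g (Vec.head e) * φ (Vec.tail e))
  pair-plug g p φ = trans (reflexive (sum-map _ p _)) (sum-cong p (λ t → *-assoc _ _ _))

  umbral-plug : ∀ g (p : Elem {suc n}) gs → umbral (g ∷ gs) p ≈ umbral gs (plug g p)
  umbral-plug g p gs = sym (pair-plug g p (tens gs))

  plug-cong : ∀ g {p q : Elem {suc n}} → p ≃ q → plug g p ≃ plug g q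
  plug-cong g {p} {q} e = same λ φ h → trans (pair-plug g p φ) (trans (at e _ tt) (sym (pair-plug g q φ)))

  plug-ι : ∀ g (p : Elem {suc n}) q → plug g (p ⊛ ι q) ≃ plug g p ⊛ q
  plug-ι g p q = same λ φ _ → begin
    pair (plug g (p ⊛ ι q)) φ
      ≈⟨ trans (pair-plug g (p ⊛ ι q) φ) (pair-⊛ p (ι q) _) ⟩
    pair p (λ e → pair (ι q) (λ e′ → g (Vec.head (e +ᵉ e′)) * φ (Vec.tail (e +ᵉ e′))))
      ≈⟨ pair-cong p (λ e → trans (reflexive (pair-push (0 ∷_) q _)) (trans
           (pair-cong q (step e φ)) (pair-* q _ _))) ⟩
    pair p (λ e → g (Vec.head e) * pair q (λ e′ → φ (Vec.tail e +ᵉ e′)))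
      ≈⟨ pair-plug g p (λ e → pair q (λ e′ → φ (e +ᵉ e′))) ⟨
    pair (plug g p) (λ e → pair q (λ e′ → φ (e +ᵉ e′)))
      ≈⟨ pair-⊛ (plug g p) q φ ⟨
    pair (plug g p ⊛ q) φ ∎
    where
    step : ∀ e φ e′ → g (Vec.head (e +ᵉ (0 ∷ e′))) * φ (Vec.tail (e +ᵉ (0 ∷ e′)))
                      ≈ g (Vec.head e) * φ (Vec.tail e +ᵉ e′)
    step (x ∷ e) φ e′ = *-congʳ (reflexive (≡.cong g (ℕP.+-identityʳ x)))

  umbral-multilinear : ∀ n (p : Elem {n}) → Multilinear (λ gs → umbral gs p)
  umbral-multilinear zero    p = tt
  umbral-multilinear (suc n) p = record
    { slot-cong = λ gs g≈h → pair-cong p (λ e → *-congʳ (g≈h _))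
    ; slot-+ = λ g h gs → trans (pair-cong p (λ e → distribʳ _ _ _)) (pair-+ p _ _)
    ; slot-* = λ c g gs → trans (pair-cong p (λ e → *-assoc _ _ _)) (pair-* p c _) }
    , (λ g → Multilinear-cong (λ gs → sym (umbral-plug g p gs)) (umbral-multilinear n (plug g p)))

  swapHom : ∀ i n → Hom (Pol n) (Pol n)
  swapHom i n = pushHom (swapAt i) (swapAt-+ᵉ i) (swapAt-0ᵉ i n) (λ _ → ⊤) (λ _ _ → tt) (λ _ → ⊤) (λ _ _ → tt)

  Symmetric : Elem {n} → Set
  Symmetric p = ∀ i → push (swapAt i) p ≃ p

  push-ι-swap : ∀ i m (ps : Vec (Elem {n}) m) →
    Vec.map (push (swapAt (suc i))) (Vec.map ι ps) ≡ Vec.map ι (Vec.map (push (swapAt i)) ps)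
  push-ι-swap i m []       = ≡.refl
  push-ι-swap i m (p ∷ ps) = ≡.cong₂ _∷_ (≡.trans (≡.sym (LP.map-∘ p)) (LP.map-∘ p)) (push-ι-swap i _ ps)

  push-ιι : ∀ m (ps : Vec (Elem {n}) m) →
    Vec.map (push (swapAt 0)) (Vec.map ι (Vec.map ι ps)) ≡ Vec.map ι (Vec.map ι ps)
  push-ιι m []       = ≡.refl
  push-ιι m (p ∷ ps) = ≡.cong₂ _∷_
    (≡.trans (≡.cong (push (swapAt 0)) (≡.sym (LP.map-∘ p))) (≡.trans (≡.sym (LP.map-∘ p)) (LP.map-∘ p)))
    (push-ιι _ ps)

  vars-swap : ∀ i n → Vec.map (push (swapAt i)) (vars n) ≡ swapAt i (vars n)
  vars-swap zero    zero          = ≡.refl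
  vars-swap (suc i) zero          = ≡.refl
  vars-swap zero    (suc zero)    = ≡.refl
  vars-swap zero    (suc (suc n)) = ≡.cong (λ ps → ι var₀ ∷ var₀ ∷ ps) (push-ιι n (vars n))
  vars-swap (suc i) (suc n)       = ≡.cong₂ _∷_
    (≡.cong (λ e → mono 1# (1 ∷ e)) (swapAt-0ᵉ i n))
    (≡.trans (push-ι-swap i n (vars n))
      (≡.trans (≡.cong (Vec.map ι) (vars-swap i n)) (≡.sym (swapAt-map ι i (vars n)))))

  rowD-symmetric : ∀ i n → push (swapAt (suc i)) (PV.rowD var₀ (Vec.map ι (vars n))) ≃ PV.rowD var₀ (Vec.map ι (vars n))
  rowD-symmetric i n = P.trans (P.sym (HomProperties.rowD-hom (swapHom (suc i) (suc n)) var₀ (Vec.map ι (vars n))))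
    (P.trans (P.reflexive (≡.cong (λ xs → PV.rowD (Vec.head xs) (Vec.tail xs)) (vars-swap (suc i) (suc n))))
      (PV.rowD-swap var₀ i (Vec.map ι (vars n))))

  pair-monomial : ∀ m (p : Elem {n}) φ → pair (mono 1# m ⊛ p) φ ≈ pair p (λ e → φ (m +ᵉ e))
  pair-monomial m p φ = trans (pair-⊛ (mono 1# m) p φ)
    (trans (pair-mono 1# m (λ m → pair p (λ e → φ (m +ᵉ e)))) (*-identityˡ _))

  umbral-dn : ∀ h gs (p : Elem {suc n}) → umbral (dn h ∷ gs) p ≈ umbral (h ∷ gs) (var₀ ⊛ p)
  umbral-dn h gs p = sym (trans (pair-monomial (1 ∷ 0ᵉ) p (tens (h ∷ gs))) (pair-cong p
    (λ { (x ∷ e) → reflexive (≡.cong (λ e → h (suc x) * tens gs e) (VecP.zipWith-identityˡ ℕP.+-identityˡ e)) })))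

  umbral-dn₂ : ∀ g h gs (p : Elem {suc (suc n)}) → umbral (g ∷ dn h ∷ gs) p ≈ umbral (g ∷ h ∷ gs) (ι var₀ ⊛ p)
  umbral-dn₂ g h gs p = sym (trans (pair-monomial (0 ∷ 1 ∷ 0ᵉ) p (tens (g ∷ h ∷ gs))) (pair-cong p
    (λ { (x ∷ y ∷ e) → reflexive (≡.cong (λ e → g x * (h (suc y) * tens gs e)) (VecP.zipWith-identityˡ ℕP.+-identityˡ e)) })))

  umbral-up : ∀ h gs (p : Elem {suc n}) → umbral (up h ∷ gs) p ≈ umbral (h ∷ gs) (p ++ var₀ ⊛ p)
  umbral-up h gs p = trans (pair-cong p (λ e → distribʳ _ _ _)) (trans (pair-+ p _ _)
    (trans (+-congˡ (umbral-dn h gs p)) (sym (pair-++ p (var₀ ⊛ p) _))))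

  -- Both summands together pair a functional symmetric in the first two
  -- variables a, b with (a - b) times a symmetric polynomial.
  front-junction : ∀ n (T : Elem {suc (suc n)}) → Symmetric T → ∀ h gs →
    umbral (up h ∷ h ∷ gs) (T ⊛ PV.prodD (vars (suc (suc n))))
    + umbral (dn h ∷ dn h ∷ gs) (T ⊛ PV.prodD (vars (suc (suc n)))) ≈ 0#
  front-junction n T symT h gs = begin
    umbral (up h ∷ h ∷ gs) p + umbral (dn h ∷ dn h ∷ gs) p
      ≈⟨ +-cong (umbral-up h (h ∷ gs) p) (trans (umbral-dn h (dn h ∷ gs) p) (umbral-dn₂ h h gs (a ⊛ p))) ⟩
    umbral hs (p ++ a ⊛ p) + umbral hs (b ⊛ (a ⊛ p))
      ≈⟨ pair-++ (p ++ a ⊛ p) (b ⊛ (a ⊛ p)) (tens hs) ⟨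
    umbral hs ((p ++ a ⊛ p) ++ b ⊛ (a ⊛ p))
      ≈⟨ at (PK.solve 6 (λ a b T ra rb d →
           let q = T PK.:* (((a PK.:- b) PK.:* (PK.:1 PK.:+ b PK.:+ a PK.:* b)) PK.:* ra PK.:* (rb PK.:* d))
               z = ((PK.:1 PK.:+ a PK.:+ a PK.:* b) PK.:* (PK.:1 PK.:+ b PK.:+ a PK.:* b)) PK.:* (T PK.:* ((ra PK.:* rb) PK.:* d))
           in (q PK.:+ a PK.:* q) PK.:+ b PK.:* (a PK.:* q) PK.:= a PK.:* z PK.:- b PK.:* z)
           P.refl a b T (PV.rowD a cs) (PV.rowD b cs) (PV.prodD cs)) (tens hs) tt ⟩
    umbral hs ((a ⊛ Z) ++ neg (b ⊛ Z))
      ≈⟨ trans (pair-++ (a ⊛ Z) (neg (b ⊛ Z)) (tens hs)) (+-congˡ (pair-neg (b ⊛ Z) (tens hs))) ⟩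
    umbral hs (a ⊛ Z) - umbral hs (b ⊛ Z)
      ≈⟨ +-congʳ (begin
           umbral hs (a ⊛ Z)                               ≈⟨ pair-cong (a ⊛ Z) tens-swap ⟩
           pair (a ⊛ Z) (λ e → tens hs (swapAt 0 e))       ≡⟨ pair-push (swapAt 0) (a ⊛ Z) (tens hs) ⟨
           umbral hs (σ (a ⊛ Z))                           ≈⟨ at σaZ (tens hs) tt ⟩
           umbral hs (b ⊛ Z)                               ∎) ⟩
    umbral hs (b ⊛ Z) - umbral hs (b ⊛ Z)
      ≈⟨ -‿inverseʳ _ ⟩
    0# ∎
    where
    module PK = RingKit (Pol (suc (suc n)))
    module H = Hom (swapHom 0 (suc (suc n)))
    module HP = HomProperties (swapHom 0 (suc (suc n)))
    σ : Elem {suc (suc n)} → Elem {suc (suc n)}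
    σ = push (swapAt 0)
    hs = h ∷ h ∷ gs
    a b : Elem {suc (suc n)}
    a = var₀
    b = ι var₀
    cs = Vec.map ι (Vec.map ι (vars n))
    p = T ⊛ PV.prodD (vars (suc (suc n)))
    one+ : Elem → Elem → Elem
    one+ x y = unit P.+ x P.+ y
    RR = PV.rowD a cs ⊛ PV.rowD b cs
    Z = (one+ a (a ⊛ b) ⊛ one+ b (a ⊛ b)) ⊛ (T ⊛ (RR ⊛ PV.prodD cs))
    tens-swap : ∀ e → tens hs e ≈ tens hs (swapAt 0 e)
    tens-swap (x ∷ y ∷ e) = solve 3 (λ x y t → x :* (y :* t) := y :* (x :* t)) refl _ _ _
    σcs : Vec.map σ cs ≡ cs
    σcs = ≡.cong (λ xs → Vec.tail (Vec.tail xs)) (vars-swap 0 (suc (suc n)))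
    σone+ : ∀ x y → σ (one+ x y) ≃ one+ (σ x) (σ y)
    σone+ x y = P.trans (H.+-homo (unit ++ x) y) (P.+-congʳ (P.trans (H.+-homo unit x) (P.+-congʳ H.1-homo)))
    σaZ : σ (a ⊛ Z) ≃ b ⊛ Z
    σaZ = P.trans (H.*-homo a Z) (P.*-congˡ {x = b} (P.trans (H.*-homo (one+ a (a ⊛ b) ⊛ one+ b (a ⊛ b)) (T ⊛ (RR ⊛ PV.prodD cs)))
      (P.trans (P.*-cong
        (P.trans (H.*-homo (one+ a (a ⊛ b)) (one+ b (a ⊛ b))) (P.*-cong
          (P.trans (σone+ a (a ⊛ b)) (P.+-congˡ {x = unit ++ b} (H.*-homo a b)))
          (P.trans (σone+ b (a ⊛ b)) (P.+-congˡ {x = unit ++ a} (H.*-homo a b)))))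
        (P.trans (H.*-homo T (RR ⊛ PV.prodD cs)) (P.*-cong (symT 0)
          (P.trans (H.*-homo RR (PV.prodD cs)) (P.*-cong
            (P.trans (H.*-homo (PV.rowD a cs) (PV.rowD b cs)) (P.*-cong
              (P.trans (P.sym (HP.rowD-hom a cs)) (P.reflexive (≡.cong (PV.rowD b) σcs)))
              (P.trans (P.sym (HP.rowD-hom b cs)) (P.reflexive (≡.cong (PV.rowD a) σcs)))))
            (P.trans (P.sym (HP.prodD-hom cs)) (P.reflexive (≡.cong PV.prodD σcs))))))))
      (PK.solve 6 (λ a b T ra rb d →
         ((PK.:1 PK.:+ b PK.:+ b PK.:* a) PK.:* (PK.:1 PK.:+ a PK.:+ b PK.:* a)) PK.:* (T PK.:* ((rb PK.:* ra) PK.:* d))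
         PK.:= ((PK.:1 PK.:+ a PK.:+ a PK.:* b) PK.:* (PK.:1 PK.:+ b PK.:+ a PK.:* b)) PK.:* (T PK.:* ((ra PK.:* rb) PK.:* d)))
         P.refl a b T (PV.rowD a cs) (PV.rowD b cs) (PV.prodD cs)))))

  -- The symmetric factor T is what the induction needs: evaluating the first variable turns T times
  -- the first row of pair factors into a new factor, symmetric in the remaining variables, in front
  -- of their own product. So the relation at the first pair passes to every later pair.
  symmetric-junction : ∀ n (T : Elem {n}) → Symmetric T → Junction (λ gs → umbral gs (T ⊛ PV.prodD (vars n)))
  symmetric-junction zero          T symT = tt
  symmetric-junction (suc zero)    T symT = tt
  symmetric-junction (suc (suc n)) T symT =
    front-junction n T symT ,
    (λ g → Junction-cong (unplug g) (symmetric-junction (suc n) (plug g (T ⊛ R)) (plug-symmetric g)))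
    where
    vs = vars (suc n)
    R = PV.rowD var₀ (Vec.map ι vs)
    unplug : ∀ g gs → umbral gs (plug g (T ⊛ R) ⊛ PV.prodD vs) ≈ umbral (g ∷ gs) (T ⊛ (R ⊛ PV.prodD (Vec.map ι vs)))
    unplug g gs = begin
      umbral gs (plug g (T ⊛ R) ⊛ PV.prodD vs)        ≈⟨ at (plug-ι g (T ⊛ R) (PV.prodD vs)) (tens gs) tt ⟨
      umbral gs (plug g ((T ⊛ R) ⊛ ι (PV.prodD vs)))
        ≈⟨ at (plug-cong g (P.trans (P.*-congˡ {x = T ⊛ R} (P.sym (HomProperties.prodD-hom ιHom vs)))
             (P.*-assoc T R _))) (tens gs) tt ⟩
      umbral gs (plug g (T ⊛ (R ⊛ PV.prodD (Vec.map ι vs)))) ≈⟨ umbral-plug g (T ⊛ (R ⊛ PV.prodD (Vec.map ι vs))) gs ⟨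
      umbral (g ∷ gs) (T ⊛ (R ⊛ PV.prodD (Vec.map ι vs))) ∎
      where
      ιHom : Hom (Pol (suc n)) (Pol (suc (suc n)))
      ιHom = pushHom (0 ∷_) (λ _ _ → ≡.refl) ≡.refl (λ _ → ⊤) (λ _ _ → tt) (λ _ → ⊤) (λ _ _ → tt)
    plug-symmetric : ∀ g → Symmetric (plug g (T ⊛ R))
    plug-symmetric g i = same λ φ _ → begin
      pair (push (swapAt i) (plug g (T ⊛ R))) φ
        ≡⟨ pair-push (swapAt i) (plug g (T ⊛ R)) φ ⟩
      pair (plug g (T ⊛ R)) (λ e → φ (swapAt i e))
        ≈⟨ pair-plug g (T ⊛ R) _ ⟩
      pair (T ⊛ R) (λ e → g (Vec.head e) * φ (swapAt i (Vec.tail e)))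
        ≈⟨ pair-cong (T ⊛ R) (λ { (x ∷ e) → refl }) ⟩
      pair (T ⊛ R) (λ e → g (Vec.head (swapAt (suc i) e)) * φ (Vec.tail (swapAt (suc i) e)))
        ≡⟨ pair-push (swapAt (suc i)) (T ⊛ R) _ ⟨
      pair (push (swapAt (suc i)) (T ⊛ R)) (λ e → g (Vec.head e) * φ (Vec.tail e))
        ≈⟨ at (P.trans (Hom.*-homo (swapHom (suc i) (suc (suc n))) T R)
             (P.*-cong (symT (suc i)) (rowD-symmetric i (suc n)))) _ tt ⟩
      pair (T ⊛ R) (λ e → g (Vec.head e) * φ (Vec.tail e))
        ≈⟨ pair-plug g (T ⊛ R) φ ⟨
      pair (plug g (T ⊛ R)) φ ∎

  opaque
    unfolding gogForm

    gogForm-junction : ∀ n → Junction (gogForm n)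
    gogForm-junction n = Junction-cong
      (λ gs → at (P.*-identityˡ (PV.prodD (vars n))) (tens gs) tt)
      (symmetric-junction n unit (λ i → Hom.1-homo (swapHom i n)))

    gogForm-multilinear : ∀ n → Multilinear (gogForm n)
    gogForm-multilinear n = umbral-multilinear n (PV.prodD (vars n))

    gogForm-0 : gogForm 0 [] ≈ 1#
    gogForm-0 = trans (+-identityʳ _) (*-identityˡ 1#)

    gogForm-umbral : ∀ n gs → gogForm n gs ≈ umbral gs (PV.prodD (vars n))
    gogForm-umbral n gs = refl

-- Telescoping over interlacing rows

T⇒true : ∀ {b} → T b → b ≡ true
T⇒true = Equivalence.to T-≡

¬T⇒false : ∀ {b} → (T b → ⊥) → b ≡ false
¬T⇒false {true}  f = ⊥-elim (f tt)
¬T⇒false {false} f = ≡.refl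

≤ᵇ-true : ∀ {m n} → m ℕ.≤ n → (m ≤ᵇ n) ≡ true
≤ᵇ-true m≤n = T⇒true (ℕP.≤⇒≤ᵇ m≤n)

≤ᵇ-false : ∀ {m n} → n ℕ.< m → (m ≤ᵇ n) ≡ false
≤ᵇ-false {m} {n} n<m = ¬T⇒false (λ t → ℕP.<⇒≱ n<m (ℕP.≤ᵇ⇒≤ m n t))

<ᵇ-true : ∀ {m n} → m ℕ.< n → (m <ᵇ n) ≡ true
<ᵇ-true m<n = T⇒true (ℕP.<⇒<ᵇ m<n)

<ᵇ-false : ∀ {m n} → n ℕ.≤ m → (m <ᵇ n) ≡ false
<ᵇ-false {m} {n} n≤m = ¬T⇒false (λ t → ℕP.≤⇒≯ n≤m (ℕP.<ᵇ⇒< m n t))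

≡ᵇ-true : ∀ n → (n ≡ᵇ n) ≡ true
≡ᵇ-true n = T⇒true (ℕP.≡⇒≡ᵇ n n ≡.refl)

≡ᵇ-false : ∀ {m n} → (m ≡ n → ⊥) → (m ≡ᵇ n) ≡ false
≡ᵇ-false {m} {n} m≢n = ¬T⇒false (λ t → m≢n (ℕP.≡ᵇ⇒≡ m n t))

module Telescope (𝕂 : Ring₀) where
  open CommutativeRing 𝕂
  open RingKit 𝕂
  open SlotFunctionals 𝕂
  open Junctions 𝕂 using (LinearFirst; Multilinear; Junction)
  open Relation.Binary.Reasoning.Setoid setoid

  private variable n r : ℕ

  ind : Bool → Carrier
  ind true  = 1#
  ind false = 0#

  ind-true : ∀ {b} x → b ≡ true → ind b * x ≈ x
  ind-true x ≡.refl = *-identityˡ x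

  ind-false : ∀ {b} x → b ≡ false → ind b * x ≈ 0#
  ind-false x ≡.refl = zeroˡ x

  private
    sum-single-applyUpTo : ∀ M b (g : ℕ → ℕ) (f : ℕ → Carrier) → b ℕ.< M → (∀ l → (g l ≡ᵇ g b) ≡ (l ≡ᵇ b)) →
      sumL (applyUpTo g M) (λ l → ind (l ≡ᵇ g b) * f l) ≈ f (g b)
    sum-none : ∀ M (g : ℕ → ℕ) x (f : ℕ → Carrier) → (∀ l → (g l ≡ᵇ x) ≡ false) →
      sumL (applyUpTo g M) (λ l → ind (l ≡ᵇ x) * f l) ≈ 0#
    sum-none zero    g x f e = refl
    sum-none (suc M) g x f e = trans (+-cong (ind-false _ (e 0)) (sum-none M (g ∘ suc) x f (e ∘ suc))) (+-identityˡ _)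
    sum-single-applyUpTo (suc M) zero    g f _         e =
      trans (+-cong (ind-true _ (e 0)) (sum-none M (g ∘ suc) (g 0) f (e ∘ suc))) (+-identityʳ _)
    sum-single-applyUpTo (suc M) (suc b) g f (s≤s b<M) e =
      trans (+-cong (ind-false _ (e 0)) (sum-single-applyUpTo M b (g ∘ suc) f b<M (e ∘ suc))) (+-identityˡ _)

  sum-single : ∀ M b (f : ℕ → Carrier) → 1 ℕ.≤ b → b ℕ.≤ M → sumL (range1 M) (λ l → ind (l ≡ᵇ b) * f l) ≈ f b
  sum-single M (suc b) f _ b<M = trans (reflexive (sum-map suc (upTo M) _))
    (sum-single-applyUpTo M b (λ l → l) (f ∘ suc) b<M (λ _ → ≡.refl))

  ind-split : ∀ b k l → ind ((b ≤ᵇ l) ∧ (l <ᵇ suc (b ℕ.+ k))) ≈ ind ((b ≤ᵇ l) ∧ (l <ᵇ (b ℕ.+ k))) + ind (l ≡ᵇ (b ℕ.+ k))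
  ind-split b k l with ℕP.<-cmp l (b ℕ.+ k)
  ... | tri< l< l≢ _ rewrite <ᵇ-true l< | <ᵇ-true (ℕP.m<n⇒m<1+n l<) | ≡ᵇ-false l≢ = sym (+-identityʳ _)
  ... | tri> _ l≢ l> rewrite <ᵇ-false (ℕP.<⇒≤ l>) | <ᵇ-false l> | ≡ᵇ-false l≢ with b ≤ᵇ l
  ...   | true  = sym (+-identityʳ _)
  ...   | false = sym (+-identityʳ _)
  ind-split b k l | tri≈ _ ≡.refl _
    rewrite <ᵇ-false (ℕP.≤-refl {b ℕ.+ k}) | <ᵇ-true (ℕP.n<1+n (b ℕ.+ k)) | ≡ᵇ-true (b ℕ.+ k) | ≤ᵇ-true (ℕP.m≤m+n b k)
    = sym (+-identityˡ _)

  -- The half-open interval from b to b + k contains the empty case, and the induction on k adds the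
  -- top term.
  sum-telescope-+ : ∀ M b k (f ψ : ℕ → Carrier) → 1 ℕ.≤ b → b ℕ.+ k ℕ.≤ suc M →
    (∀ l → b ℕ.≤ l → l ℕ.< b ℕ.+ k → f l ≈ ψ (suc l) - ψ l) →
    sumL (range1 M) (λ l → ind ((b ≤ᵇ l) ∧ (l <ᵇ (b ℕ.+ k))) * f l) ≈ ψ (b ℕ.+ k) - ψ b
  sum-telescope-+ M b zero f ψ 1≤b _ _ rewrite ℕP.+-identityʳ b = begin
    sumL (range1 M) (λ l → ind ((b ≤ᵇ l) ∧ (l <ᵇ b)) * f l)
      ≈⟨ sum-cong (range1 M) (λ l → ind-false _ (empty l)) ⟩
    sumL (range1 M) (λ _ → 0#)
      ≈⟨ trans (sum-0 (range1 M)) (sym (-‿inverseʳ _)) ⟩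
    ψ b - ψ b ∎
    where
    empty : ∀ l → ((b ≤ᵇ l) ∧ (l <ᵇ b)) ≡ false
    empty l with ℕP.<-≤-connex l b
    ... | inj₁ l<b rewrite ≤ᵇ-false l<b = ≡.refl
    ... | inj₂ b≤l rewrite ≤ᵇ-true b≤l = <ᵇ-false b≤l
  sum-telescope-+ M b (suc k) f ψ 1≤b b+k≤M e rewrite ℕP.+-suc b k = begin
    sumL (range1 M) (λ l → ind ((b ≤ᵇ l) ∧ (l <ᵇ suc (b ℕ.+ k))) * f l)
      ≈⟨ sum-cong (range1 M) (λ l → trans (*-congʳ (ind-split b k l)) (distribʳ _ _ _)) ⟩
    sumL (range1 M) (λ l → ind ((b ≤ᵇ l) ∧ (l <ᵇ (b ℕ.+ k))) * f l + ind (l ≡ᵇ (b ℕ.+ k)) * f l)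
      ≈⟨ sum-+ (range1 M) _ _ ⟩
    sumL (range1 M) (λ l → ind ((b ≤ᵇ l) ∧ (l <ᵇ (b ℕ.+ k))) * f l) + sumL (range1 M) (λ l → ind (l ≡ᵇ (b ℕ.+ k)) * f l)
      ≈⟨ +-cong (sum-telescope-+ M b k f ψ 1≤b (ℕP.m≤n⇒m≤1+n (ℕP.≤-pred b+k≤M)) (λ l b≤l l< → e l b≤l (ℕP.m<n⇒m<1+n l<)))
           (sum-single M (b ℕ.+ k) f (ℕP.≤-trans 1≤b (ℕP.m≤m+n b k)) (ℕP.≤-pred b+k≤M)) ⟩
    (ψ (b ℕ.+ k) - ψ b) + f (b ℕ.+ k)
      ≈⟨ +-congˡ (e (b ℕ.+ k) (ℕP.m≤m+n b k) ℕP.≤-refl) ⟩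
    (ψ (b ℕ.+ k) - ψ b) + (ψ (suc (b ℕ.+ k)) - ψ (b ℕ.+ k))
      ≈⟨ solve 3 (λ x y z → (x :- y) :+ (z :- x) := z :- y) refl _ _ _ ⟩
    ψ (suc (b ℕ.+ k)) - ψ b ∎

  ≤ᵇ≡<ᵇsuc : ∀ l c → (l ≤ᵇ c) ≡ (l <ᵇ suc c)
  ≤ᵇ≡<ᵇsuc zero    c = ≡.refl
  ≤ᵇ≡<ᵇsuc (suc l) c = ≡.refl

  sum-telescope : ∀ M b c (f ψ : ℕ → Carrier) → 1 ℕ.≤ b → b ℕ.≤ c → c ℕ.≤ M →
    (∀ l → b ℕ.≤ l → l ℕ.≤ c → f l ≈ ψ (suc l) - ψ l) →
    sumL (range1 M) (λ l → ind ((b ≤ᵇ l) ∧ (l ≤ᵇ c)) * f l) ≈ ψ (suc c) - ψ b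
  sum-telescope M b c f ψ 1≤b b≤c c≤M e with suc c ℕ.∸ b | ℕP.m+[n∸m]≡n (ℕP.m≤n⇒m≤1+n b≤c)
  ... | k | eq = begin
    sumL (range1 M) (λ l → ind ((b ≤ᵇ l) ∧ (l ≤ᵇ c)) * f l)
      ≈⟨ sum-cong (range1 M) (λ l → *-congʳ (reflexive (≡.cong (λ t → ind ((b ≤ᵇ l) ∧ t))
           (≡.trans (≤ᵇ≡<ᵇsuc l c) (≡.cong (l <ᵇ_) (≡.sym eq)))))) ⟩
    sumL (range1 M) (λ l → ind ((b ≤ᵇ l) ∧ (l <ᵇ (b ℕ.+ k))) * f l)
      ≈⟨ sum-telescope-+ M b k f ψ 1≤b (≡.subst (ℕ._≤ suc M) (≡.sym eq) (s≤s c≤M))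
           (λ l b≤l l< → e l b≤l (ℕP.≤-pred (≡.subst (l ℕ.<_) eq l<))) ⟩
    ψ (b ℕ.+ k) - ψ b
      ≡⟨ ≡.cong (λ x → ψ x - ψ b) eq ⟩
    ψ (suc c) - ψ b ∎

  -- M bounds the alphabet, C is the upper bound of the last entry, wt l the
  -- weight of an entry l, S l the slot of a bottom entry l and d l its slot one
  -- row further up.
  module _ (M C : ℕ) (C≤M : C ℕ.≤ M) (wt : ℕ → Carrier) (S d : ℕ → Slot)
           (wt-1 : ∀ l → l ℕ.< C → wt l ≈ 1#)
           (S-up : ∀ l → l ℕ.< C → ∀ e → S (suc l) e ≈ up (S l) e)
           (d-dn : ∀ l → l ℕ.< C → ∀ e → d l e ≈ dn (S l) e)
           (wt-d : ∀ l → l ℕ.≤ C → ∀ e → wt l * d l e ≈ S (suc l) e - S l e)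
    where

    next : Vec ℕ r → ℕ
    next []      = C
    next (b ∷ _) = b

    Increasing : Vec ℕ r → Set
    Increasing []       = ⊤
    Increasing (b ∷ bs) = b ℕ.< next bs × Increasing bs

    next≤C : ∀ (bs : Vec ℕ r) → Increasing bs → next bs ℕ.≤ C
    next≤C []       _        = ℕP.≤-refl
    next≤C (b ∷ bs) (b< , i) = ℕP.≤-trans (ℕP.<⇒≤ b<) (next≤C bs i)

    -- The condition `prev <ᵇ l` is the strictness of the row; it ties each sum to the preceding
    -- entry and prevents factorisation.
    nested : ℕ → Vec ℕ r → (Vec Slot r → Carrier) → Carrier
    nested prev []       Ψ = Ψ []
    nested prev (b ∷ bs) Ψ = sumL (range1 M) (λ l →
      ind ((prev <ᵇ l) ∧ (b ≤ᵇ l) ∧ (l ≤ᵇ next bs)) * (wt l * nested l bs (λ gs → Ψ (d l ∷ gs))))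

    raised : Vec ℕ r → Vec Slot r
    raised []       = []
    raised (b ∷ bs) = S (suc (next bs)) ∷ raised bs

    -- Telescoping each sum freely would give all 2^r choices of interval ends. Only r + 1 of them
    -- survive: lower ends up to some position and upper ends after it. In every other choice an
    -- upper end `up h` is followed by the lower end `h` of the next interval; these terms cancel
    -- against the coinciding neighbours, with slots `dn h` and `dn h`, that strictness excludes.
    closed : Vec ℕ r → (Vec Slot r → Carrier) → Carrier
    closed []       Ψ = Ψ []
    closed (b ∷ bs) Ψ = Ψ (raised (b ∷ bs)) - closed bs (λ gs → Ψ (S b ∷ gs))

    closed-cong : ∀ (bs : Vec ℕ r) {Ψ Θ} → (∀ gs → Ψ gs ≈ Θ gs) → closed bs Ψ ≈ closed bs Θ
    closed-cong []       e = e []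
    closed-cong (b ∷ bs) e = +-cong (e _) (-‿cong (closed-cong bs (λ gs → e _)))

    closed-* : ∀ (bs : Vec ℕ r) c Ψ → closed bs (λ gs → c * Ψ gs) ≈ c * closed bs Ψ
    closed-* []       c Ψ = refl
    closed-* (b ∷ bs) c Ψ = trans (+-congˡ (-‿cong (closed-* bs c _)))
      (solve 3 (λ c x y → c :* x :- c :* y := c :* (x :- y)) refl _ _ _)

    closed-+ : ∀ (bs : Vec ℕ r) Ψ Θ → closed bs (λ gs → Ψ gs + Θ gs) ≈ closed bs Ψ + closed bs Θ
    closed-+ []       Ψ Θ = refl
    closed-+ (b ∷ bs) Ψ Θ = trans (+-congˡ (-‿cong (closed-+ bs _ _)))
      (solve 4 (λ x y u v → (x :+ y) :- (u :+ v) := (x :- u) :+ (y :- v)) refl _ _ _ _)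

    closed-sub : ∀ (bs : Vec ℕ r) Ψ Θ → closed bs (λ gs → Ψ gs - Θ gs) ≈ closed bs Ψ - closed bs Θ
    closed-sub bs Ψ Θ = trans (closed-cong bs (λ gs → +-congˡ (solve 1 (λ x → :- x := :- :1 :* x) refl _)))
      (trans (closed-+ bs Ψ _) (+-congˡ (trans (closed-* bs (- 1#) Θ) (solve 1 (λ x → :- :1 :* x := :- x) refl _))))

    closed-0 : ∀ (bs : Vec ℕ r) {Ψ} → (∀ gs → Ψ gs ≈ 0#) → closed bs Ψ ≈ 0#
    closed-0 []       e = e []
    closed-0 (b ∷ bs) e = trans (+-cong (e _) (-‿cong (closed-0 bs (λ gs → e _)))) (solve 0 (:0 :- :0 := :0) refl)

    slot-sub : {Ψ : Vec Slot (suc n) → Carrier} → LinearFirst Ψ → ∀ g h gs →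
      Ψ ((λ e → g e - h e) ∷ gs) ≈ Ψ (g ∷ gs) - Ψ (h ∷ gs)
    slot-sub {Ψ = Ψ} l g h gs = begin
      Ψ ((λ e → g e - h e) ∷ gs)             ≈⟨ slot-cong gs (λ e → solve 2 (λ x y → x :- y := x :+ :- :1 :* y) refl _ _) ⟩
      Ψ ((λ e → g e + - 1# * h e) ∷ gs)      ≈⟨ trans (slot-+ _ _ gs) (+-congˡ (slot-* (- 1#) h gs)) ⟩
      Ψ (g ∷ gs) + - 1# * Ψ (h ∷ gs)         ≈⟨ solve 2 (λ x y → x :+ :- :1 :* y := x :- y) refl _ _ ⟩
      Ψ (g ∷ gs) - Ψ (h ∷ gs)                ∎
      where open LinearFirst l

    -- At l = next bs the sum over the following entries lacks its lowest term;
    -- the junction relation cancels it against a boundary term.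
    sweep : ∀ (a : Carrier) (u U : ℕ → Slot) b (bs : Vec ℕ r) (Ψ : Vec Slot (suc r) → Carrier) →
      1 ℕ.≤ b → b ℕ.< next bs → Increasing bs →
      (∀ l → b ℕ.≤ l → l ℕ.≤ next bs → ∀ e → a * (wt l * u l e) ≈ U (suc l) e - U l e) →
      (next bs ℕ.< C → ∀ e → u (next bs) e ≈ dn (S (next bs)) e) →
      (next bs ℕ.< C → ∀ e → U (suc (next bs)) e ≈ a * up (S (next bs)) e) →
      Multilinear Ψ → Junction Ψ →
      a * sumL (range1 M) (λ l → ind ((b ≤ᵇ l) ∧ (l ≤ᵇ next bs)) * (wt l * nested l bs (λ gs → Ψ (u l ∷ gs))))
        ≈ Ψ (U (suc (next bs)) ∷ raised bs) - closed bs (λ gs → Ψ (U b ∷ gs))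

    -- A preceding entry below b makes strictness automatic for the first sum.
    nested-below : ∀ prev b (bs : Vec ℕ r) Ψ → prev ℕ.< b → Increasing (b ∷ bs) → Multilinear Ψ → Junction Ψ →
      nested prev (b ∷ bs) Ψ ≈ closed (b ∷ bs) Ψ

    -- With preceding entry b, strictness removes exactly the term l = b. In that term the next sum
    -- is again unrestricted, since b lies below the next lower end, and the weight is 1.
    nested-at : ∀ b (bs : Vec ℕ r) Ψ → 1 ℕ.≤ b → Increasing (b ∷ bs) → Multilinear Ψ → Junction Ψ →
      nested b (b ∷ bs) Ψ ≈ closed (b ∷ bs) Ψ - closed bs (λ gs → Ψ (d b ∷ gs))

    private
      -- With the inner sums already in closed form, the summand depends linearly on its first slot
      -- and is therefore a difference of consecutive values of `U`.
      tele : ∀ (a : Carrier) (u U : ℕ → Slot) b (bs : Vec ℕ r) (Ψ : Vec Slot (suc r) → Carrier) →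
        1 ℕ.≤ b → b ℕ.< next bs → Increasing bs →
        (∀ l → b ℕ.≤ l → l ℕ.≤ next bs → ∀ e → a * (wt l * u l e) ≈ U (suc l) e - U l e) →
        Multilinear Ψ →
        a * sumL (range1 M) (λ l → ind ((b ≤ᵇ l) ∧ (l ≤ᵇ next bs)) * (wt l * closed bs (λ gs → Ψ (u l ∷ gs))))
          ≈ closed bs (λ gs → Ψ (U (suc (next bs)) ∷ gs)) - closed bs (λ gs → Ψ (U b ∷ gs))
      tele a u U b bs Ψ 1≤b b< inc ΔU (lin , _) = begin
        a * sumL (range1 M) (λ l → ind ((b ≤ᵇ l) ∧ (l ≤ᵇ next bs)) * (wt l * closed bs (λ gs → Ψ (u l ∷ gs))))
          ≈⟨ sum-*ˡ (range1 M) a _ ⟨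
        sumL (range1 M) (λ l → a * (ind ((b ≤ᵇ l) ∧ (l ≤ᵇ next bs)) * (wt l * closed bs (λ gs → Ψ (u l ∷ gs)))))
          ≈⟨ sum-cong (range1 M) (λ l → solve 4 (λ a i w c → a :* (i :* (w :* c)) := i :* (a :* (w :* c))) refl _ _ _ _) ⟩
        sumL (range1 M) (λ l → ind ((b ≤ᵇ l) ∧ (l ≤ᵇ next bs)) * (a * (wt l * closed bs (λ gs → Ψ (u l ∷ gs)))))
          ≈⟨ sum-telescope M b (next bs) _ (λ l → closed bs (λ gs → Ψ (U l ∷ gs))) 1≤b (ℕP.<⇒≤ b<)
               (ℕP.≤-trans (next≤C bs inc) C≤M) step ⟩
        closed bs (λ gs → Ψ (U (suc (next bs)) ∷ gs)) - closed bs (λ gs → Ψ (U b ∷ gs)) ∎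
        where
        open LinearFirst lin
        step : ∀ l → b ℕ.≤ l → l ℕ.≤ next bs →
          a * (wt l * closed bs (λ gs → Ψ (u l ∷ gs)))
            ≈ closed bs (λ gs → Ψ (U (suc l) ∷ gs)) - closed bs (λ gs → Ψ (U l ∷ gs))
        step l b≤l l≤ = begin
          a * (wt l * closed bs (λ gs → Ψ (u l ∷ gs)))
            ≈⟨ trans (closed-* bs a _) (*-congˡ (closed-* bs (wt l) _)) ⟨
          closed bs (λ gs → a * (wt l * Ψ (u l ∷ gs)))
            ≈⟨ closed-cong bs (λ gs → trans
                 (trans (*-congˡ (sym (slot-* (wt l) (u l) gs))) (sym (slot-* a _ gs)))
                 (trans (slot-cong gs (ΔU l b≤l l≤)) (slot-sub lin _ _ gs))) ⟩
          closed bs (λ gs → Ψ (U (suc l) ∷ gs) - Ψ (U l ∷ gs))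
            ≈⟨ closed-sub bs _ _ ⟩
          closed bs (λ gs → Ψ (U (suc l) ∷ gs)) - closed bs (λ gs → Ψ (U l ∷ gs)) ∎

    sweep a u U b [] Ψ 1≤b b< inc ΔU u-dn U-up lin junc = tele a u U b [] Ψ 1≤b b< tt ΔU lin
    sweep a u U b bs@(b₂ ∷ bs₂) Ψ 1≤b b< inc@(b₂< , inc₂) ΔU u-dn U-up lin@(lin₁ , lin₂) junc = begin
      a * sumL A (λ l → ι l * (wt l * nested l bs (Ψ⟨ u l ⟩)))
        ≈⟨ *-congˡ (trans (sum-cong A term) (trans (sum-+ A _ _) (+-congˡ (sum-neg A _)))) ⟩
      a * (sumL A (λ l → ι l * (wt l * closed bs Ψ⟨ u l ⟩)) - sumL A (λ l → ind (l ≡ᵇ b₂) * (wt l * X l)))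
        ≈⟨ *-congˡ (+-congˡ (-‿cong (trans (sum-single M b₂ (λ l → wt l * X l) 1≤b₂ b₂≤M)
             (trans (*-congʳ (wt-1 b₂ b₂<C)) (*-identityˡ _))))) ⟩
      a * (sumL A (λ l → ι l * (wt l * closed bs Ψ⟨ u l ⟩)) - X b₂)
        ≈⟨ trans (distribˡ _ _ _) (+-congʳ (tele a u U b bs Ψ 1≤b b< inc ΔU lin)) ⟩
      ((Ψ (U (suc b₂) ∷ raised bs) - closed bs₂ (λ gs → Ψ (U (suc b₂) ∷ S b₂ ∷ gs))) - closed bs Ψ⟨ U b ⟩) + a * - X b₂
        ≈⟨ solve 5 (λ p q r a x → ((p :- q) :- r) :+ a :* :- x := (p :- r) :- (q :+ a :* x)) refl _ _ _ _ _ ⟩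
      (Ψ (U (suc b₂) ∷ raised bs) - closed bs Ψ⟨ U b ⟩)
        - (closed bs₂ (λ gs → Ψ (U (suc b₂) ∷ S b₂ ∷ gs)) + a * X b₂)
        ≈⟨ +-congˡ (-‿cong vanish) ⟩
      (Ψ (U (suc b₂) ∷ raised bs) - closed bs Ψ⟨ U b ⟩) - 0#
        ≈⟨ solve 1 (λ x → x :- :0 := x) refl _ ⟩
      Ψ (U (suc b₂) ∷ raised bs) - closed bs Ψ⟨ U b ⟩ ∎
      where
      open LinearFirst
      A = range1 M
      Ψ⟨_⟩ : Slot → Vec Slot _ → Carrier
      Ψ⟨ g ⟩ gs = Ψ (g ∷ gs)
      ι : ℕ → Carrier
      ι l = ind ((b ≤ᵇ l) ∧ (l ≤ᵇ b₂))
      X : ℕ → Carrier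
      X l = closed bs₂ (λ gs → Ψ (u l ∷ d b₂ ∷ gs))
      b₂<C = ℕP.≤-trans b₂< (next≤C bs₂ inc₂)
      b₂≤M = ℕP.≤-trans (ℕP.<⇒≤ b₂<C) C≤M
      1≤b₂ = ℕP.≤-trans 1≤b (ℕP.<⇒≤ b<)
      -- The true summand differs from the closed form only at l = b₂: below it the next sum is
      -- unrestricted, and above it the indicator is zero.
      term : ∀ l → ι l * (wt l * nested l bs Ψ⟨ u l ⟩)
                   ≈ ι l * (wt l * closed bs Ψ⟨ u l ⟩) + - (ind (l ≡ᵇ b₂) * (wt l * X l))
      term l with ℕP.<-cmp l b₂
      ... | tri< l<b₂ l≢b₂ _ rewrite ≡ᵇ-false l≢b₂ = trans
        (*-congˡ (*-congˡ (nested-below l b₂ bs₂ Ψ⟨ u l ⟩ l<b₂ inc (lin₂ (u l)) (proj₂ junc (u l)))))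
        (solve 2 (λ x y → x := x :- :0 :* y) refl _ _)
      ... | tri≈ _ ≡.refl _ rewrite ≡ᵇ-true l | ≤ᵇ-true (ℕP.<⇒≤ b<) | ≤ᵇ-true (ℕP.≤-refl {l}) = trans
        (*-congˡ (*-congˡ (nested-at l bs₂ Ψ⟨ u l ⟩ 1≤b₂ inc (lin₂ (u l)) (proj₂ junc (u l)))))
        (solve 3 (λ w x y → :1 :* (w :* (x :- y)) := :1 :* (w :* x) :- :1 :* (w :* y)) refl _ _ _)
      ... | tri> _ l≢b₂ b₂<l rewrite ≡ᵇ-false l≢b₂ | ≤ᵇ-false b₂<l | ∧-zeroʳ (b ≤ᵇ l) =
        solve 3 (λ x y z → :0 :* x := :0 :* y :- :0 :* z) refl _ _ _
      vanish : closed bs₂ (λ gs → Ψ (U (suc b₂) ∷ S b₂ ∷ gs)) + a * X b₂ ≈ 0#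
      vanish = begin
        closed bs₂ (λ gs → Ψ (U (suc b₂) ∷ S b₂ ∷ gs)) + a * X b₂
          ≈⟨ +-cong
               (trans (closed-cong bs₂ (λ gs → trans (slot-cong lin₁ _ (U-up b₂<C)) (slot-* lin₁ a _ _))) (closed-* bs₂ a _))
               (*-congˡ (closed-cong bs₂ (λ gs → trans (slot-cong lin₁ _ (u-dn b₂<C))
                 (slot-cong (proj₁ (lin₂ (dn (S b₂)))) gs (d-dn b₂ b₂<C))))) ⟩
        a * closed bs₂ (λ gs → Ψ (up (S b₂) ∷ S b₂ ∷ gs)) + a * closed bs₂ (λ gs → Ψ (dn (S b₂) ∷ dn (S b₂) ∷ gs))
          ≈⟨ trans (sym (distribˡ _ _ _)) (*-congˡ (trans (sym (closed-+ bs₂ _ _)) (closed-0 bs₂ (proj₁ junc (S b₂))))) ⟩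
        a * 0#
          ≈⟨ zeroʳ a ⟩
        0# ∎

    private
      sweep-S : ∀ b (bs : Vec ℕ r) (Ψ : Vec Slot (suc r) → Carrier) →
        1 ℕ.≤ b → Increasing (b ∷ bs) → Multilinear Ψ → Junction Ψ →
        sumL (range1 M) (λ l → ind ((b ≤ᵇ l) ∧ (l ≤ᵇ next bs)) * (wt l * nested l bs (λ gs → Ψ (d l ∷ gs))))
          ≈ closed (b ∷ bs) Ψ
      sweep-S b bs Ψ 1≤b (b< , inc) lin junc = trans (sym (*-identityˡ _))
        (sweep 1# d S b bs Ψ 1≤b b< inc
          (λ l _ l≤ e → trans (*-identityˡ _) (wt-d l (ℕP.≤-trans l≤ (next≤C bs inc)) e))
          (d-dn (next bs)) (λ lt e → trans (S-up _ lt e) (sym (*-identityˡ _))) lin junc)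

    nested-below prev b bs Ψ prev<b inc lin junc = trans
      (sum-cong (range1 M) (λ l → *-congʳ (reflexive (≡.cong ind (drop l)))))
      (sweep-S b bs Ψ (ℕP.≤-trans (s≤s z≤n) prev<b) inc lin junc)
      where
      drop : ∀ l → ((prev <ᵇ l) ∧ (b ≤ᵇ l) ∧ (l ≤ᵇ next bs)) ≡ ((b ≤ᵇ l) ∧ (l ≤ᵇ next bs))
      drop l with ℕP.<-≤-connex l b
      ... | inj₁ l<b rewrite ≤ᵇ-false l<b = ∧-zeroʳ (prev <ᵇ l)
      ... | inj₂ b≤l rewrite <ᵇ-true (ℕP.<-≤-trans prev<b b≤l) = ≡.refl

    nested-at b bs Ψ 1≤b inc@(b< , inc′) lin junc = begin
      sumL A (λ l → ind ((b <ᵇ l) ∧ (b ≤ᵇ l) ∧ (l ≤ᵇ next bs)) * f l)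
        ≈⟨ sum-cong A term ⟩
      sumL A (λ l → ind ((b ≤ᵇ l) ∧ (l ≤ᵇ next bs)) * f l + - (ind (l ≡ᵇ b) * f l))
        ≈⟨ trans (sum-+ A _ _) (+-congˡ (sum-neg A _)) ⟩
      sumL A (λ l → ind ((b ≤ᵇ l) ∧ (l ≤ᵇ next bs)) * f l) - sumL A (λ l → ind (l ≡ᵇ b) * f l)
        ≈⟨ +-cong (sweep-S b bs Ψ 1≤b inc lin junc) (-‿cong (trans (sum-single M b f 1≤b b≤M)
             (trans (trans (*-congʳ (wt-1 b b<C)) (*-identityˡ _)) (inner bs b< inc′ Ψ lin junc)))) ⟩
      closed (b ∷ bs) Ψ - closed bs (λ gs → Ψ (d b ∷ gs)) ∎
      where
      A = range1 M
      b<C = ℕP.≤-trans b< (next≤C bs inc′)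
      b≤M = ℕP.≤-trans (ℕP.<⇒≤ b<C) C≤M
      f : ℕ → Carrier
      f l = wt l * nested l bs (λ gs → Ψ (d l ∷ gs))
      inner : ∀ {r} (bs : Vec ℕ r) → b ℕ.< next bs → Increasing bs → ∀ (Ψ : Vec Slot (suc r) → Carrier) →
        Multilinear Ψ → Junction Ψ →
        nested b bs (λ gs → Ψ (d b ∷ gs)) ≈ closed bs (λ gs → Ψ (d b ∷ gs))
      inner []        _  _    Ψ _   _    = refl
      inner (b₂ ∷ bs) b< incb Ψ lin junc = nested-below b b₂ bs _ b< incb (proj₂ lin (d b)) (proj₂ junc (d b))
      term : ∀ l → ind ((b <ᵇ l) ∧ (b ≤ᵇ l) ∧ (l ≤ᵇ next bs)) * f l
                   ≈ ind ((b ≤ᵇ l) ∧ (l ≤ᵇ next bs)) * f l + - (ind (l ≡ᵇ b) * f l)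
      term l with ℕP.<-cmp l b
      ... | tri< l<b l≢b _ rewrite <ᵇ-false (ℕP.<⇒≤ l<b) | ≤ᵇ-false l<b | ≡ᵇ-false l≢b =
        solve 1 (λ x → :0 :* x := :0 :* x :- :0 :* x) refl _
      ... | tri≈ _ ≡.refl _ rewrite <ᵇ-false (ℕP.≤-refl {b}) | ≤ᵇ-true (ℕP.≤-refl {b}) | ≤ᵇ-true (ℕP.<⇒≤ b<) | ≡ᵇ-true b =
        solve 1 (λ x → :0 :* x := :1 :* x :- :1 :* x) refl _
      ... | tri> _ l≢b b<l rewrite <ᵇ-true b<l | ≤ᵇ-true (ℕP.<⇒≤ b<l) | ≡ᵇ-false l≢b =
        solve 2 (λ i x → i :* x := i :* x :- :0 :* x) refl _ _

-- Carries properties between vectors with the same entries whose lengths agree only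
-- propositionally.
toList-transport : ∀ {A : Set} {n m} (u : Vec A n) (v : Vec A m) → toList u ≡ toList v →
  (P : ∀ k → Vec A k → Set) → P n u → P m v
toList-transport []      []      _  P x = x
toList-transport (a ∷ u) (b ∷ v) eq P x with LP.∷-injective eq
... | ≡.refl , eq′ = toList-transport u v eq′ (λ k w → P (suc k) (a ∷ w)) x

nextOr : ∀ {r} → ℕ → Vec ℕ r → ℕ
nextOr C []      = C
nextOr C (b ∷ _) = b

interlaces : ∀ {r} → ℕ → ℕ → Vec ℕ r → Vec ℕ r → Bool
interlaces C prev []       []       = true
interlaces C prev (b ∷ bs) (l ∷ ls) =
  ((prev <ᵇ l) ∧ (b ≤ᵇ l) ∧ (l ≤ᵇ nextOr C bs)) ∧ interlaces C l bs ls

Chain : ∀ {r} → ℕ → Vec ℕ r → ℕ → Set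
Chain prev []       C = prev ℕ.≤ C
Chain prev (b ∷ bs) C = prev ℕ.< b × Chain b bs C

-- Power series as slots, and the one-row recursion for constant terms

module Recursion (𝕂 : Ring₀) where
  open CommutativeRing 𝕂 hiding (zero)
  open RingKit 𝕂
  open SlotFunctionals 𝕂
  open Junctions 𝕂 using (LinearFirst; Multilinear; Junction; gogForm-junction; gogForm-multilinear)
  open Telescope 𝕂
  open Relation.Binary.Reasoning.Setoid setoid

  private variable n r j : ℕ

  infix 4 _≐_
  _≐_ : Slot → Slot → Set
  g ≐ h = ∀ e → g e ≈ h e

  Multilinear-respects : ∀ {n} {Ψ : Vec Slot n → Carrier} → Multilinear Ψ → ∀ {gs hs} → Pointwise _≐_ gs hs → Ψ gs ≈ Ψ hs
  Multilinear-respects lin             []       = refl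
  Multilinear-respects lin {gs = _ ∷ gs} (e ∷ es) = trans (LinearFirst.slot-cong (proj₁ lin) gs e)
    (Multilinear-respects (proj₂ lin _) es)

  -- Slot vectors are concatenated from several pieces; on lists their reassociation carries no
  -- length arithmetic.
  gogFormL : List Slot → Carrier
  gogFormL gs = gogForm (length gs) (fromList gs)

  gogFormL-toList : ∀ (v : Vec Slot n) → gogFormL (toList v) ≈ gogForm n v
  gogFormL-toList v = toList-transport v (fromList (toList v)) (≡.sym (VecP.toList∘fromList (toList v)))
    (λ k w → gogForm k w ≈ gogForm _ v) refl

  gogFormL-cong : ∀ {gs hs} → PointwiseL _≐_ gs hs → gogFormL gs ≈ gogFormL hs
  gogFormL-cong {gs} {hs} es = begin
    gogFormL gs                              ≡⟨ ≡.cong gogFormL (VecP.toList∘fromList gs) ⟨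
    gogFormL (toList (fromList gs))          ≈⟨ gogFormL-toList (fromList gs) ⟩
    gogForm (length gs) (fromList gs)        ≈⟨ Multilinear-respects (gogForm-multilinear (length gs)) (proj₂ v) ⟩
    gogForm (length gs) (proj₁ v)            ≈⟨ gogFormL-toList (proj₁ v) ⟨
    gogFormL (toList (proj₁ v))              ≡⟨ ≡.cong gogFormL (toList-proj es) ⟩
    gogFormL hs                              ∎
    where
    aligned : ∀ {gs hs} → PointwiseL _≐_ gs hs → Data.Product.∃ λ (v : Vec Slot (length gs)) → Pointwise _≐_ (fromList gs) v
    aligned []       = [] , []
    aligned (_∷_ {y = h} e es) = h ∷ proj₁ (aligned es) , e ∷ proj₂ (aligned es)
    toList-proj : ∀ {gs hs} (es : PointwiseL _≐_ gs hs) → toList (proj₁ (aligned es)) ≡ hs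
    toList-proj []       = ≡.refl
    toList-proj (e ∷ es) = ≡.cong (_ ∷_) (toList-proj es)
    v = aligned es

  -- For the coefficient sequence g of a power series, sq g n is the slot
  -- e ↦ [x^(n-1-e)] g; as a truncated sequence it vanishes for e ≥ n.
  sq : (ℕ → Carrier) → ℕ → Slot
  sq g zero    e       = 0#
  sq g (suc n) zero    = g n
  sq g (suc n) (suc e) = sq g n e

  -- Coefficients of (1 + w x) g(x).
  times1+ : Carrier → (ℕ → Carrier) → (ℕ → Carrier)
  times1+ w g zero    = g zero
  times1+ w g (suc i) = g (suc i) + w * g i

  binom : ℕ → ℕ → Carrier
  binom zero    zero    = 1#
  binom zero    (suc i) = 0#
  binom (suc b) = times1+ 1# (binom b)

  binom-0 : ∀ b → binom b 0 ≈ 1#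
  binom-0 zero    = refl
  binom-0 (suc b) = binom-0 b

  sq-cong : ∀ {g h} n → (∀ i → g i ≈ h i) → sq g n ≐ sq h n
  sq-cong zero    e _       = refl
  sq-cong (suc n) e zero    = e n
  sq-cong (suc n) e (suc i) = sq-cong n e i

  sq-top : ∀ g n → sq g (suc n) n ≡ g 0
  sq-top g zero    = ≡.refl
  sq-top g (suc n) = sq-top g n

  sq-short : ∀ g n e → n ℕ.≤ e → sq g n e ≡ 0#
  sq-short g zero    e       _         = ≡.refl
  sq-short g (suc n) (suc e) (s≤s n≤e) = sq-short g n e n≤e

  sq-times1+ : ∀ w g n e → sq (times1+ w g) n e ≈ sq g n e + w * sq g n (suc e)
  sq-times1+ w g zero          e       = sym (trans (+-congˡ (zeroʳ w)) (+-identityˡ _))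
  sq-times1+ w g (suc zero)    zero    = sym (trans (+-congˡ (zeroʳ w)) (+-identityʳ _))
  sq-times1+ w g (suc (suc n)) zero    = refl
  sq-times1+ w g (suc n)       (suc e) = sq-times1+ w g n e

  sq-up : ∀ g n → up (sq g n) ≐ sq (times1+ 1# g) n
  sq-up g n e = sym (trans (sq-times1+ 1# g n e) (+-congˡ (*-identityˡ _)))

  toSlots : (b : Vec ℕ r) → ℕ → Vec Slot r
  toSlots bs n = Vec.map (λ b → sq (binom b) n) bs

  -- The level drops by one per slot because the exponent of x_i is -n + i - k: for i = k + 1 + s it
  -- equals 1 - (n - s).
  tailSlots : ∀ j → ℕ → (ℕ → Carrier) → Vec Slot j
  tailSlots zero    n g = []
  tailSlots (suc j) n g = sq g n ∷ tailSlots j (n ∸ 1) g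

  tailSlots-short : ∀ j n g → All (λ h → ∀ e → n ℕ.≤ e → h e ≈ 0#) (tailSlots j n g)
  tailSlots-short zero    n g = []
  tailSlots-short (suc j) n g = (λ e n≤e → reflexive (sq-short g n e n≤e))
    ∷ All.map (λ {h} s e n≤e → s e (ℕP.≤-trans (ℕP.m∸n≤m n 1) n≤e)) (tailSlots-short j (n ∸ 1) g)

  tailSlots-up : ∀ j n {g h} → (∀ i → times1+ 1# g i ≈ h i) →
    PointwiseL _≐_ (toList (Vec.map up (tailSlots j n g))) (toList (tailSlots j n h))
  tailSlots-up zero    n e = []
  tailSlots-up (suc j) n {g} e = (λ i → trans (sq-up g n i) (sq-cong n e i)) ∷ tailSlots-up j (n ∸ 1) e

  tailSeries : Carrier → ℕ → ℕ → Carrier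
  tailSeries q c = times1+ q (binom c)

  tailSeries-up : ∀ q c i → times1+ 1# (tailSeries q c) i ≈ tailSeries q (suc c) i
  tailSeries-up q c zero          = refl
  tailSeries-up q c (suc zero)    = solve 4 (λ a b q o → (a :+ q :* b) :+ o :* b := (a :+ o :* b) :+ q :* b) refl _ _ q 1#
  tailSeries-up q c (suc (suc i)) = solve 5 (λ a b d q o → (a :+ q :* b) :+ o :* (b :+ q :* d) := (a :+ o :* b) :+ q :* (b :+ o :* d))
    refl _ _ _ q 1#

  sumV : ∀ r → List ℕ → (Vec ℕ r → Carrier) → Carrier
  sumV zero    A f = f []
  sumV (suc r) A f = sumL A (λ a → sumV r A (λ v → f (a ∷ v)))

  sumV-cong : ∀ r A {f g} → (∀ v → f v ≈ g v) → sumV r A f ≈ sumV r A g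
  sumV-cong zero    A e = e []
  sumV-cong (suc r) A e = sum-cong A (λ a → sumV-cong r A (λ v → e _))

  sumV-* : ∀ r A c f → sumV r A (λ v → c * f v) ≈ c * sumV r A f
  sumV-* zero    A c f = refl
  sumV-* (suc r) A c f = trans (sum-cong A (λ a → sumV-* r A c _)) (sum-*ˡ A c _)

  topWeight : ℕ → Carrier → ℕ → Carrier
  topWeight C w l = if l ≡ᵇ C then w else 1#

  weights : ℕ → Carrier → Vec ℕ r → Carrier
  weights C w []       = 1#
  weights C w (l ∷ ls) = topWeight C w l * weights C w ls

  ind-∧ : ∀ a b → ind (a ∧ b) ≈ ind a * ind b
  ind-∧ true  b = sym (*-identityˡ _)
  ind-∧ false b = sym (zeroˡ _)

  module _ (p : Carrier) where

    minWeight : ℕ → Carrier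
    minWeight b = if b ≡ᵇ 1 then p else 1#

    -- The power series p (1 + x)² / (1 + p x).
    firstSeries : ℕ → Carrier
    firstSeries zero    = p * binom 2 zero
    firstSeries (suc i) = p * binom 2 (suc i) - p * firstSeries i

    firstSlot : ℕ → ℕ → Slot
    firstSlot n b = if b ≡ᵇ 1 then sq firstSeries n else sq (binom b) n

    sq-first : ∀ n e → sq firstSeries n e + p * sq firstSeries n (suc e) ≈ p * sq (binom 2) n e
    sq-first zero          e       = trans (+-congˡ (zeroʳ p)) (trans (+-identityˡ _) (sym (zeroʳ p)))
    sq-first (suc zero)    zero    = trans (+-congˡ (zeroʳ p)) (+-identityʳ _)
    sq-first (suc (suc n)) zero    = solve 2 (λ x y → (x :- y) :+ y := x) refl _ _
    sq-first (suc n)       (suc e) = sq-first n e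

    firstSlot-top : ∀ n b → firstSlot (suc n) b n ≈ minWeight b
    firstSlot-top n b with b ≡ᵇ 1
    ... | true  = trans (reflexive (sq-top firstSeries n)) (*-identityʳ p)
    ... | false = trans (reflexive (sq-top (binom b) n)) (binom-0 b)

    firstSlot-short : ∀ n b e → n ℕ.≤ e → firstSlot n b e ≈ 0#
    firstSlot-short n b e n≤e with b ≡ᵇ 1
    ... | true  = reflexive (sq-short firstSeries n e n≤e)
    ... | false = reflexive (sq-short (binom b) n e n≤e)

    firstSlot-≢1 : ∀ n b → 2 ℕ.≤ b → firstSlot n b ≡ sq (binom b) n
    firstSlot-≢1 n (suc zero)    (s≤s ())
    firstSlot-≢1 n (suc (suc b)) _ = ≡.refl

    private
      -- Appending with t in the middle, arranged so that the length is definitionally a successor,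
      -- as the Laplace expansion expects.
      snocSlots : Vec Slot r → Slot → Vec Slot j → Vec Slot (suc (r ℕ.+ j))
      snocSlots []       t ts = t ∷ ts
      snocSlots (g ∷ gs) t ts = g ∷ snocSlots gs t ts

      toList-snocSlots : ∀ (gs : Vec Slot r) t (ts : Vec Slot j) →
        toList (snocSlots gs t ts) ≡ toList gs ++ t ∷ toList ts
      toList-snocSlots []       t ts = ≡.refl
      toList-snocSlots (g ∷ gs) t ts = ≡.cong (g ∷_) (toList-snocSlots gs t ts)

      snocSlots-all : ∀ {P : Slot → Set} {gs : Vec Slot r} {t} {ts : Vec Slot j} →
        All P gs → P t → All P ts → All P (snocSlots gs t ts)
      snocSlots-all []       x ys = x ∷ ys
      snocSlots-all (z ∷ zs) x ys = z ∷ snocSlots-all zs x ys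

      append-multilinear : ∀ r {Θ : Vec Slot (r ℕ.+ j) → Carrier} ts → Multilinear Θ → Multilinear {r} (λ gs → Θ (gs Vec.++ ts))
      append-multilinear zero    ts lin       = tt
      append-multilinear (suc r) ts (l , lin) = record
        { slot-cong = λ gs → slot-cong (gs Vec.++ ts) ; slot-+ = λ g h gs → slot-+ g h (gs Vec.++ ts)
        ; slot-* = λ c g gs → slot-* c g (gs Vec.++ ts) } , (λ g → append-multilinear r ts (lin g))
        where open LinearFirst l

      append-junction : ∀ r {Θ : Vec Slot (r ℕ.+ j) → Carrier} ts → Junction Θ → Junction {r} (λ gs → Θ (gs Vec.++ ts))
      append-junction zero          ts junc       = tt
      append-junction (suc zero)    ts junc       = tt
      append-junction (suc (suc r)) ts (q , junc) = (λ h gs → q h (gs Vec.++ ts)) , (λ g → append-junction (suc r) ts (junc g))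

      lapSlots-∷ : ∀ N g (gs : Vec Slot (suc n)) Ψ →
        lapSlots N (g ∷ gs) Ψ ≈ g N * Ψ (Vec.map up gs) - lapSlots N gs (λ hs → Ψ (g ∷ hs))
      lapSlots-∷ N g (g′ ∷ gs) Ψ = refl

      lapSlots-vanish : ∀ N (gs : Vec Slot (suc n)) Ψ → All (λ g → g N ≈ 0#) gs → lapSlots N gs Ψ ≈ 0#
      lapSlots-vanish N (g ∷ [])      Ψ (e ∷ _)  = trans (*-congʳ e) (zeroˡ _)
      lapSlots-vanish N (g ∷ g′ ∷ gs) Ψ (e ∷ es) = trans (+-cong (trans (*-congʳ e) (zeroˡ _))
        (-‿cong (lapSlots-vanish N (g′ ∷ gs) _ es))) (solve 0 (:0 :- :0 := :0) refl)

    -- One row of the trapezoid: b ∷ bs bounds the row above from below, C from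
    -- above, τ is the first series of the tail and ts the rest of the tail.
    module Step {r j} (M C : ℕ) (C≤M : C ℕ.≤ M) (w : Carrier)
                (τ : ℕ → Carrier) (τ-0 : τ 0 ≈ 1#) (τ-up : ∀ i → times1+ 1# τ i ≈ times1+ w (binom C) i)
                (b : ℕ) (bs : Vec ℕ r) (ts : Vec Slot j) (ts-short : All (λ g → ∀ e → suc (r ℕ.+ j) ℕ.≤ e → g e ≈ 0#) ts)
                (chain : Chain 0 (b ∷ bs) (ℕ.pred C)) (1≤C : 1 ℕ.≤ C)
      where

      private
        N = suc (r ℕ.+ j)

        -- The value of `S` above C is the boundary term that absorbs the weight w of an entry l =
        -- C: the series (1 + wx)(1 + x)^C minus (1 + x)^C is w x (1 + x)^C.
        S d : ℕ → Slot
        S l = if l ≤ᵇ C then sq (binom l) (suc N) else sq (times1+ w (binom C)) (suc N)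
        d l = sq (binom l) N

        wt = topWeight C w

        S-≤ : ∀ l → l ℕ.≤ C → S l ≡ sq (binom l) (suc N)
        S-≤ l l≤C rewrite ≤ᵇ-true l≤C = ≡.refl

        S-> : S (suc C) ≡ sq (times1+ w (binom C)) (suc N)
        S-> rewrite ≤ᵇ-false (ℕP.n<1+n C) = ≡.refl

        wt-1 : ∀ l → l ℕ.< C → wt l ≈ 1#
        wt-1 l l<C rewrite ≡ᵇ-false (ℕP.<⇒≢ l<C) = refl

        S-up : ∀ l → l ℕ.< C → ∀ e → S (suc l) e ≈ up (S l) e
        S-up l l<C e rewrite S-≤ (suc l) l<C | S-≤ l (ℕP.<⇒≤ l<C) = sym (sq-up (binom l) (suc N) e)

        d-dn : ∀ l → l ℕ.< C → ∀ e → d l e ≈ dn (S l) e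
        d-dn l l<C e rewrite S-≤ l (ℕP.<⇒≤ l<C) = refl

        wt-d : ∀ l → l ℕ.≤ C → ∀ e → wt l * d l e ≈ S (suc l) e - S l e
        wt-d l l≤C e with ℕP.m≤n⇒m<n∨m≡n l≤C
        ... | inj₁ l<C = begin
          wt l * d l e                    ≈⟨ *-cong (wt-1 l l<C) (d-dn l l<C e) ⟩
          1# * S l (suc e)                ≈⟨ solve 2 (λ x y → :1 :* y := (x :+ y) :- x) refl (S l e) _ ⟩
          up (S l) e - S l e              ≈⟨ +-congʳ (S-up l l<C e) ⟨
          S (suc l) e - S l e             ∎
        ... | inj₂ ≡.refl = begin
          wt C * d C e                    ≡⟨ ≡.cong (λ c → (if c then w else 1#) * d C e) (≡ᵇ-true C) ⟩
          w * d C e                       ≈⟨ solve 2 (λ x y → y := (x :+ y) :- x) refl (sq (binom C) (suc N) e) _ ⟩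
          (sq (binom C) (suc N) e + w * d C e) - sq (binom C) (suc N) e
            ≈⟨ +-cong (sym (sq-times1+ w (binom C) (suc N) e)) (-‿cong (reflexive (≡.cong (λ s → s e) (≡.sym (S-≤ C ℕP.≤-refl))))) ⟩
          sq (times1+ w (binom C)) (suc N) e - S C e ≡⟨ ≡.cong (λ s → s e - S C e) S-> ⟨
          S (suc C) e - S C e ∎

        next′ : ∀ {r} → Vec ℕ r → ℕ
        next′ = next M C C≤M wt S d wt-1 S-up d-dn wt-d
        Increasing′ : ∀ {r} → Vec ℕ r → Set
        Increasing′ = Increasing M C C≤M wt S d wt-1 S-up d-dn wt-d
        nested′ : ∀ {r} → ℕ → Vec ℕ r → (Vec Slot r → Carrier) → Carrier
        nested′ = nested M C C≤M wt S d wt-1 S-up d-dn wt-d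
        raised′ : ∀ {r} → Vec ℕ r → Vec Slot r
        raised′ = raised M C C≤M wt S d wt-1 S-up d-dn wt-d
        closed′ : ∀ {r} → Vec ℕ r → (Vec Slot r → Carrier) → Carrier
        closed′ = closed M C C≤M wt S d wt-1 S-up d-dn wt-d

        next≡ : ∀ {r} (bs : Vec ℕ r) → next′ bs ≡ nextOr C bs
        next≡ []      = ≡.refl
        next≡ (_ ∷ _) = ≡.refl

        chain-increasing : ∀ {r} prev (bs : Vec ℕ r) → Chain prev bs (ℕ.pred C) → prev ℕ.< next′ bs × Increasing′ bs
        chain-increasing prev [] prev≤ = ≡.subst (prev ℕ.<_) (ℕP.suc-pred C {{ℕ.>-nonZero 1≤C}}) (s≤s prev≤) , tt
        chain-increasing prev (b ∷ bs) (prev<b , ch) = prev<b , chain-increasing b bs ch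

        next≤ : ∀ {r} (bs : Vec ℕ r) → Increasing′ bs → next′ bs ℕ.≤ C
        next≤ = next≤C M C C≤M wt S d wt-1 S-up d-dn wt-d

        1≤b = proj₁ chain
        b<next = proj₁ (chain-increasing b bs (proj₂ chain))
        inc = proj₂ (chain-increasing b bs (proj₂ chain))
        b<C = ℕP.<-≤-trans b<next (next≤ bs inc)

        a = minWeight b

        -- `u` gives the slot of the first entry of the row above, and `U` the boundary values of
        -- its telescoping sum scaled by the minimum weight of b. Only an entry 1 has a special
        -- series, and every l > b is at least 2, so `U` is a multiple of `S` from b + 1 on.
        u U : ℕ → Slot
        u = firstSlot N
        U l = if l ≡ᵇ b then firstSlot (suc N) b else (λ e → a * S l e)

        U-b : U b ≡ firstSlot (suc N) b
        U-b rewrite ≡ᵇ-true b = ≡.refl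

        U-> : ∀ l → b ℕ.< l → U l ≡ (λ e → a * S l e)
        U-> l b<l rewrite ≡ᵇ-false (ℕP.>⇒≢ b<l) = ≡.refl

        u-> : ∀ l → b ℕ.< l → u l ≡ d l
        u-> l b<l = firstSlot-≢1 N l (ℕP.≤-trans (s≤s 1≤b) b<l)

        -- The single telescoping step affected by minima. For b = 1 it is the equation φ + p x φ =
        -- p(1 + x)^2 of `firstSeries`; for larger b it is the ordinary difference.
        first-difference : ∀ e → a * firstSlot N b e ≈ a * S (suc b) e - firstSlot (suc N) b e
        first-difference e = go b 1≤b b<C
          where
          go : ∀ b → 1 ℕ.≤ b → b ℕ.< C → minWeight b * firstSlot N b e ≈ minWeight b * S (suc b) e - firstSlot (suc N) b e
          go 1 _ 1<C rewrite S-≤ 2 1<C = begin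
            p * sq firstSeries N e
              ≈⟨ solve 2 (λ x y → y := (x :+ y) :- x) refl (sq firstSeries (suc N) e) _ ⟩
            (sq firstSeries (suc N) e + p * sq firstSeries N e) - sq firstSeries (suc N) e
              ≈⟨ +-congʳ (sq-first (suc N) e) ⟩
            p * sq (binom 2) (suc N) e - sq firstSeries (suc N) e ∎
          go b@(suc (suc _)) _ b<C = begin
            1# * d b e
              ≈⟨ *-congˡ (d-dn b b<C e) ⟩
            1# * S b (suc e)
              ≈⟨ solve 2 (λ x y → :1 :* y := :1 :* (x :+ y) :- x) refl (S b e) _ ⟩
            1# * up (S b) e - S b e
              ≈⟨ +-cong (*-congˡ (sym (S-up b b<C e))) (-‿cong (reflexive (≡.cong (λ s → s e) (S-≤ b (ℕP.<⇒≤ b<C))))) ⟩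
            1# * S (suc b) e - sq (binom b) (suc N) e ∎

        ΔU : ∀ l → b ℕ.≤ l → l ℕ.≤ next′ bs → ∀ e → a * (wt l * u l e) ≈ U (suc l) e - U l e
        ΔU l b≤l l≤ e with ℕP.m≤n⇒m<n∨m≡n b≤l
        ... | inj₁ b<l rewrite U-> l b<l | U-> (suc l) (ℕP.m<n⇒m<1+n b<l) | u-> l b<l =
          trans (*-congˡ (wt-d l (ℕP.≤-trans l≤ (next≤ bs inc)) e))
            (solve 3 (λ a x y → a :* (x :- y) := a :* x :- a :* y) refl _ _ _)
        ... | inj₂ ≡.refl rewrite U-b | U-> (suc b) (ℕP.n<1+n b) =
          trans (*-congˡ (trans (*-congʳ (wt-1 b b<C)) (*-identityˡ _))) (first-difference e)

        Θ = gogForm (suc r ℕ.+ j)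
        Ψ : Vec Slot (suc r) → Carrier
        Ψ gs = Θ (gs Vec.++ Vec.map up ts)

        swept : a * sumL (range1 M) (λ l → ind ((b ≤ᵇ l) ∧ (l ≤ᵇ next′ bs)) * (wt l * nested′ l bs (λ gs → Ψ (u l ∷ gs))))
          ≈ Ψ (U (suc (next′ bs)) ∷ raised′ bs) - closed′ bs (λ gs → Ψ (U b ∷ gs))
        swept = sweep M C C≤M wt S d wt-1 S-up d-dn wt-d a u U b bs Ψ 1≤b b<next inc ΔU
          (λ lt e → trans (reflexive (≡.cong (λ s → s e) (u-> (next′ bs) b<next))) (d-dn (next′ bs) lt e))
          (λ lt e → trans (reflexive (≡.cong (λ s → s e) (U-> (suc (next′ bs)) (ℕP.m<n⇒m<1+n b<next)))) (*-congˡ (S-up (next′ bs) lt e)))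
          (append-multilinear (suc r) (Vec.map up ts) (gogForm-multilinear (suc r ℕ.+ j)))
          (append-junction (suc r) (Vec.map up ts) (gogForm-junction (suc r ℕ.+ j)))

        t = sq τ (suc N)

        t-up : up t ≐ S (suc C)
        t-up e = trans (sq-up τ (suc N) e) (trans (sq-cong (suc N) τ-up e) (reflexive (≡.cong (λ s → s e) (≡.sym S->))))

        -- The factors 1 + x left by the omitted variable raise each bottom series by one: (1 + x)(1
        -- + x)^b₂ is the upper boundary value of the interval ending at b₂, and (1 + x)τ that of
        -- the interval ending at C.
        raised-up : ∀ {r j} b (bs : Vec ℕ r) (ts : Vec Slot j) → b ℕ.< next′ bs → Increasing′ bs →
          Pointwise _≐_ (Vec.map up (snocSlots (toSlots bs (suc N)) t ts)) (raised′ (b ∷ bs) Vec.++ Vec.map up ts)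
        raised-up b [] ts _ _ = t-up ∷ PW.refl (λ _ → refl)
        raised-up b (b₂ ∷ bs) ts b< inc@(b₂< , inc′) = first ∷ raised-up b₂ bs ts b₂< inc′
          where
          first : up (sq (binom b₂) (suc N)) ≐ S (suc b₂)
          first e = trans (reflexive (≡.cong (λ s → up s e) (≡.sym (S-≤ b₂ (ℕP.<⇒≤ b₂<C))))) (sym (S-up b₂ b₂<C e))
            where b₂<C = ℕP.<-≤-trans b₂< (next≤ bs inc′)

        -- All series of the bottom entries after the first, and τ, start with 1, so omitting their
        -- variables gives coefficient 1. The slots in `ts` have lower level and vanish at N, so
        -- omitting them gives nothing. The surviving terms match `closed′` one by one.
        lap-closed : ∀ {r j} (bs : Vec ℕ r) (ts : Vec Slot j) → Increasing′ bs → All (λ g → g N ≈ 0#) ts →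
          (Θ : Vec Slot (r ℕ.+ j) → Carrier) → Multilinear Θ →
          lapSlots N (snocSlots (toSlots bs (suc N)) t ts) Θ ≈ closed′ bs (λ gs → Θ (gs Vec.++ Vec.map up ts))
        lap-closed [] [] _ _ Θ lin = trans (*-congʳ (trans (reflexive (sq-top τ N)) τ-0)) (*-identityˡ _)
        lap-closed [] ts@(_ ∷ _) _ zs Θ lin = begin
          t N * Θ (Vec.map up ts) - lapSlots N ts (λ hs → Θ (t ∷ hs))
            ≈⟨ +-cong (trans (*-congʳ (trans (reflexive (sq-top τ N)) τ-0)) (*-identityˡ _)) (-‿cong (lapSlots-vanish N ts _ zs)) ⟩
          Θ (Vec.map up ts) - 0#
            ≈⟨ solve 1 (λ x → x :- :0 := x) refl _ ⟩
          Θ (Vec.map up ts) ∎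
        lap-closed (b ∷ bs) ts (b< , inc) zs Θ lin = begin
          lapSlots N (sq (binom b) (suc N) ∷ v) Θ
            ≈⟨ lapSlots-∷ N _ v Θ ⟩
          sq (binom b) (suc N) N * Θ (Vec.map up v) - lapSlots N v (λ hs → Θ (sq (binom b) (suc N) ∷ hs))
            ≈⟨ +-cong (trans (*-congʳ (trans (reflexive (sq-top (binom b) N)) (binom-0 b))) (*-identityˡ _))
                 (-‿cong (lap-closed bs ts inc zs _ (proj₂ lin _))) ⟩
          Θ (Vec.map up v) - closed′ bs (λ gs → Θ (sq (binom b) (suc N) ∷ gs Vec.++ Vec.map up ts))
            ≈⟨ +-cong (Multilinear-respects lin (raised-up b bs ts b< inc))
                 (-‿cong (reflexive (≡.cong (λ s → closed′ bs (λ gs → Θ (s ∷ gs Vec.++ Vec.map up ts)))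
                   (≡.sym (S-≤ b (ℕP.<⇒≤ (ℕP.<-≤-trans b< (next≤ bs inc)))))))) ⟩
          closed′ (b ∷ bs) (λ gs → Θ (gs Vec.++ Vec.map up ts)) ∎
          where v = snocSlots (toSlots bs (suc N)) t ts

        nested-sumV : ∀ {r} prev (bs : Vec ℕ r) Ψ →
          nested′ prev bs Ψ ≈ sumV r (range1 M) (λ ls → ind (interlaces C prev bs ls) * (weights C w ls * Ψ (toSlots ls N)))
        nested-sumV prev []       Ψ = solve 1 (λ x → x := :1 :* (:1 :* x)) refl _
        nested-sumV {suc r} prev (b ∷ bs) Ψ = sum-cong (range1 M) (λ l → begin
          ind (cond l) * (wt l * nested′ l bs (λ gs → Ψ (d l ∷ gs)))
            ≈⟨ *-congˡ (*-congˡ (nested-sumV l bs _)) ⟩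
          ind (cond l) * (wt l * sumV r (range1 M) (λ ls → ind (interlaces C l bs ls) * (weights C w ls * Ψ (d l ∷ toSlots ls N))))
            ≈⟨ trans (sym (*-assoc _ _ _)) (sym (sumV-* r (range1 M) _ _)) ⟩
          sumV r (range1 M) (λ ls → ind (cond l) * wt l * (ind (interlaces C l bs ls) * (weights C w ls * Ψ (d l ∷ toSlots ls N))))
            ≈⟨ sumV-cong r (range1 M) (λ ls → trans
                 (solve 5 (λ c t i x y → c :* t :* (i :* (x :* y)) := (c :* i) :* (t :* x :* y)) refl _ _ _ _ _)
                 (*-congʳ (trans (sym (ind-∧ (cond l) (interlaces C l bs ls)))
                   (reflexive (≡.cong (λ c → ind (((prev <ᵇ l) ∧ (b ≤ᵇ l) ∧ (l ≤ᵇ c)) ∧ interlaces C l bs ls)) (next≡ bs)))))) ⟩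
          sumV r (range1 M) (λ ls → ind (interlaces C prev (b ∷ bs) (l ∷ ls)) * (weights C w (l ∷ ls) * Ψ (toSlots (l ∷ ls) N))) ∎)
          where
          cond : ℕ → Bool
          cond l = (prev <ᵇ l) ∧ (b ≤ᵇ l) ∧ (l ≤ᵇ next′ bs)

      -- The two computations meet here: the Laplace expansion of the larger constant term and the
      -- closed form of the sum over the row above are the same alternating sum.
      step : gogFormL (firstSlot (suc N) b ∷ toList (toSlots bs (suc N)) ++ sq τ (suc N) ∷ toList ts)
        ≈ minWeight b * sumV (suc r) (range1 M) (λ ls → ind (interlaces C 0 (b ∷ bs) ls) * (weights C w ls *
            gogFormL (firstSlot N (Vec.head ls) ∷ toList (toSlots (Vec.tail ls) N) ++ toList (Vec.map up ts))))
      step = begin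
        gogFormL (firstSlot (suc N) b ∷ toList (toSlots bs (suc N)) ++ sq τ (suc N) ∷ toList ts)
          ≡⟨ ≡.cong (λ l → gogFormL (firstSlot (suc N) b ∷ l)) (toList-snocSlots (toSlots bs (suc N)) t ts) ⟨
        gogFormL (toList (firstSlot (suc N) b ∷ v))
          ≈⟨ gogFormL-toList (firstSlot (suc N) b ∷ v) ⟩
        gogForm (suc N) (firstSlot (suc N) b ∷ v)
          ≈⟨ gogForm-laplace N (firstSlot (suc N) b ∷ v) (firstSlot-short (suc N) b ∷ snocSlots-all all-short (λ e lt → reflexive (sq-short τ (suc N) e lt))
               (All.map (λ s e lt → s e (ℕP.<⇒≤ lt)) ts-short)) ⟩
        lapSlots N (firstSlot (suc N) b ∷ v) Θ
          ≈⟨ lapSlots-∷ N _ v Θ ⟩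
        firstSlot (suc N) b N * Θ (Vec.map up v) - lapSlots N v (λ hs → Θ (firstSlot (suc N) b ∷ hs))
          ≈⟨ +-cong (*-cong (firstSlot-top N b) (Multilinear-respects (gogForm-multilinear N) (raised-up b bs ts b<next inc)))
               (-‿cong (lap-closed bs ts inc (All.map (λ s → s N ℕP.≤-refl) ts-short) _ (proj₂ (gogForm-multilinear N) _))) ⟩
        a * Ψ (S (suc (next′ bs)) ∷ raised′ bs) - closed′ bs (λ gs → Ψ (firstSlot (suc N) b ∷ gs))
          ≈⟨ +-cong (trans (sym (LinearFirst.slot-* (proj₁ (gogForm-multilinear N)) a (S (suc (next′ bs))) _))
                     (reflexive (≡.cong (λ s → Ψ (s ∷ raised′ bs)) (≡.sym (U-> (suc (next′ bs)) (ℕP.m<n⇒m<1+n b<next))))))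
               (-‿cong (reflexive (≡.cong (λ s → closed′ bs (λ gs → Ψ (s ∷ gs))) (≡.sym U-b)))) ⟩
        Ψ (U (suc (next′ bs)) ∷ raised′ bs) - closed′ bs (λ gs → Ψ (U b ∷ gs))
          ≈⟨ swept ⟨
        a * sumL (range1 M) (λ l → ind ((b ≤ᵇ l) ∧ (l ≤ᵇ next′ bs)) * (wt l * nested′ l bs (λ gs → Ψ (u l ∷ gs))))
          ≈⟨ *-congˡ (sum-cong (range1 M) expand) ⟩
        a * sumV (suc r) (range1 M) (λ ls → ind (interlaces C 0 (b ∷ bs) ls) * (weights C w ls *
            gogFormL (firstSlot N (Vec.head ls) ∷ toList (toSlots (Vec.tail ls) N) ++ toList (Vec.map up ts)))) ∎
        where
        v = snocSlots (toSlots bs (suc N)) t ts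
        all-short : All (Short N) (toSlots bs (suc N))
        all-short = AllP.map⁺ (All.universal (λ b e lt → reflexive (sq-short (binom b) (suc N) e lt)) bs)
        toΨ : ∀ l ls → Ψ (u l ∷ toSlots ls N) ≈ gogFormL (firstSlot N l ∷ toList (toSlots ls N) ++ toList (Vec.map up ts))
        toΨ l ls = sym (trans (reflexive (≡.cong (λ x → gogFormL (firstSlot N l ∷ x)) (≡.sym (VecP.toList-++ (toSlots ls N) (Vec.map up ts)))))
          (gogFormL-toList (firstSlot N l ∷ toSlots ls N Vec.++ Vec.map up ts)))
        drop-0< : ∀ l → ((b ≤ᵇ l) ∧ (l ≤ᵇ next′ bs)) ≡ ((0 <ᵇ l) ∧ (b ≤ᵇ l) ∧ (l ≤ᵇ nextOr C bs))
        drop-0< zero    rewrite ≤ᵇ-false 1≤b = ≡.refl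
        drop-0< (suc l) = ≡.cong (λ c → (b ≤ᵇ suc l) ∧ (suc l ≤ᵇ c)) (next≡ bs)
        expand : ∀ l → ind ((b ≤ᵇ l) ∧ (l ≤ᵇ next′ bs)) * (wt l * nested′ l bs (λ gs → Ψ (u l ∷ gs)))
          ≈ sumV r (range1 M) (λ ls → ind (interlaces C 0 (b ∷ bs) (l ∷ ls)) * (weights C w (l ∷ ls) *
              gogFormL (firstSlot N l ∷ toList (toSlots ls N) ++ toList (Vec.map up ts))))
        expand l = begin
          ind ((b ≤ᵇ l) ∧ (l ≤ᵇ next′ bs)) * (wt l * nested′ l bs (λ gs → Ψ (u l ∷ gs)))
            ≈⟨ *-cong (reflexive (≡.cong ind (drop-0< l))) (*-congˡ (nested-sumV l bs _)) ⟩
          ind cond * (wt l * sumV r (range1 M) _)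
            ≈⟨ trans (sym (*-assoc _ _ _)) (sym (sumV-* r (range1 M) _ _)) ⟩
          sumV r (range1 M) (λ ls → ind cond * wt l * (ind (interlaces C l bs ls) * (weights C w ls * Ψ (u l ∷ toSlots ls N))))
            ≈⟨ sumV-cong r (range1 M) (λ ls → trans
                 (solve 5 (λ c t i x y → c :* t :* (i :* (x :* y)) := (c :* i) :* (t :* x :* y)) refl _ _ _ _ _)
                 (*-cong (sym (ind-∧ cond (interlaces C l bs ls))) (*-congˡ (toΨ l ls)))) ⟩
          sumV r (range1 M) (λ ls → ind (interlaces C 0 (b ∷ bs) (l ∷ ls)) * (weights C w (l ∷ ls) *
              gogFormL (firstSlot N l ∷ toList (toSlots ls N) ++ toList (Vec.map up ts)))) ∎
          where cond = (0 <ᵇ l) ∧ (b ≤ᵇ l) ∧ (l ≤ᵇ nextOr C bs)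

-- Rows of Gog trapezoids

∧-true : ∀ {a b} → (a ∧ b) ≡ true → a ≡ true × b ≡ true
∧-true {true} e = ≡.refl , e

≤ᵇ-sound : ∀ {m n} → (m ≤ᵇ n) ≡ true → m ℕ.≤ n
≤ᵇ-sound {m} {n} e = ℕP.≤ᵇ⇒≤ m n (≡.subst T (≡.sym e) _)

<ᵇ-sound : ∀ {m n} → (m <ᵇ n) ≡ true → m ℕ.< n
<ᵇ-sound {m} {n} e = ℕP.<ᵇ⇒< m n (≡.subst T (≡.sym e) _)

range1-∷ʳ : ∀ n → range1 (suc n) ≡ range1 n ++ (suc n ∷ [])
range1-∷ʳ n = ≡.trans (≡.cong (List.map suc) (≡.sym (LP.upTo-∷ʳ n))) (LP.map-++ suc (upTo n) (n ∷ []))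

range1-∷ : ∀ n → range1 (suc n) ≡ 1 ∷ List.map suc (range1 n)
range1-∷ n = ≡.cong (λ xs → 1 ∷ List.map suc xs) (≡.sym (LP.map-upTo suc n))

allB-map : ∀ (f : ℕ → ℕ) P xs → allB P (List.map f xs) ≡ allB (P ∘ f) xs
allB-map f P []       = ≡.refl
allB-map f P (x ∷ xs) = ≡.cong (P (f x) ∧_) (allB-map f P xs)

allB-shift : ∀ P n → allB P (range1 (suc n)) ≡ P 1 ∧ allB (P ∘ suc) (range1 n)
allB-shift P n = ≡.trans (≡.cong (allB P) (range1-∷ n)) (≡.cong (P 1 ∧_) (allB-map suc P (range1 n)))

allB-∷ʳ : ∀ P xs x → allB P (xs ++ (x ∷ [])) ≡ allB P xs ∧ P x
allB-∷ʳ P []       x = ∧-identityʳ (P x)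
allB-∷ʳ P (y ∷ xs) x = ≡.trans (≡.cong (P y ∧_) (allB-∷ʳ P xs x)) (≡.sym (∧-assoc (P y) _ _))

allB-range1 : ∀ P n → allB P (range1 (suc n)) ≡ allB P (range1 n) ∧ P (suc n)
allB-range1 P n = ≡.trans (≡.cong (allB P) (range1-∷ʳ n)) (allB-∷ʳ P (range1 n) (suc n))

allB-cong : ∀ {P Q} n → (∀ j → suc j ℕ.≤ n → P (suc j) ≡ Q (suc j)) → allB P (range1 n) ≡ allB Q (range1 n)
allB-cong zero    e = ≡.refl
allB-cong {P} {Q} (suc n) e = ≡.trans (allB-range1 P n)
  (≡.trans (≡.cong₂ _∧_ (allB-cong n (λ j j≤n → e j (ℕP.m≤n⇒m≤1+n j≤n))) (e n ℕP.≤-refl)) (≡.sym (allB-range1 Q n)))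

[_]₁ : Bool → ℕ
[ b ]₁ = if b then 1 else 0

countB-∷ : ∀ P x xs → countB P (x ∷ xs) ≡ [ P x ]₁ ℕ.+ countB P xs
countB-∷ P x xs with P x
... | true  = ≡.refl
... | false = ≡.refl

countB-map : ∀ (f : ℕ → ℕ) P xs → countB P (List.map f xs) ≡ countB (P ∘ f) xs
countB-map f P []       = ≡.refl
countB-map f P (x ∷ xs) = ≡.trans (countB-∷ P (f x) _)
  (≡.trans (≡.cong ([ P (f x) ]₁ ℕ.+_) (countB-map f P xs)) (≡.sym (countB-∷ (P ∘ f) x xs)))

countB-shift : ∀ P n → countB P (range1 (suc n)) ≡ [ P 1 ]₁ ℕ.+ countB (P ∘ suc) (range1 n)
countB-shift P n = ≡.trans (≡.cong (countB P) (range1-∷ n))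
  (≡.trans (countB-∷ P 1 _) (≡.cong ([ P 1 ]₁ ℕ.+_) (countB-map suc P (range1 n))))

countB-range1 : ∀ P n → countB P (range1 (suc n)) ≡ countB P (range1 n) ℕ.+ [ P (suc n) ]₁
countB-range1 P n = ≡.trans (≡.cong (countB P) (range1-∷ʳ n)) (go (range1 n))
  where
  go : ∀ xs → countB P (xs ++ (suc n ∷ [])) ≡ countB P xs ℕ.+ [ P (suc n) ]₁
  go []       = ≡.trans (countB-∷ P (suc n) []) (ℕP.+-comm [ P (suc n) ]₁ 0)
  go (x ∷ xs) = ≡.trans (countB-∷ P x _) (≡.trans (≡.cong ([ P x ]₁ ℕ.+_) (go xs))
    (≡.trans (≡.sym (ℕP.+-assoc [ P x ]₁ _ _)) (≡.cong (ℕ._+ [ P (suc n) ]₁) (≡.sym (countB-∷ P x xs)))))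

countB-cong : ∀ {P Q} n → (∀ j → suc j ℕ.≤ n → P (suc j) ≡ Q (suc j)) → countB P (range1 n) ≡ countB Q (range1 n)
countB-cong zero    e = ≡.refl
countB-cong {P} {Q} (suc n) e = ≡.trans (countB-range1 P n)
  (≡.trans (≡.cong₂ (λ x b → x ℕ.+ [ b ]₁) (countB-cong n (λ j j≤n → e j (ℕP.m≤n⇒m≤1+n j≤n))) (e n ℕP.≤-refl))
    (≡.sym (countB-range1 Q n)))

sumN : (ℕ → ℕ) → ℕ → ℕ
sumN f n = foldr ℕ._+_ 0 (List.map f (range1 n))

sumN-range1 : ∀ f n → sumN f (suc n) ≡ sumN f n ℕ.+ f (suc n)
sumN-range1 f n = ≡.trans (≡.cong (foldr ℕ._+_ 0 ∘ List.map f) (range1-∷ʳ n)) (go (range1 n))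
  where
  go : ∀ xs → foldr ℕ._+_ 0 (List.map f (xs ++ (suc n ∷ []))) ≡ foldr ℕ._+_ 0 (List.map f xs) ℕ.+ f (suc n)
  go []       = ℕP.+-comm (f (suc n)) 0
  go (x ∷ xs) = ≡.trans (≡.cong (f x ℕ.+_) (go xs)) (≡.sym (ℕP.+-assoc (f x) _ _))

sumN-cong : ∀ {f g} n → (∀ j → suc j ℕ.≤ n → f (suc j) ≡ g (suc j)) → sumN f n ≡ sumN g n
sumN-cong zero    e = ≡.refl
sumN-cong {f} {g} (suc n) e = ≡.trans (sumN-range1 f n)
  (≡.trans (≡.cong₂ ℕ._+_ (sumN-cong n (λ j j≤n → e j (ℕP.m≤n⇒m≤1+n j≤n))) (e n ℕP.≤-refl)) (≡.sym (sumN-range1 g n)))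

-- M stands for m + n, and i is the height of the row.
lengthOK : ℕ → ℕ → List ℕ → Bool
lengthOK k i r = length r ≡ᵇ (i ⊓ k)

boundsOK : ℕ → ℕ → ℕ → List ℕ → Bool
boundsOK M k i r = allB (λ j → (1 ≤ᵇ atℕ r j) ∧ (atℕ r j ≤ᵇ (M ∸ i ℕ.+ j))) (range1 (i ⊓ k))

strictOK : ℕ → ℕ → List ℕ → Bool
strictOK k i r = allB (λ j → atℕ r j <ᵇ atℕ r (suc j)) (range1 (i ⊓ k ∸ 1))

rowOK : ℕ → ℕ → ℕ → List ℕ → Bool
rowOK M k i r = lengthOK k i r ∧ boundsOK M k i r ∧ strictOK k i r

rowsOK : ℕ → ℕ → List ℕ → List ℕ → Bool
rowsOK k i upper lower = allB (λ j →
    (atℕ lower j ≤ᵇ atℕ upper j) ∧ (if suc j ≤ᵇ (suc i ⊓ k) then atℕ upper j ≤ᵇ atℕ lower (suc j) else true))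
  (range1 (i ⊓ k))

rowOnes : ℕ → ℕ → List ℕ → ℕ
rowOnes k i r = countB (λ j → atℕ r j ≡ᵇ 1) (range1 (i ⊓ k))

isMaxRow : ℕ → ℕ → ℕ → List ℕ → Bool
isMaxRow M k i r = (k ≤ᵇ i) ∧ (atℕ r k ≡ᵇ (M ∸ i ℕ.+ k))

-- `isGog` with m + n as a parameter M of its own: deleting the bottom row lowers n and raises m,
-- while M stays the same.
gogB : ℕ → ℕ → ℕ → Array → Bool
gogB M n k T =
  (length T ≡ᵇ n)
  ∧ allB (λ i → lengthOK k i (row T i)) (range1 n)
  ∧ allB (λ i → boundsOK M k i (row T i)) (range1 n)
  ∧ allB (λ i → strictOK k i (row T i)) (range1 n)
  ∧ allB (λ i → rowsOK k i (row T i) (row T (suc i))) (range1 (n ∸ 1))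

minimaN : ℕ → ℕ → Array → ℕ
minimaN n k T = sumN (λ i → rowOnes k i (row T i)) n

maximaN : ℕ → ℕ → ℕ → Array → ℕ
maximaN M n k T = countB (λ i → isMaxRow M k i (row T i)) (range1 (n ∸ 1))

row-0 : ∀ T → row T 0 ≡ []
row-0 []      = ≡.refl
row-0 (_ ∷ _) = ≡.refl

row-old : ∀ T r i → i ℕ.≤ length T → row (T ∷ʳ r) i ≡ row T i
row-old T       r zero          _         = ≡.trans (row-0 (T ∷ʳ r)) (≡.sym (row-0 T))
row-old (x ∷ T) r (suc zero)    _         = ≡.refl
row-old (x ∷ T) r (suc (suc i)) (s≤s i≤n) = row-old T r (suc i) i≤n

row-new : ∀ T r → row (T ∷ʳ r) (suc (length T)) ≡ r
row-new []      r = ≡.refl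
row-new (x ∷ T) r = row-new T r

private
  and-shuffle : ∀ a b c d e b′ c′ d′ e′ →
    (a ∧ (b ∧ b′) ∧ (c ∧ c′) ∧ (d ∧ d′) ∧ (e ∧ e′)) ≡ ((a ∧ b ∧ c ∧ d ∧ e) ∧ ((b′ ∧ c′ ∧ d′) ∧ e′))
  and-shuffle false b     c     d     e     b′    c′    d′    e′ = ≡.refl
  and-shuffle true  false c     d     e     b′    c′    d′    e′ = ≡.refl
  and-shuffle true  true  false d     e     false c′    d′    e′ = ≡.refl
  and-shuffle true  true  false d     e     true  c′    d′    e′ = ≡.refl
  and-shuffle true  true  true  false e     false c′    d′    e′ = ≡.refl
  and-shuffle true  true  true  false e     true  false d′    e′ = ≡.refl
  and-shuffle true  true  true  false e     true  true  d′    e′ = ≡.refl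
  and-shuffle true  true  true  true  e     false c′    d′    e′ = ≡.sym (∧-zeroʳ e)
  and-shuffle true  true  true  true  e     true  false d′    e′ = ≡.sym (∧-zeroʳ e)
  and-shuffle true  true  true  true  e     true  true  false e′ = ≡.sym (∧-zeroʳ e)
  and-shuffle true  true  true  true  e     true  true  true  e′ = ≡.refl

  allB-rows : ∀ (f : ℕ → List ℕ → Bool) T r →
    allB (λ i → f i (row (T ∷ʳ r) i)) (range1 (suc (length T)))
      ≡ allB (λ i → f i (row T i)) (range1 (length T)) ∧ f (suc (length T)) r
  allB-rows f T r = ≡.trans (allB-range1 _ (length T)) (≡.cong₂ _∧_
    (allB-cong (length T) (λ j j≤ → ≡.cong (f (suc j)) (row-old T r (suc j) j≤)))
    (≡.cong (f (suc (length T))) (row-new T r)))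

  allB-row-pairs : ∀ k T r →
    allB (λ i → rowsOK k i (row (T ∷ʳ r) i) (row (T ∷ʳ r) (suc i))) (range1 (length T))
      ≡ allB (λ i → rowsOK k i (row T i) (row T (suc i))) (range1 (length T ∸ 1)) ∧ rowsOK k (length T) (row T (length T)) r
  allB-row-pairs k []        r = ≡.refl
  allB-row-pairs k T@(_ ∷ T₁) r = ≡.trans (allB-range1 _ (length T₁)) (≡.cong₂ _∧_
    (allB-cong (length T₁) (λ j j≤ → ≡.cong₂ (rowsOK k (suc j))
      (row-old T r (suc j) (ℕP.m≤n⇒m≤1+n j≤)) (row-old T r (suc (suc j)) (s≤s j≤))))
    (≡.cong₂ (rowsOK k (length T)) (row-old T r (length T) ℕP.≤-refl) (row-new T r)))

gogB-∷ʳ : ∀ M k T r → gogB M (suc (length T)) k (T ∷ʳ r)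
  ≡ gogB M (length T) k T ∧ (rowOK M k (suc (length T)) r ∧ rowsOK k (length T) (row T (length T)) r)
gogB-∷ʳ M k T r = ≡.trans
  (≡.cong₂ _∧_ (≡.cong (_≡ᵇ suc (length T)) (LP.length-++-comm T (r ∷ [])))
    (≡.cong₂ _∧_ (allB-rows (lengthOK k) T r)
    (≡.cong₂ _∧_ (allB-rows (boundsOK M k) T r)
    (≡.cong₂ _∧_ (allB-rows (strictOK k) T r)
      (allB-row-pairs k T r)))))
  (and-shuffle (length T ≡ᵇ length T)
    (allB (λ i → lengthOK k i (row T i)) (range1 (length T)))
    (allB (λ i → boundsOK M k i (row T i)) (range1 (length T)))
    (allB (λ i → strictOK k i (row T i)) (range1 (length T)))
    (allB (λ i → rowsOK k i (row T i) (row T (suc i))) (range1 (length T ∸ 1)))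
    (lengthOK k (suc (length T)) r) (boundsOK M k (suc (length T)) r) (strictOK k (suc (length T)) r)
    (rowsOK k (length T) (row T (length T)) r))

minimaN-∷ʳ : ∀ k T r → minimaN (suc (length T)) k (T ∷ʳ r) ≡ minimaN (length T) k T ℕ.+ rowOnes k (suc (length T)) r
minimaN-∷ʳ k T r = ≡.trans (sumN-range1 _ (length T)) (≡.cong₂ ℕ._+_
  (sumN-cong (length T) (λ j j≤ → ≡.cong (rowOnes k (suc j)) (row-old T r (suc j) j≤)))
  (≡.cong (rowOnes k (suc (length T))) (row-new T r)))

-- The bottom row is excluded from the count, so a new row at the bottom makes the previous bottom
-- row count. For empty T the extra term vanishes because k is positive.
maximaN-∷ʳ : ∀ M k T r → 1 ℕ.≤ k →
  maximaN M (suc (length T)) k (T ∷ʳ r) ≡ maximaN M (length T) k T ℕ.+ [ isMaxRow M k (length T) (row T (length T)) ]₁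
maximaN-∷ʳ M (suc k) []         r _ = ≡.refl
maximaN-∷ʳ M k       T@(_ ∷ T₁) r _ = ≡.trans (countB-range1 (λ i → isMaxRow M k i (row (T ∷ʳ r) i)) (length T₁)) (≡.cong₂ (λ x b → x ℕ.+ [ b ]₁)
  (countB-cong {λ i → isMaxRow M k i (row (T ∷ʳ r) i)} {λ i → isMaxRow M k i (row T i)} (length T₁) (λ j j≤ → ≡.cong (isMaxRow M k (suc j)) (row-old T r (suc j) (ℕP.m≤n⇒m≤1+n j≤))))
  (≡.cong (isMaxRow M k (length T)) (row-old T r (length T) ℕP.≤-refl)))

boundsR : ℕ → List ℕ → Bool
boundsR D []       = true
boundsR D (x ∷ xs) = ((1 ≤ᵇ x) ∧ (x ≤ᵇ (D ℕ.+ 1))) ∧ boundsR (suc D) xs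

strictR : List ℕ → Bool
strictR []           = true
strictR (x ∷ [])     = true
strictR (x ∷ y ∷ zs) = (x <ᵇ y) ∧ strictR (y ∷ zs)

belowR : List ℕ → ℕ → Bool
belowR []      l = true
belowR (b ∷ _) l = l ≤ᵇ b

interR : List ℕ → List ℕ → Bool
interR bs       []       = true
interR []       (_ ∷ _)  = true
interR (b ∷ bs) (l ∷ ls) = ((b ≤ᵇ l) ∧ belowR bs l) ∧ interR bs ls

boundsR-spec : ∀ D r →
  allB (λ j → (1 ≤ᵇ atℕ r j) ∧ (atℕ r j ≤ᵇ (D ℕ.+ j))) (range1 (length r)) ≡ boundsR D r
boundsR-spec D []       = ≡.refl
boundsR-spec D (x ∷ xs) = ≡.trans (allB-shift _ (length xs)) (≡.cong (_ ∧_) (≡.trans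
  (allB-cong (length xs) (λ j _ → ≡.cong (λ z → (1 ≤ᵇ atℕ xs (suc j)) ∧ (atℕ xs (suc j) ≤ᵇ z)) (ℕP.+-suc D (suc j))))
  (boundsR-spec (suc D) xs)))

strictR-spec : ∀ r → allB (λ j → atℕ r j <ᵇ atℕ r (suc j)) (range1 (length r ∸ 1)) ≡ strictR r
strictR-spec []           = ≡.refl
strictR-spec (x ∷ [])     = ≡.refl
strictR-spec (x ∷ y ∷ zs) = ≡.trans (allB-shift _ (length zs)) (≡.cong (_ ∧_) (≡.trans
  (allB-cong (length zs) (λ j _ → ≡.refl)) (strictR-spec (y ∷ zs))))

interR-spec : ∀ bs ls → length ls ℕ.≤ length bs →
  allB (λ j → (atℕ bs j ≤ᵇ atℕ ls j) ∧ (if suc j ≤ᵇ length bs then atℕ ls j ≤ᵇ atℕ bs (suc j) else true)) (range1 (length ls))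
    ≡ interR bs ls
interR-spec bs       []       _         = ≡.refl
interR-spec (b ∷ bs) (l ∷ ls) (s≤s len) = ≡.trans (allB-shift _ (length ls)) (≡.cong₂ _∧_ (head bs)
  (≡.trans (allB-cong (length ls) (λ j _ → ≡.refl)) (interR-spec bs ls len)))
  where
  head : ∀ bs → (b ≤ᵇ l) ∧ (if 2 ≤ᵇ suc (length bs) then l ≤ᵇ atℕ (b ∷ bs) 2 else true) ≡ (b ≤ᵇ l) ∧ belowR bs l
  head []      = ≡.refl
  head (_ ∷ _) = ≡.refl

rowOK-spec : ∀ M k i r → length r ≡ i ⊓ k → rowOK M k i r ≡ boundsR (M ∸ i) r ∧ strictR r
rowOK-spec M k i r eq rewrite ≡.sym eq | ≡ᵇ-true (length r) = ≡.cong₂ _∧_ (boundsR-spec (M ∸ i) r) (strictR-spec r)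

rowsOK-spec : ∀ k i u l → length u ≡ i ⊓ k → length l ≡ suc i ⊓ k → length u ℕ.≤ length l → rowsOK k i u l ≡ interR l u
rowsOK-spec k i u l eq eq′ len rewrite ≡.sym eq | ≡.sym eq′ = interR-spec l u len

private variable r : ℕ

chain-length : ∀ prev (v : Vec ℕ r) C → Chain prev v C → prev ℕ.+ r ℕ.≤ C
chain-length {zero}  prev []      C ch       = ≡.subst (ℕ._≤ C) (≡.sym (ℕP.+-identityʳ prev)) ch
chain-length {suc r} prev (x ∷ v) C (lt , ch) = ≡.subst (ℕ._≤ C) (≡.sym (ℕP.+-suc prev r))
  (ℕP.≤-trans (ℕP.+-monoˡ-≤ r lt) (chain-length x v C ch))

-- Strict increase lowers the bound by one per step to the left, so the bound D + r on the last
-- entry already implies the bound D + j at each position j.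
chain-bounds : ∀ prev (v : Vec ℕ r) D → Chain prev v (D ℕ.+ r) → boundsR D (toList v) ≡ true
chain-bounds         prev []      D _         = ≡.refl
chain-bounds {suc r} prev (x ∷ v) D (lt , ch)
  rewrite ≤ᵇ-true (ℕP.≤-trans (s≤s z≤n) lt) | ≤ᵇ-true (ℕP.+-cancelʳ-≤ r x (D ℕ.+ 1)
    (≡.subst (x ℕ.+ r ℕ.≤_) (≡.sym (ℕP.+-assoc D 1 r)) (chain-length x v _ ch)))
  = chain-bounds x v (suc D) (≡.subst (Chain x v) (ℕP.+-suc D r) ch)

chain-strict : ∀ prev (v : Vec ℕ r) C → Chain prev v C → strictR (toList v) ≡ true
chain-strict prev []          C _                    = ≡.refl
chain-strict prev (x ∷ [])    C _                    = ≡.refl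
chain-strict prev (x ∷ y ∷ v) C (_ , ch@(x<y , _)) = ≡.cong₂ _∧_ (<ᵇ-true x<y) (chain-strict x (y ∷ v) C ch)

strict-bounds-chain : ∀ prev x (v : Vec ℕ r) D → prev ℕ.< x →
  boundsR D (x ∷ toList v) ≡ true → strictR (x ∷ toList v) ≡ true → Chain prev (x ∷ v) (D ℕ.+ suc r)
strict-bounds-chain prev x []      D lt bo _ = lt , ≤ᵇ-sound (proj₂ (∧-true {1 ≤ᵇ x} (proj₁ (∧-true bo))))
strict-bounds-chain {suc r} prev x (y ∷ v) D lt bo st = lt ,
  ≡.subst (Chain x (y ∷ v)) (≡.sym (ℕP.+-suc D (suc r)))
    (strict-bounds-chain x y v (suc D) (<ᵇ-sound (proj₁ (∧-true st)))
      (proj₂ (∧-true {(1 ≤ᵇ x) ∧ (x ≤ᵇ (D ℕ.+ 1))} bo)) (proj₂ (∧-true {x <ᵇ y} st)))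

chain-rowOK : ∀ M k i (v : Vec ℕ r) → r ≡ i ⊓ k → Chain 0 v (M ∸ i ℕ.+ r) → rowOK M k i (toList v) ≡ true
chain-rowOK M k i v eq ch = ≡.trans (rowOK-spec M k i (toList v) (≡.trans (VecP.length-toList v) eq))
  (≡.cong₂ _∧_ (chain-bounds 0 v (M ∸ i) ch) (chain-strict 0 v _ ch))

rowOK-chain : ∀ M k i (v : Vec ℕ (suc r)) → suc r ≡ i ⊓ k → rowOK M k i (toList v) ≡ true → Chain 0 v (M ∸ i ℕ.+ suc r)
rowOK-chain M k i v@(x ∷ w) eq ok with ∧-true (≡.trans (≡.sym (rowOK-spec M k i (toList v) (≡.trans (VecP.length-toList v) eq))) ok)
... | bo , st = strict-bounds-chain 0 x w (M ∸ i) (≤ᵇ-sound (proj₁ (∧-true (proj₁ (∧-true bo))))) bo st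

interlaces-interR : ∀ C E → (∀ l → l ℕ.≤ C → belowR E l ≡ true) → ∀ prev (bs ls : Vec ℕ r) →
  interlaces C prev bs ls ≡ true → interR (toList bs ++ E) (toList ls) ≡ true
interlaces-interR C E hE prev []       []       _ = ≡.refl
interlaces-interR C E hE prev (b ∷ bs) (l ∷ ls) e with ∧-true e
... | e₁ , e₂ with ∧-true {prev <ᵇ l} e₁
... | _ , e₃ with ∧-true {b ≤ᵇ l} e₃
... | b≤l , l≤ rewrite b≤l = ≡.cong₂ _∧_ (below bs l≤) (interlaces-interR C E hE l bs ls e₂)
  where
  below : ∀ {r} (bs : Vec ℕ r) → (l ≤ᵇ nextOr C bs) ≡ true → belowR (toList bs ++ E) l ≡ true
  below []      e = hE l (≤ᵇ-sound e)
  below (_ ∷ _) e = e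

interlaces-chain : ∀ C prev (bs ls : Vec ℕ r) → prev ℕ.≤ nextOr C bs → interlaces C prev bs ls ≡ true → Chain prev ls C
interlaces-chain C prev []       []       h _ = h
interlaces-chain C prev (b ∷ bs) (l ∷ ls) h e with ∧-true e
... | e₁ , e₂ with ∧-true {prev <ᵇ l} e₁
... | lt , e₃ = <ᵇ-sound lt , interlaces-chain C l bs ls (≤ᵇ-sound (proj₂ (∧-true {b ≤ᵇ l} e₃))) e₂

-- The trapezoid inequalities between two rows do not contain strictness within the upper row; that,
-- and the bound on its last entry when E is empty, come from the chain.
interR-interlaces : ∀ C C′ E → (∀ l → belowR E l ≡ true → l ℕ.≤ C′ → l ℕ.≤ C) → ∀ prev (bs ls : Vec ℕ r) →
  interR (toList bs ++ E) (toList ls) ≡ true → Chain prev ls C′ → interlaces C prev bs ls ≡ true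
interR-interlaces C C′ E hE prev []       []       _ _ = ≡.refl
interR-interlaces C C′ E hE prev (b ∷ bs) (l ∷ ls) e (lt , ch) with ∧-true e
... | e₁ , e₂ with ∧-true {b ≤ᵇ l} e₁
... | b≤l , l≤ rewrite <ᵇ-true lt | b≤l =
  ≡.cong₂ _∧_ (below bs ls l≤ ch) (interR-interlaces C C′ E hE l bs ls e₂ ch)
  where
  below : ∀ {r} (bs ls : Vec ℕ r) → belowR (toList bs ++ E) l ≡ true → Chain l ls C′ → (l ≤ᵇ nextOr C bs) ≡ true
  below []      []  e ch = ≤ᵇ-true (hE l e ch)
  below (_ ∷ _) _   e _  = e

chain-mono : ∀ prev (v : Vec ℕ r) {C C′} → C ℕ.≤ C′ → Chain prev v C → Chain prev v C′
chain-mono prev []      C≤ ch        = ℕP.≤-trans ch C≤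
chain-mono prev (x ∷ v) C≤ (lt , ch) = lt , chain-mono x v C≤ ch

private
  no-ones : ∀ prev (v : Vec ℕ r) C → 1 ℕ.≤ prev → Chain prev v C → countB (λ j → atℕ (toList v) j ≡ᵇ 1) (range1 r) ≡ 0
  no-ones prev []              C _ _ = ≡.refl
  no-ones {suc r} prev (x ∷ v) C 1≤prev (lt , ch) = ≡.trans (countB-shift (λ j → atℕ (x ∷ toList v) j ≡ᵇ 1) r)
    (≡.cong₂ ℕ._+_ (≡.cong [_]₁ (≡ᵇ-false (λ x≡1 → ℕP.<⇒≱ (ℕP.≤-<-trans 1≤prev lt) (ℕP.≤-reflexive x≡1))))
      (≡.trans (countB-cong r (λ j _ → ≡.refl)) (no-ones x v C (ℕP.≤-trans 1≤prev (ℕP.<⇒≤ lt)) ch)))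

-- In a strictly increasing row of positive entries only the first can equal 1, so the minimum
-- weight of a row depends on its first entry alone.
chain-ones : ∀ k i b (v : Vec ℕ r) C → suc r ≡ i ⊓ k → Chain 0 (b ∷ v) C → rowOnes k i (b ∷ toList v) ≡ [ b ≡ᵇ 1 ]₁
chain-ones {r} k i b v C eq (lt , ch) rewrite ≡.sym eq = ≡.trans (countB-shift (λ j → atℕ (b ∷ toList v) j ≡ᵇ 1) r)
  (≡.trans (≡.cong ([ b ≡ᵇ 1 ]₁ ℕ.+_) (≡.trans (countB-cong r (λ j _ → ≡.refl)) (no-ones b v C lt ch))) (ℕP.+-identityʳ _))

isMaxRow-false : ∀ M k i u → i ℕ.< k → isMaxRow M k i u ≡ false
isMaxRow-false M k i u i<k = ≡.cong (_∧ (atℕ u k ≡ᵇ (M ∸ i ℕ.+ k))) (≤ᵇ-false i<k)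

chain-∷ʳ : ∀ prev (v : Vec ℕ r) c C → Chain prev (v Vec.∷ʳ c) C → Chain prev v (ℕ.pred c) × c ℕ.≤ C × 1 ℕ.≤ c
chain-∷ʳ prev []      (suc c) C (s≤s prev≤ , c≤) = prev≤ , c≤ , s≤s z≤n
chain-∷ʳ prev (x ∷ v) c       C (lt , ch) with chain-∷ʳ x v c C ch
... | ch′ , c≤ , 1≤c = (lt , ch′) , c≤ , 1≤c

-- Induction on rows: weighted counts equal constant terms

module Counting (𝕂 : Ring₀) (p q : CommutativeRing.Carrier 𝕂) (M k : ℕ) (1≤k : 1 ℕ.≤ k) where
  open CommutativeRing 𝕂 hiding (zero)
  open RingKit 𝕂
  open Vandermonde 𝕂 using (pow; pow-+)
  open SlotFunctionals 𝕂
  open Junctions 𝕂 using (gogForm-0)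
  open Telescope 𝕂 using (ind; ind-true; ind-false; sum-single)
  open Recursion 𝕂
  open Relation.Binary.Reasoning.Setoid setoid

  A : List ℕ
  A = range1 M

  rowWeight : ℕ → List ℕ → List ℕ → Carrier
  rowWeight n upper lower = ind (rowsOK k n upper lower) * pow q [ isMaxRow M k n upper ]₁

  -- The weighted number of (M - n, n, k)-Gog trapezoids with bottom row r.
  total : ℕ → List ℕ → Carrier
  total zero    r = 1#
  total (suc n) r = ind (rowOK M k (suc n) r) * (pow p (rowOnes k (suc n) r) *
    sumL (words (n ⊓ k) A) (λ r′ → total n r′ * rowWeight n r′ r))

  sum-words : ∀ ℓ (f : List ℕ → Carrier) → sumL (words ℓ A) f ≈ sumV ℓ A (λ v → f (toList v))
  sum-words zero    f = +-identityʳ _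
  sum-words (suc ℓ) f = trans (sum-concatMap _ A f)
    (sum-cong A (λ a → trans (reflexive (sum-map (a ∷_) (words ℓ A) f)) (sum-words ℓ (λ v → f (a ∷ v)))))

  slotList : ℕ → ∀ {ℓ} → Vec ℕ (suc ℓ) → ℕ → List Slot
  slotList n (b ∷ bs) j =
    firstSlot p n b ∷ toList (toSlots bs n) ++ toList (tailSlots j n (tailSeries q (M ∸ n ℕ.+ k)))

  -- The row length is the minimum of n and k, and j is the number of tail variables: zero while n ≤
  -- k, and n - k afterwards.
  Claim : ℕ → Set
  Claim n = ∀ ℓ (b : Vec ℕ (suc ℓ)) j → n ≡ suc ℓ ℕ.+ j → suc ℓ ≡ n ⊓ k → n ℕ.≤ M →
    Chain 0 b (M ∸ n ℕ.+ suc ℓ) → total n (toList b) ≈ gogFormL (slotList n b j)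

  pow-minWeight : ∀ b → pow p [ b ≡ᵇ 1 ]₁ ≈ minWeight p b
  pow-minWeight b with b ≡ᵇ 1
  ... | true  = *-identityʳ p
  ... | false = refl

  total-top : ∀ n b (bs : Vec ℕ r) → suc r ≡ suc n ⊓ k → Chain 0 (b ∷ bs) (M ∸ suc n ℕ.+ suc r) →
    total (suc n) (b ∷ toList bs) ≈ minWeight p b * sumV (n ⊓ k) A (λ ls → total n (toList ls) * rowWeight n (toList ls) (b ∷ toList bs))
  total-top n b bs eq ch = begin
    ind (rowOK M k (suc n) (b ∷ toList bs)) * (pow p (rowOnes k (suc n) (b ∷ toList bs)) * _)
      ≈⟨ ind-true _ (chain-rowOK M k (suc n) (b ∷ bs) eq ch) ⟩
    pow p (rowOnes k (suc n) (b ∷ toList bs)) * _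
      ≈⟨ *-cong (trans (reflexive (≡.cong (pow p) (chain-ones k (suc n) b bs _ eq ch))) (pow-minWeight b))
           (sum-words (n ⊓ k) _) ⟩
    minWeight p b * sumV (n ⊓ k) A _ ∎

  gogFormL-[] : ∀ b → total 1 (b ∷ []) ≈ minWeight p b → total 1 (b ∷ []) ≈ gogFormL (firstSlot p 1 b ∷ [])
  gogFormL-[] b e = begin
    total 1 (b ∷ [])                                  ≈⟨ e ⟩
    minWeight p b                                     ≈⟨ firstSlot-top p 0 b ⟨
    firstSlot p 1 b 0                                 ≈⟨ trans (*-congˡ (gogForm-0)) (*-identityʳ _) ⟨
    firstSlot p 1 b 0 * gogForm 0 []                  ≈⟨ gogForm-laplace 0 (firstSlot p 1 b ∷ []) (firstSlot-short p 1 b ∷ []) ⟨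
    gogFormL (firstSlot p 1 b ∷ [])                   ∎

  -- E is C ∷ [] if the row ls is shorter than the row bs ++ E below it, and [] otherwise.
  term-agrees : ∀ n₀ {r} (C : ℕ) (w : Carrier) (E : List ℕ) (bs ls : Vec ℕ (suc r)) (X : Carrier) →
    suc r ≡ suc n₀ ⊓ k → length (toList bs ++ E) ≡ suc (suc n₀) ⊓ k → length (toList ls) ℕ.≤ length (toList bs ++ E) →
    (∀ l → l ℕ.≤ C → belowR E l ≡ true) →
    (∀ l → belowR E l ≡ true → l ℕ.≤ M ∸ suc n₀ ℕ.+ suc r → l ℕ.≤ C) →
    (Chain 0 ls C → total (suc n₀) (toList ls) ≈ X) →
    (Chain 0 ls C → weights C w ls ≈ pow q [ isMaxRow M k (suc n₀) (toList ls) ]₁) →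
    total (suc n₀) (toList ls) * rowWeight (suc n₀) (toList ls) (toList bs ++ E)
      ≈ ind (interlaces C 0 bs ls) * (weights C w ls * X)
  term-agrees n₀ {r} C w E bs ls X eq eq′ len hE hE′ IH wt with interlaces C 0 bs ls in int
  ... | true = begin
    total (suc n₀) (toList ls) * (ind (rowsOK k (suc n₀) (toList ls) (toList bs ++ E)) * pow q [ isMaxRow M k (suc n₀) (toList ls) ]₁)
      ≈⟨ *-cong (IH chain) (trans (ind-true _ rows) (sym (wt chain))) ⟩
    X * weights C w ls
      ≈⟨ trans (*-comm _ _) (sym (*-identityˡ _)) ⟩
    1# * (weights C w ls * X) ∎
    where
    chain : Chain 0 ls C
    chain = interlaces-chain C 0 bs ls z≤n int
    rows : rowsOK k (suc n₀) (toList ls) (toList bs ++ E) ≡ true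
    rows = ≡.trans (rowsOK-spec k (suc n₀) (toList ls) _ (≡.trans (VecP.length-toList ls) eq) eq′ len)
      (interlaces-interR C E hE 0 bs ls int)
  ... | false with rowsOK k (suc n₀) (toList ls) (toList bs ++ E) in rows | rowOK M k (suc n₀) (toList ls) in ok
  ...   | false | _     = trans (*-congˡ (zeroˡ _)) (trans (zeroʳ _) (sym (zeroˡ _)))
  ...   | true  | false = trans (*-congʳ (zeroˡ _)) (trans (zeroˡ _) (sym (zeroˡ _)))
  ...   | true  | true  = ⊥-elim (impossible (≡.trans (≡.sym int) (interR-interlaces C _ E hE′ 0 bs ls
            (≡.trans (≡.sym (rowsOK-spec k (suc n₀) (toList ls) _ (≡.trans (VecP.length-toList ls) eq) eq′ len)) rows)
            (rowOK-chain M k (suc n₀) ls eq ok))))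
    where
    impossible : false ≡ true → ⊥
    impossible ()

  weights-1 : ∀ C (ls : Vec ℕ r) → weights C 1# ls ≈ 1#
  weights-1 C []       = refl
  weights-1 C (l ∷ ls) with l ≡ᵇ C
  ... | true  = trans (*-identityˡ _) (weights-1 C ls)
  ... | false = trans (*-identityˡ _) (weights-1 C ls)

  -- In an increasing row bounded by C only the last entry can reach C, so the product of the
  -- weights records exactly whether the row ends in a maximum.
  weights-last : ∀ C prev l (ls : Vec ℕ r) → Chain prev (l ∷ ls) C →
    weights C q (l ∷ ls) ≈ pow q [ atℕ (l ∷ toList ls) (suc r) ≡ᵇ C ]₁
  weights-last C prev l [] _ with l ≡ᵇ C
  ... | true  = refl
  ... | false = *-identityˡ _
  weights-last C prev l (l′ ∷ ls) (_ , ch@(l<l′ , ch′))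
    rewrite ≡ᵇ-false (ℕP.<⇒≢ (ℕP.<-≤-trans l<l′ (ℕP.≤-trans (ℕP.m≤m+n l′ _) (chain-length l′ ls C ch′)))) =
    trans (*-identityˡ _) (weights-last C l l′ ls ch)

  private
    -- Case n ≤ k: the row above is one entry shorter, and there are no tail variables. The last
    -- bottom entry c is split off as the upper bound of the row above; that row has no k-th entry,
    -- so no maximum arises.
    closed-case : ∀ n₀ → Claim n₀ → ∀ ℓ (b : Vec ℕ (suc ℓ)) → suc n₀ ≡ suc ℓ ℕ.+ 0 → suc n₀ ℕ.≤ k → suc n₀ ℕ.≤ M →
      Chain 0 b (M ∸ suc n₀ ℕ.+ suc ℓ) → total (suc n₀) (toList b) ≈ gogFormL (slotList (suc n₀) b 0)
    closed-case .0 IH zero (b ∷ []) ≡.refl le _ ch =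
      gogFormL-[] b (trans (total-top 0 b [] (≡.sym (ℕP.m≤n⇒m⊓n≡m le)) ch) (trans (*-congˡ one-term) (*-identityʳ _)))
      where
      one-term : total 0 [] * rowWeight 0 [] (b ∷ []) ≈ 1#
      one-term = trans (*-identityˡ _) (trans (*-identityˡ _)
        (reflexive (≡.cong (λ x → pow q [ x ]₁) (isMaxRow-false M k 0 [] 1≤k))))
    closed-case .(suc (r ℕ.+ 0)) IH (suc r) (b ∷ bs) ≡.refl le le′ ch with Vec.initLast bs
    ... | bs′ , c , ≡.refl = begin
      total (suc N) (b ∷ toList (bs′ Vec.∷ʳ c))
        ≈⟨ total-top N b (bs′ Vec.∷ʳ c) len₁ ch ⟩
      minWeight p b * sumV (N ⊓ k) A (λ ls → total N (toList ls) * rowWeight N (toList ls) (b ∷ toList (bs′ Vec.∷ʳ c)))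
        ≡⟨ ≡.cong (λ x → minWeight p b * sumV x A (λ ls → total N (toList ls) * rowWeight N (toList ls) (b ∷ toList (bs′ Vec.∷ʳ c)))) (≡.sym len₀) ⟩
      minWeight p b * sumV (suc r) A (λ ls → total N (toList ls) * rowWeight N (toList ls) (b ∷ toList (bs′ Vec.∷ʳ c)))
        ≡⟨ ≡.cong (λ x → minWeight p b * sumV (suc r) A (λ ls → total N (toList ls) * rowWeight N (toList ls) (b ∷ x))) (VecP.toList-∷ʳ c bs′) ⟩
      minWeight p b * sumV (suc r) A (λ ls → total N (toList ls) * rowWeight N (toList ls) (b ∷ toList bs′ ++ (c ∷ [])))
        ≈⟨ *-congˡ (sumV-cong (suc r) A term) ⟩
      minWeight p b * sumV (suc r) A (λ ls → ind (interlaces c 0 (b ∷ bs′) ls) * (weights c 1# ls *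
        gogFormL (firstSlot p N (Vec.head ls) ∷ toList (toSlots (Vec.tail ls) N) ++ [])))
        -- The series of c itself plays the role of τ, since (1 + x)(1 + x)^c is the top boundary
        -- series for bound c and weight 1.
        ≈⟨ Step.step p M c c≤M 1# (binom c) (binom-0 c) (λ _ → refl) b bs′ [] [] chain₀ 1≤c ⟨
      gogFormL (firstSlot p (suc N) b ∷ toList (toSlots bs′ (suc N)) ++ (sq (binom c) (suc N) ∷ []))
        ≡⟨ ≡.cong (λ x → gogFormL (firstSlot p (suc N) b ∷ x)) slots ⟩
      gogFormL (firstSlot p (suc N) b ∷ toList (toSlots (bs′ Vec.∷ʳ c) (suc N)) ++ []) ∎
      where
      N = suc (r ℕ.+ 0)
      r+0 : N ≡ suc r
      r+0 = ≡.cong suc (ℕP.+-identityʳ r)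
      len₀ : suc r ≡ N ⊓ k
      len₀ = ≡.trans (≡.sym r+0) (≡.sym (ℕP.m≤n⇒m⊓n≡m (ℕP.<⇒≤ le)))
      len₁ : suc (suc r) ≡ suc N ⊓ k
      len₁ = ≡.trans (≡.cong suc (≡.sym r+0)) (≡.sym (ℕP.m≤n⇒m⊓n≡m le))
      fin = chain-∷ʳ 0 (b ∷ bs′) c _ ch
      chain₀ = proj₁ fin
      1≤c = proj₂ (proj₂ fin)
      top≡M : ∀ {i j} → i ≡ j → i ℕ.≤ M → M ∸ i ℕ.+ j ≡ M
      top≡M ≡.refl i≤M = ℕP.m∸n+n≡m i≤M
      c≤M : c ℕ.≤ M
      c≤M = ≡.subst (c ℕ.≤_) (top≡M (≡.cong suc r+0) le′) (proj₁ (proj₂ fin))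
      slots : toList (toSlots bs′ (suc N)) ++ (sq (binom c) (suc N) ∷ []) ≡ toList (toSlots (bs′ Vec.∷ʳ c) (suc N)) ++ []
      slots = ≡.trans (≡.sym (VecP.toList-∷ʳ _ (toSlots bs′ (suc N))))
        (≡.trans (≡.cong toList (≡.sym (VecP.map-∷ʳ (λ b → sq (binom b) (suc N)) c bs′))) (≡.sym (LP.++-identityʳ _)))
      length-row : length (toList (b ∷ bs′) ++ (c ∷ [])) ≡ suc (suc r)
      length-row = ≡.trans (≡.cong length (≡.sym (VecP.toList-∷ʳ c (b ∷ bs′)))) (VecP.length-toList ((b ∷ bs′) Vec.∷ʳ c))
      term : ∀ ls → total N (toList ls) * rowWeight N (toList ls) (b ∷ toList bs′ ++ (c ∷ []))
        ≈ ind (interlaces c 0 (b ∷ bs′) ls) * (weights c 1# ls *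
            gogFormL (firstSlot p N (Vec.head ls) ∷ toList (toSlots (Vec.tail ls) N) ++ []))
      term ls@(_ ∷ _) = term-agrees (r ℕ.+ 0) c 1# (c ∷ []) (b ∷ bs′) ls _ len₀
        (≡.trans length-row len₁)
        (≡.subst₂ ℕ._≤_ (≡.sym (VecP.length-toList ls)) (≡.sym length-row) (ℕP.n≤1+n (suc r)))
        (λ l l≤c → ≤ᵇ-true l≤c)
        (λ l e _ → ≤ᵇ-sound e)
        (λ chn → IH r ls 0 ≡.refl len₀ (ℕP.<⇒≤ le′)
          (chain-mono 0 ls (≡.subst (c ℕ.≤_) (≡.sym (top≡M r+0 (ℕP.<⇒≤ le′))) c≤M) chn))
        (λ _ → trans (weights-1 c ls) (reflexive (≡.cong (λ x → pow q [ x ]₁) (≡.sym (isMaxRow-false M k N (toList ls) le)))))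

    -- Case n > k: both rows have k entries, and the row above is bounded by its diagonal bound,
    -- where it receives the weight q.
    open-case : ∀ n₀ → Claim n₀ → ∀ ℓ (b : Vec ℕ (suc ℓ)) j → suc n₀ ≡ suc ℓ ℕ.+ suc j → suc ℓ ≡ k → suc n₀ ℕ.≤ M →
      Chain 0 b (M ∸ suc n₀ ℕ.+ suc ℓ) → total (suc n₀) (toList b) ≈ gogFormL (slotList (suc n₀) b (suc j))
    open-case n₀ IH ℓ b j eq ℓ≡k le ch with ≡.trans (ℕP.suc-injective eq) (ℕP.+-suc ℓ j)
    open-case .(suc (ℓ ℕ.+ j)) IH ℓ (b ∷ bs) j eq ≡.refl le ch | ≡.refl = begin
      total (suc N) (b ∷ toList bs)
        ≈⟨ total-top N b bs len₁ ch ⟩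
      minWeight p b * sumV (N ⊓ k) A (λ ls → total N (toList ls) * rowWeight N (toList ls) (b ∷ toList bs))
        ≡⟨ ≡.cong (λ x → minWeight p b * sumV x A (λ ls → total N (toList ls) * rowWeight N (toList ls) (b ∷ toList bs))) (≡.sym len₀) ⟩
      minWeight p b * sumV (suc ℓ) A (λ ls → total N (toList ls) * rowWeight N (toList ls) (b ∷ toList bs))
        ≡⟨ ≡.cong (λ x → minWeight p b * sumV (suc ℓ) A (λ ls → total N (toList ls) * rowWeight N (toList ls) (b ∷ x))) (≡.sym (LP.++-identityʳ _)) ⟩
      minWeight p b * sumV (suc ℓ) A (λ ls → total N (toList ls) * rowWeight N (toList ls) (b ∷ toList bs ++ []))
        ≈⟨ *-congˡ (sumV-cong (suc ℓ) A term) ⟩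
      minWeight p b * sumV (suc ℓ) A (λ ls → ind (interlaces (suc c) 0 (b ∷ bs) ls) * (weights (suc c) q ls *
        gogFormL (firstSlot p N (Vec.head ls) ∷ toList (toSlots (Vec.tail ls) N) ++ toList (Vec.map up ts))))
        -- The first tail series plays the role of τ: (1 + x)(1 + qx)(1 + x)^c is the top boundary
        -- series for bound c + 1 and weight q. The other tail series keep their levels and are only
        -- multiplied by 1 + x.
        ≈⟨ Step.step p M (suc c) c<M q (tailSeries q c) (binom-0 c) (tailSeries-up q c) b bs ts (tailSlots-short j N _) ch (s≤s z≤n) ⟨
      gogFormL (firstSlot p (suc N) b ∷ toList (toSlots bs (suc N)) ++ sq (tailSeries q c) (suc N) ∷ toList ts) ∎
      where
      N = suc (ℓ ℕ.+ j)
      c = M ∸ suc N ℕ.+ k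
      ts = tailSlots j N (tailSeries q c)
      k≤N : k ℕ.≤ N
      k≤N = s≤s (ℕP.m≤m+n ℓ j)
      len₀ : suc ℓ ≡ N ⊓ k
      len₀ = ≡.sym (ℕP.m≥n⇒m⊓n≡n k≤N)
      len₁ : suc ℓ ≡ suc N ⊓ k
      len₁ = ≡.sym (ℕP.m≥n⇒m⊓n≡n (ℕP.m≤n⇒m≤1+n k≤N))
      -- One row up the diagonal bound m + k is larger by one; this absorbs the factor 1 + x on the
      -- tail.
      suc-c : M ∸ N ℕ.+ k ≡ suc c
      suc-c = ≡.cong (ℕ._+ k) (ℕP.+-∸-assoc 1 le)
      c<M : suc c ℕ.≤ M
      c<M = ≡.subst (ℕ._≤ M) suc-c (ℕP.≤-trans (ℕP.+-monoʳ-≤ (M ∸ N) k≤N) (ℕP.≤-reflexive (ℕP.m∸n+n≡m (ℕP.<⇒≤ le))))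
      length-row : length (toList (b ∷ bs) ++ []) ≡ suc ℓ
      length-row = ≡.trans (≡.cong length (LP.++-identityʳ (toList (b ∷ bs)))) (VecP.length-toList (b ∷ bs))
      tails : ∀ ls → gogFormL (slotList N ls j)
        ≈ gogFormL (firstSlot p N (Vec.head ls) ∷ toList (toSlots (Vec.tail ls) N) ++ toList (Vec.map up ts))
      tails (l ∷ ls) = gogFormL-cong ((λ _ → refl) ∷ LPW.++⁺ (LPW.refl (λ _ → refl))
        (LPW.symmetric (λ e i → sym (e i)) (tailSlots-up j N (λ i → trans (tailSeries-up q c i)
          (reflexive (≡.cong (λ x → tailSeries q x i) (≡.sym suc-c)))))))
      term : ∀ ls → total N (toList ls) * rowWeight N (toList ls) (b ∷ toList bs ++ [])
        ≈ ind (interlaces (suc c) 0 (b ∷ bs) ls) * (weights (suc c) q ls *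
            gogFormL (firstSlot p N (Vec.head ls) ∷ toList (toSlots (Vec.tail ls) N) ++ toList (Vec.map up ts)))
      term ls@(l ∷ ls′) = term-agrees (ℓ ℕ.+ j) (suc c) q [] (b ∷ bs) ls _ len₀
        (≡.trans length-row len₁)
        (ℕP.≤-reflexive (≡.trans (VecP.length-toList ls) (≡.sym length-row)))
        (λ _ _ → ≡.refl)
        (λ l _ l≤ → ≡.subst (l ℕ.≤_) suc-c l≤)
        (λ chn → trans (IH ℓ ls j ≡.refl len₀ (ℕP.<⇒≤ le) (≡.subst (Chain 0 ls) (≡.sym suc-c) chn)) (tails ls))
        (λ chn → trans (weights-last (suc c) 0 l ls′ chn) (reflexive (≡.cong (λ x → pow q [ x ]₁)
          (≡.sym (≡.cong₂ _∧_ (≤ᵇ-true k≤N) (≡.cong (atℕ (l ∷ toList ls′) (suc ℓ) ≡ᵇ_) suc-c))))))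

  claim : ∀ n → Claim n
  claim zero     ℓ b j ()
  claim (suc n₀) ℓ b zero    eq len le ch = closed-case n₀ (claim n₀) ℓ b eq
    (≡.subst (ℕ._≤ k) (≡.trans (≡.sym len) (≡.trans (≡.sym (ℕP.+-identityʳ (suc ℓ))) (≡.sym eq))) (ℕP.m⊓n≤n (suc n₀) k)) le ch
  claim (suc n₀) ℓ b (suc j) eq len le ch = open-case n₀ (claim n₀) ℓ b j eq (is-k (ℕP.≤-total k (suc n₀))) le ch
    where
    is-k : k ℕ.≤ suc n₀ ⊎ suc n₀ ℕ.≤ k → suc ℓ ≡ k
    is-k (inj₁ k≤) = ≡.trans len (ℕP.m≥n⇒m⊓n≡n k≤)
    is-k (inj₂ ≤k) = ⊥-elim (ℕP.<-irrefl (≡.trans len (≡.trans (ℕP.m≤n⇒m⊓n≡m ≤k) eq))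
      (ℕP.m<m+n (suc ℓ) (s≤s z≤n)))

-- listEq is local to gogs, so the predicate it is used in is recovered from
-- gogs by unification.
mutual
  gogPredicate : (m n k : ℕ) → List ℕ → Array → Bool
  gogPredicate m n k bs T = _

  gogs-filter : ∀ m n k bs → gogs m n k bs ≡ List.filter (λ T → T? (gogPredicate m n k bs T)) (candidates m n k)
  gogs-filter m n k bs = ≡.refl

mutual
  sameList : (m k : ℕ) → List ℕ → List ℕ → Bool
  sameList m k w bs = _

  gogPredicate-row : ∀ m k w bs → gogPredicate m 1 k bs (w ∷ []) ≡ (isGog m 1 k (w ∷ []) ∧ sameList m k w bs)
  gogPredicate-row m k w bs = ≡.refl

gogB-length : ∀ M n k T → length T ≢ n → gogB M n k T ≡ false
gogB-length M n k T T≢n rewrite ≡ᵇ-false T≢n = ≡.refl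

-- From the list of trapezoids to the row-by-row count

module GogSum (𝕂 : Ring₀) (p q : CommutativeRing.Carrier 𝕂) (k : ℕ) (1≤k : 1 ℕ.≤ k) where
  open CommutativeRing 𝕂 hiding (zero)
  open RingKit 𝕂
  open Vandermonde 𝕂 using (pow; pow-+)
  open Telescope 𝕂 using (ind; ind-true; ind-false; sum-single)
  open Recursion 𝕂
  open Relation.Binary.Reasoning.Setoid setoid

  gogWeight : ℕ → ℕ → Array → Carrier
  gogWeight M n T = pow p (minimaN n k T) * pow q (maximaN M n k T)

  sum-filter : ∀ {X : Set} (P : X → Bool) xs (f : X → Carrier) →
    sumL (List.filter (λ x → T? (P x)) xs) f ≈ sumL xs (λ x → ind (P x) * f x)
  sum-filter P []       f = refl
  sum-filter P (x ∷ xs) f with P x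
  ... | true  = +-cong (sym (*-identityˡ _)) (sum-filter P xs f)
  ... | false = trans (sum-filter P xs f) (trans (sym (+-identityˡ _)) (+-congʳ (sym (zeroˡ _))))

  module _ (M : ℕ) where
    open Counting 𝕂 p q M k 1≤k

    arrays : List ℕ → List Array
    arrays = foldr (λ i rest → List.concatMap (λ r → List.map (r ∷_) rest) (words (i ⊓ k) A)) ([] ∷ [])

    sum-arrays-∷ : ∀ i is (f : Array → Carrier) →
      sumL (arrays (i ∷ is)) f ≈ sumL (words (i ⊓ k) A) (λ r → sumL (arrays is) (λ T → f (r ∷ T)))
    sum-arrays-∷ i is f = trans (sum-concatMap _ (words (i ⊓ k) A) f)
      (sum-cong (words (i ⊓ k) A) (λ r → reflexive (sum-map (r ∷_) (arrays is) f)))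

    sum-arrays-∷ʳ : ∀ is i (f : Array → Carrier) →
      sumL (arrays (is ++ (i ∷ []))) f ≈ sumL (arrays is) (λ T → sumL (words (i ⊓ k) A) (λ r → f (T ∷ʳ r)))
    sum-arrays-∷ʳ []        i f = trans (sum-arrays-∷ i [] f) (trans
      (sum-cong (words (i ⊓ k) A) (λ r → +-identityʳ _)) (sym (+-identityʳ _)))
    sum-arrays-∷ʳ (i′ ∷ is) i f = begin
      sumL (arrays (i′ ∷ is ++ (i ∷ []))) f
        ≈⟨ sum-arrays-∷ i′ (is ++ (i ∷ [])) f ⟩
      sumL (words (i′ ⊓ k) A) (λ r′ → sumL (arrays (is ++ (i ∷ []))) (λ T → f (r′ ∷ T)))
        ≈⟨ sum-cong (words (i′ ⊓ k) A) (λ r′ → sum-arrays-∷ʳ is i (λ T → f (r′ ∷ T))) ⟩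
      sumL (words (i′ ⊓ k) A) (λ r′ → sumL (arrays is) (λ T → sumL (words (i ⊓ k) A) (λ r → f (r′ ∷ T ∷ʳ r))))
        ≈⟨ sum-arrays-∷ i′ is _ ⟨
      sumL (arrays (i′ ∷ is)) (λ T → sumL (words (i ⊓ k) A) (λ r → f (T ∷ʳ r))) ∎

    lowerWeight : ℕ → List ℕ → List ℕ → Carrier
    lowerWeight n upper r = ind (rowOK M k (suc n) r) * (pow p (rowOnes k (suc n) r) * rowWeight n upper r)

    weight-∷ʳ : ∀ n T r (h : List ℕ → Carrier) →
      ind (gogB M (suc n) k (T ∷ʳ r)) * gogWeight M (suc n) (T ∷ʳ r) * h (row (T ∷ʳ r) (suc n))
        ≈ ind (gogB M n k T) * gogWeight M n T * (lowerWeight n (row T n) r * h r)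
    weight-∷ʳ n T r h with length T ℕ.≟ n
    ... | yes ≡.refl = begin
      ind (gogB M (suc n′) k (T ∷ʳ r)) * gogWeight M (suc n′) (T ∷ʳ r) * h (row (T ∷ʳ r) (suc n′))
        ≈⟨ *-cong (*-cong
             (trans (reflexive (≡.cong ind (gogB-∷ʳ M k T r))) (trans (ind-∧ (gogB M n′ k T) _) (*-congˡ (ind-∧ (rowOK M k (suc n′) r) _))))
             (*-cong (trans (reflexive (≡.cong (pow p) (minimaN-∷ʳ k T r))) (pow-+ p (minimaN n′ k T) (rowOnes k (suc n′) r)))
                     (trans (reflexive (≡.cong (pow q) (maximaN-∷ʳ M k T r 1≤k))) (pow-+ q (maximaN M n′ k T) [ isMaxRow M k n′ (row T n′) ]₁))))
             (reflexive (≡.cong h (row-new T r))) ⟩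
      (g * (o * s)) * ((m * m′) * (x * x′)) * h r
        ≈⟨ solve 8 (λ g o s m m′ x x′ h → (g :* (o :* s)) :* ((m :* m′) :* (x :* x′)) :* h
             := g :* (m :* x) :* (o :* (m′ :* (s :* x′)) :* h)) refl g o s m m′ x x′ (h r) ⟩
      g * (m * x) * (o * (m′ * (s * x′)) * h r) ∎
      where
      n′ = length T
      g = ind (gogB M n′ k T)
      o = ind (rowOK M k (suc n′) r)
      s = ind (rowsOK k n′ (row T n′) r)
      m = pow p (minimaN n′ k T)
      m′ = pow p (rowOnes k (suc n′) r)
      x = pow q (maximaN M n′ k T)
      x′ = pow q [ isMaxRow M k n′ (row T n′) ]₁
    ... | no T≢n = trans (trans (*-congʳ (ind-false _ (gogB-length M (suc n) k (T ∷ʳ r) long))) (zeroˡ _))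
        (sym (trans (*-congʳ (ind-false _ (gogB-length M n k T T≢n))) (zeroˡ _)))
      where
      long : length (T ∷ʳ r) ≢ suc n
      long e = T≢n (ℕP.suc-injective (≡.trans (≡.sym (LP.length-++-comm T (r ∷ []))) e))

    -- The test function h of the bottom row drives the induction: the weight of an added row, seen
    -- as a function of the row above it, becomes the test function one level up.
    sum-gogs : ∀ n (h : List ℕ → Carrier) →
      sumL (arrays (range1 n)) (λ T → ind (gogB M n k T) * gogWeight M n T * h (row T n))
        ≈ sumL (words (n ⊓ k) A) (λ r → total n r * h r)
    sum-gogs zero    h = +-congʳ (*-congʳ (trans (*-identityˡ _) (*-identityˡ _)))
    sum-gogs (suc n) h = begin
      sumL (arrays (range1 (suc n))) F
        ≡⟨ ≡.cong (λ is → sumL (arrays is) F) (range1-∷ʳ n) ⟩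
      sumL (arrays (range1 n ++ (suc n ∷ []))) F
        ≈⟨ sum-arrays-∷ʳ (range1 n) (suc n) F ⟩
      sumL (arrays (range1 n)) (λ T → sumL W (λ r → F (T ∷ʳ r)))
        ≈⟨ sum-swap (arrays (range1 n)) W _ ⟩
      sumL W (λ r → sumL (arrays (range1 n)) (λ T → F (T ∷ʳ r)))
        ≈⟨ sum-cong W (λ r → sum-cong (arrays (range1 n)) (λ T → weight-∷ʳ n T r h)) ⟩
      sumL W (λ r → sumL (arrays (range1 n)) (λ T → ind (gogB M n k T) * gogWeight M n T * (lowerWeight n (row T n) r * h r)))
        ≈⟨ sum-cong W (λ r → sum-gogs n (λ r′ → lowerWeight n r′ r * h r)) ⟩
      sumL W (λ r → sumL (words (n ⊓ k) A) (λ r′ → total n r′ * (lowerWeight n r′ r * h r)))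
        ≈⟨ sum-cong W (λ r → trans (sum-cong (words (n ⊓ k) A) (λ r′ →
             solve 5 (λ t o m x h → t :* (o :* (m :* x) :* h) := (o :* m :* h) :* (t :* x)) refl _ _ _ _ _))
             (trans (sum-*ˡ (words (n ⊓ k) A) _ _)
               (solve 4 (λ o m h x → o :* m :* h :* x := o :* (m :* x) :* h) refl _ _ _ _))) ⟩
      sumL W (λ r → total (suc n) r * h r) ∎
      where
      W = words (suc n ⊓ k) A
      F : Array → Carrier
      F T = ind (gogB M (suc n) k T) * gogWeight M (suc n) T * h (row T (suc n))

    sum-word : ∀ m prev {ℓ} (b : Vec ℕ ℓ) → Chain prev b M → (f : Vec ℕ ℓ → Carrier) →
      sumV ℓ A (λ v → f v * ind (sameList m k (toList v) (toList b))) ≈ f b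
    sum-word m prev []      _         f = *-identityʳ _
    sum-word m prev {suc ℓ} (b ∷ bs) (lt , ch) f = begin
      sumL A (λ a → sumV ℓ A (λ v → f (a ∷ v) * ind ((a ≡ᵇ b) ∧ sameList m k (toList v) (toList bs))))
        ≈⟨ sum-cong A (λ a → trans
             (sumV-cong ℓ A (λ v → trans (*-congˡ (ind-∧ (a ≡ᵇ b) _))
               (solve 3 (λ f i s → f :* (i :* s) := i :* (f :* s)) refl _ _ _)))
             (trans (sumV-* ℓ A _ _) (*-congˡ (sum-word m b bs ch (λ v → f (a ∷ v)))))) ⟩
      sumL A (λ a → ind (a ≡ᵇ b) * f (a ∷ bs))
        ≈⟨ sum-single M b (λ a → f (a ∷ bs)) (ℕP.≤-trans (s≤s z≤n) lt)
             (ℕP.≤-trans (ℕP.m≤m+n b _) (chain-length b bs M ch)) ⟩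
      f (b ∷ bs) ∎

  gogs-total : ∀ m n {ℓ} (b : Vec ℕ ℓ) → ℓ ≡ n ⊓ k → Chain 0 b (m ℕ.+ n) →
    sumL (gogs m n k (toList b)) (λ T → pow p (#minima m n k T) * pow q (#maxima m n k T))
      ≈ Counting.total 𝕂 p q (m ℕ.+ n) k 1≤k n (toList b)
  gogs-total m n {ℓ} b eq ch = begin
    sumL (gogs m n k (toList b)) (gogWeight M n)
      ≈⟨ sum-filter (gogPredicate m n k (toList b)) (candidates m n k) (gogWeight M n) ⟩
    sumL (candidates m n k) (λ T → ind (gogPredicate m n k (toList b) T) * gogWeight M n T)
      ≈⟨ sum-cong (candidates m n k) (λ T → trans (*-congʳ (ind-∧ (isGog m n k T) _))
           (solve 3 (λ a b c → a :* b :* c := a :* c :* b) refl _ _ _)) ⟩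
    sumL (arrays M (range1 n)) (λ T → ind (gogB M n k T) * gogWeight M n T * ind (sameList m k (row T n) (toList b)))
      ≈⟨ sum-gogs M n (λ r → ind (sameList m k r (toList b))) ⟩
    sumL (words (n ⊓ k) (range1 M)) (λ r → total n r * ind (sameList m k r (toList b)))
      ≈⟨ sum-words (n ⊓ k) _ ⟩
    sumV (n ⊓ k) (range1 M) (λ v → total n (toList v) * ind (sameList m k (toList v) (toList b)))
      ≡⟨ ≡.cong (λ x → sumV x (range1 M) (λ v → total n (toList v) * ind (sameList m k (toList v) (toList b)))) (≡.sym eq) ⟩
    sumV ℓ (range1 M) (λ v → total n (toList v) * ind (sameList m k (toList v) (toList b)))
      ≈⟨ sum-word M m 0 b ch (λ v → total n (toList v)) ⟩
    total n (toList b) ∎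
    where
    M = m ℕ.+ n
    open Counting 𝕂 p q M k 1≤k

open import Defs
open import Data.Fin as Fin using (Fin; zero; suc; toℕ)
import Data.Fin.Properties as FinP
open import Data.Integer as ℤ using (+_)
open import Data.List as List using (allFin)
open import Data.Vec as Vec using (lookup; last)
open import Function using (id)
open import Relation.Nullary using (does)
open import Data.List.Relation.Unary.Linked using (Linked; []; _∷_)
open import Relation.Nullary.Decidable using (does-⇔)
open import Function.Bundles using (mk⇔)

-- The Laurent polynomial of the theorem

module FinProducts (R : Ring₀) where
  open CommutativeRing R hiding (zero)
  open RingKit R
  open Vandermonde R

  prodF : ∀ n → (Fin n → Carrier) → Carrier
  prodF zero    h = 1#
  prodF (suc n) h = h zero * prodF n (h ∘ suc)

  prodF-cong : ∀ n {h h′} → (∀ i → h i ≈ h′ i) → prodF n h ≈ prodF n h′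
  prodF-cong zero    e = refl
  prodF-cong (suc n) e = *-cong (e zero) (prodF-cong n (e ∘ suc))

  prodF-split : ∀ {n} (f : Fin n) (x y z : Fin n → Carrier) w →
    prodF n (λ g → if does (f Fin.≟ g) then x g + w * y g else z g)
      ≈ prodF n (λ g → if does (f Fin.≟ g) then x g else z g) + w * prodF n (λ g → if does (f Fin.≟ g) then y g else z g)
  prodF-split zero    x y z w = solve 4 (λ x y w p → (x :+ w :* y) :* p := x :* p :+ w :* (y :* p)) refl _ _ w _
  prodF-split (suc f) x y z w = trans (*-congˡ (prodF-split f (x ∘ suc) (y ∘ suc) (z ∘ suc) w))
    (solve 4 (λ z x y w → z :* (x :+ w :* y) := z :* x :+ w :* (z :* y)) refl _ _ _ w)

  mon-prodF : ∀ n (y : Fin n → Carrier) e → mon (Vec.tabulate y) e ≈ prodF n (λ f → pow (y f) (lookup e f))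
  mon-prodF zero    y []      = refl
  mon-prodF (suc n) y (a ∷ e) = *-congˡ (mon-prodF n (y ∘ suc) e)

  rowD-prodF : ∀ n x (y : Fin n → Carrier) → prodF n (λ f → pairTerm x (y f)) ≈ rowD x (Vec.tabulate y)
  rowD-prodF zero    x y = refl
  rowD-prodF (suc n) x y = *-congˡ (rowD-prodF n x (y ∘ suc))

  prodD-prodF : ∀ n (y : Fin n → Carrier) →
    prodF n (λ f → prodF n (λ g → if toℕ f <ᵇ toℕ g then pairTerm (y f) (y g) else 1#)) ≈ prodD (Vec.tabulate y)
  prodD-prodF zero    y = refl
  prodD-prodF (suc n) y = *-cong (trans (*-identityˡ _) (rowD-prodF n (y zero) (y ∘ suc)))
    (trans (prodF-cong n (λ f → *-identityˡ _)) (prodD-prodF n (y ∘ suc)))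

-- Treating P and Q as part of the exponent makes `Poly n`, with its given product, literally the
-- monoid algebra over ℤ. Its case n = 0 is the ring ℤ[P,Q] in which the recursion is run.
Exps : ℕ → Set
Exps n = ℕ × ℕ × Vec ℤ n

_·_ : ∀ {n} → Exps n → Exps n → Exps n
x · y = proj₁ x ℕ.+ proj₁ y , proj₁ (proj₂ x) ℕ.+ proj₁ (proj₂ y)
      , Vec.zipWith ℤ._+_ (proj₂ (proj₂ x)) (proj₂ (proj₂ y))

·-isCommutativeMonoid : ∀ n → IsCommutativeMonoid _≡_ (_·_ {n}) (0 , 0 , zeroExp)
·-isCommutativeMonoid n = record
  { isMonoid = record
    { isSemigroup = record
      { isMagma = record { isEquivalence = ≡.isEquivalence ; ∙-cong = ≡.cong₂ _·_ }
      ; assoc = λ x y z → ≡.cong₂ _,_ (ℕP.+-assoc (proj₁ x) _ _)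
          (≡.cong₂ _,_ (ℕP.+-assoc (proj₁ (proj₂ x)) _ _) (VecP.zipWith-assoc ℤP.+-assoc _ _ _)) }
    ; identity = (λ x → ≡.cong (λ e → proj₁ x , proj₁ (proj₂ x) , e) (VecP.zipWith-identityˡ ℤP.+-identityˡ _))
      , (λ x → ≡.cong₂ _,_ (ℕP.+-identityʳ _) (≡.cong₂ _,_ (ℕP.+-identityʳ _) (VecP.zipWith-identityʳ ℤP.+-identityʳ _))) }
  ; comm = λ x y → ≡.cong₂ _,_ (ℕP.+-comm (proj₁ x) _)
      (≡.cong₂ _,_ (ℕP.+-comm (proj₁ (proj₂ x)) _) (VecP.zipWith-comm ℤP.+-comm _ _)) }

module LA (n : ℕ) = MonoidAlgebra ℤP.+-*-commutativeRing (_·_ {n}) (0 , 0 , zeroExp) (·-isCommutativeMonoid n)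
module LQ (n : ℕ) = LA.Quotient n (λ _ → ⊤) (λ _ _ → tt)

𝓛 : ℕ → Ring₀
𝓛 n = LQ.algebra n

module 𝓛 {n : ℕ} = CommutativeRing (𝓛 n)

𝕂 : Ring₀
𝕂 = 𝓛 0

module K = CommutativeRing 𝕂

module KK = RingKit 𝕂
module V𝓛 {n : ℕ} = Vandermonde (𝓛 n)
module FK = FinProducts 𝕂
module F𝓛 {n : ℕ} = FinProducts (𝓛 n)
open KK using (sumL)

private variable n : ℕ

scal : Term n → Poly 0
scal (z , a , b , _) = (z , a , b , []) ∷ []

Slotℤ : Set
Slotℤ = ℤ → Poly 0

tensℤ : (Fin n → Slotℤ) → Vec ℤ n → Poly 0
tensℤ {n} s e = FK.prodF n (λ f → s f (lookup e f))

-- The ℤ[P,Q]-linear functional that evaluates each variable by its own slot. Coefficient extraction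
-- is the special case of slots that pick out one exponent.
apply : (Fin n → Slotℤ) → Poly n → Poly 0
apply s p = sumL p (λ t → scal t ⊗ tensℤ s (proj₂ (proj₂ (proj₂ t))))

infix 4 _≅_
_≅_ : Poly 0 → Poly 0 → Set
_≅_ = K._≈_

open module 𝓛₀ {n : ℕ} = LQ n public using (same; at)

pair-sumL : ∀ {X : Set} (xs : List X) (f : X → Poly 0) ψ →
  LA.pair 0 (sumL xs f) ψ ≡ RingKit.sumL ℤP.+-*-commutativeRing xs (λ x → LA.pair 0 (f x) ψ)
pair-sumL []       f ψ = ≡.refl
pair-sumL (x ∷ xs) f ψ = ≡.trans (LA.pair-++ 0 (f x) (sumL xs f) ψ) (≡.cong (λ y → LA.pair 0 (f x) ψ ℤ.+ y) (pair-sumL xs f ψ))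

pair-scal : ∀ (t : Term n) x ψ → LA.pair 0 (scal t ⊗ x) ψ ≡ proj₁ t ℤ.* LA.pair 0 x (λ m → ψ ((proj₁ (proj₂ t) , proj₁ (proj₂ (proj₂ t)) , []) · m))
pair-scal t x ψ = ≡.trans (LA.pair-⊛ 0 (scal t) x ψ) (LA.pair-mono 0 (proj₁ t) _ (λ m → LA.pair 0 x (λ m′ → ψ (m · m′))))

pair-apply : ∀ s (p : Poly n) ψ → LA.pair 0 (apply s p) ψ
  ≡ LA.pair n p (λ m → LA.pair 0 (tensℤ s (proj₂ (proj₂ m))) (λ m′ → ψ ((proj₁ m , proj₁ (proj₂ m) , []) · m′)))
pair-apply s p ψ = ≡.trans (pair-sumL p _ ψ) (RingKit.sum-cong ℤP.+-*-commutativeRing p (λ t → pair-scal t (tensℤ s (proj₂ (proj₂ (proj₂ t)))) ψ))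

apply-cong : ∀ s {p q : Poly n} → p 𝓛.≈ q → apply s p ≅ apply s q
apply-cong s {p} {q} e = same λ ψ _ → ≡.trans (pair-apply s p ψ) (≡.trans (at e _ tt) (≡.sym (pair-apply s q ψ)))

apply-⊕ : ∀ s (p q : Poly n) → apply s (p ⊕ q) ≅ apply s p ⊕ apply s q
apply-⊕ s p q = KK.sum-++ p q _

apply-slots : ∀ {s s′ : Fin n → Slotℤ} p → (∀ f v → s f v ≅ s′ f v) → apply s p ≅ apply s′ p
apply-slots {n} p e = KK.sum-cong p (λ t → K.*-congˡ {x = scal t} (FK.prodF-cong n (λ f → e f _)))

module RK = Relation.Binary.Reasoning.Setoid K.setoid

apply-mono : ∀ s a b v (p : Poly n) → apply s (((+ 1 , a , b , v) ∷ []) ⊗ p)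
  ≅ ((+ 1 , a , b , []) ∷ []) ⊗ sumL p (λ t → scal t ⊗ tensℤ s (Vec.zipWith ℤ._+_ v (proj₂ (proj₂ (proj₂ t)))))
apply-mono {n} s a b v p = begin
  sumL (List.map (mulT m) p ++ []) g       ≡⟨ ≡.cong (λ xs → sumL xs g) (LP.++-identityʳ (List.map (mulT m) p)) ⟩
  sumL (List.map (mulT m) p) g             ≡⟨ KK.sum-map (mulT m) p g ⟩
  sumL p (λ t → g (mulT m t))              ≈⟨ KK.sum-cong p (λ t → K.*-assoc (scal m) (scal t) (tensℤ s (Vec.zipWith ℤ._+_ v (proj₂ (proj₂ (proj₂ t)))))) ⟩
  sumL p (λ t → scal m ⊗ (scal t ⊗ tensℤ s (Vec.zipWith ℤ._+_ v (proj₂ (proj₂ (proj₂ t)))))) ≈⟨ KK.sum-*ˡ p (scal m) _ ⟩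
  scal m ⊗ sumL p (λ t → scal t ⊗ tensℤ s (Vec.zipWith ℤ._+_ v (proj₂ (proj₂ (proj₂ t))))) ∎
  where
  open RK
  m : Term n
  m = + 1 , a , b , v
  g : Term n → Poly 0
  g t = scal t ⊗ tensℤ s (proj₂ (proj₂ (proj₂ t)))

upd : Fin n → (Slotℤ → Slotℤ) → (Fin n → Slotℤ) → Fin n → Slotℤ
upd f h s g = if does (f Fin.≟ g) then h (s g) else s g

upd-≡ : ∀ (f : Fin n) h s → upd f h s f ≡ h (s f)
upd-≡ f h s with f Fin.≟ f
... | yes _  = ≡.refl
... | no f≢f = ⊥-elim (f≢f ≡.refl)

upd-≢ : ∀ (f g : Fin n) h s → f ≢ g → upd f h s g ≡ s g
upd-≢ f g h s f≢g with f Fin.≟ g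
... | yes f≡g = ⊥-elim (f≢g f≡g)
... | no _    = ≡.refl

shift : ℤ → Slotℤ → Slotℤ
shift z g v = g (z ℤ.+ v)

timesℤ : Poly 0 → Slotℤ → Slotℤ
timesℤ w g v = g v ⊕ w ⊗ g (+ 1 ℤ.+ v)

-- Multiplication by a one-variable factor is adjoint to an operation on the slot of that variable.
-- The same principle moves all the single factors of the Laurent polynomial into the slots.
apply-xpow : ∀ (f : Fin n) z s p → apply s (xpow f z ⊗ p) ≅ apply (upd f (shift z) s) p
apply-xpow {n} f z s p = K.trans (apply-mono s 0 0 _ p) (K.trans (K.*-identityˡ _)
  (KK.sum-cong p (λ t → K.*-congˡ {x = scal t} (FK.prodF-cong n (λ g → K.reflexive (slot g (proj₂ (proj₂ (proj₂ t)))))))))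
  where
  slot : ∀ g (e : Vec ℤ n) → s g (lookup (Vec.zipWith ℤ._+_ (Vec.tabulate (λ g → if does (f Fin.≟ g) then z else + 0)) e) g)
                 ≡ upd f (shift z) s g (lookup e g)
  slot g e rewrite VecP.lookup-zipWith ℤ._+_ g (Vec.tabulate (λ g → if does (f Fin.≟ g) then z else + 0)) e
                 | VecP.lookup∘tabulate (λ g → if does (f Fin.≟ g) then z else + 0) g with f Fin.≟ g
  ... | yes _ = ≡.refl
  ... | no _  = ≡.cong (s g) (ℤP.+-identityˡ _)

apply-𝑸 : ∀ s (p : Poly n) → apply s (𝑸 ⊗ p) ≅ 𝑸 ⊗ apply s p
apply-𝑸 {n} s p = K.trans (apply-mono s 0 1 zeroExp p) (K.*-congˡ {x = 𝑸} (KK.sum-cong p (λ t →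
  K.reflexive (≡.cong (λ e → scal t ⊗ tensℤ s e) (VecP.zipWith-identityˡ ℤP.+-identityˡ _)))))

apply-𝑷 : ∀ s (p : Poly n) → apply s (𝑷 ⊗ p) ≅ 𝑷 ⊗ apply s p
apply-𝑷 {n} s p = K.trans (apply-mono s 1 0 zeroExp p) (K.*-congˡ {x = 𝑷} (KK.sum-cong p (λ t →
  K.reflexive (≡.cong (λ e → scal t ⊗ tensℤ s e) (VecP.zipWith-identityˡ ℤP.+-identityˡ _)))))

apply-timesℤ : ∀ (f : Fin n) w s p → apply s p ⊕ w ⊗ apply (upd f (shift (+ 1)) s) p ≅ apply (upd f (timesℤ w) s) p
apply-timesℤ {n} f w s p = K.sym (begin
  apply (upd f (timesℤ w) s) p
    ≈⟨ KK.sum-cong p (λ t → split t (proj₂ (proj₂ (proj₂ t)))) ⟩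
  sumL p (λ t → scal t ⊗ tensℤ s (proj₂ (proj₂ (proj₂ t))) ⊕ w ⊗ (scal t ⊗ tensℤ (upd f (shift (+ 1)) s) (proj₂ (proj₂ (proj₂ t)))))
    ≈⟨ K.trans (KK.sum-+ p _ _) (K.+-congˡ {x = apply s p} (KK.sum-*ˡ p w _)) ⟩
  apply s p ⊕ w ⊗ apply (upd f (shift (+ 1)) s) p ∎)
  where
  open RK
  move : ∀ (b : Bool) {x y z : Slotℤ} v → (if b then x else z) v ≡ (if b then x v else z v)
  move true  v = ≡.refl
  move false v = ≡.refl
  same-slot : ∀ g e → s g (lookup e g) ≡ (if does (f Fin.≟ g) then s g (lookup e g) else s g (lookup e g))
  same-slot g e with does (f Fin.≟ g)
  ... | true  = ≡.refl
  ... | false = ≡.refl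
  split : ∀ t e → scal t ⊗ tensℤ (upd f (timesℤ w) s) e
    ≅ scal t ⊗ tensℤ s e ⊕ w ⊗ (scal t ⊗ tensℤ (upd f (shift (+ 1)) s) e)
  split t e = begin
    scal t ⊗ tensℤ (upd f (timesℤ w) s) e
      ≈⟨ K.*-congˡ {x = scal t} (FK.prodF-cong n (λ g → K.reflexive (move (does (f Fin.≟ g)) {timesℤ w (s g)} {s g} {s g} (lookup e g)))) ⟩
    scal t ⊗ FK.prodF n (λ g → if does (f Fin.≟ g) then s g (lookup e g) ⊕ w ⊗ s g (+ 1 ℤ.+ lookup e g) else s g (lookup e g))
      ≈⟨ K.*-congˡ {x = scal t} (FK.prodF-split f (λ g → s g (lookup e g)) (λ g → s g (+ 1 ℤ.+ lookup e g)) (λ g → s g (lookup e g)) w) ⟩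
    scal t ⊗ (FK.prodF n (λ g → if does (f Fin.≟ g) then s g (lookup e g) else s g (lookup e g))
      ⊕ w ⊗ FK.prodF n (λ g → if does (f Fin.≟ g) then s g (+ 1 ℤ.+ lookup e g) else s g (lookup e g)))
      ≈⟨ K.*-congˡ {x = scal t} (K.+-cong (FK.prodF-cong n (λ g → K.reflexive (≡.sym (same-slot g e))))
           (K.*-congˡ {x = w} (FK.prodF-cong n (λ g → K.reflexive (≡.sym (move (does (f Fin.≟ g)) {shift (+ 1) (s g)} {s g} {s g} (lookup e g))))))) ⟩
    scal t ⊗ (tensℤ s e ⊕ w ⊗ tensℤ (upd f (shift (+ 1)) s) e)
      ≈⟨ KK.solve 4 (λ c x w y → c KK.:* (x KK.:+ w KK.:* y) KK.:= c KK.:* x KK.:+ w KK.:* (c KK.:* y)) K.refl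
           (scal t) (tensℤ s e) w (tensℤ (upd f (shift (+ 1)) s) e) ⟩
    scal t ⊗ tensℤ s e ⊕ w ⊗ (scal t ⊗ tensℤ (upd f (shift (+ 1)) s) e) ∎

apply-one+𝒙 : ∀ (f : Fin n) s p → apply s ((one ⊕ 𝒙 f) ⊗ p) ≅ apply (upd f (timesℤ one) s) p
apply-one+𝒙 f s p = begin
  apply s ((one ⊕ 𝒙 f) ⊗ p)                 ≈⟨ apply-cong s (𝓛.trans (𝓛.distribʳ p one (𝒙 f)) (𝓛.+-congʳ {x = 𝒙 f ⊗ p} (𝓛.*-identityˡ p))) ⟩
  apply s (p ⊕ 𝒙 f ⊗ p)                     ≈⟨ apply-⊕ s p (𝒙 f ⊗ p) ⟩
  apply s p ⊕ apply s (𝒙 f ⊗ p)             ≈⟨ K.+-congˡ {x = apply s p} (K.trans (apply-xpow f (+ 1) s p) (K.sym (K.*-identityˡ _))) ⟩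
  apply s p ⊕ one ⊗ apply (upd f (shift (+ 1)) s) p ≈⟨ apply-timesℤ f one s p ⟩
  apply (upd f (timesℤ one) s) p ∎
  where open RK

apply-one+𝑸𝒙 : ∀ (f : Fin n) s p → apply s ((one ⊕ (𝑸 ⊗ 𝒙 f)) ⊗ p) ≅ apply (upd f (timesℤ 𝑸) s) p
apply-one+𝑸𝒙 f s p = begin
  apply s ((one ⊕ (𝑸 ⊗ 𝒙 f)) ⊗ p)
    ≈⟨ apply-cong s (𝓛.trans (𝓛.distribʳ p one (𝑸 ⊗ 𝒙 f)) (𝓛.+-cong (𝓛.*-identityˡ p) (𝓛.*-assoc 𝑸 (𝒙 f) p))) ⟩
  apply s (p ⊕ 𝑸 ⊗ (𝒙 f ⊗ p))                      ≈⟨ apply-⊕ s p (𝑸 ⊗ (𝒙 f ⊗ p)) ⟩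
  apply s p ⊕ apply s (𝑸 ⊗ (𝒙 f ⊗ p))
    ≈⟨ K.+-congˡ {x = apply s p} (K.trans (apply-𝑸 s (𝒙 f ⊗ p)) (K.*-congˡ {x = 𝑸} (apply-xpow f (+ 1) s p))) ⟩
  apply s p ⊕ 𝑸 ⊗ apply (upd f (shift (+ 1)) s) p  ≈⟨ apply-timesℤ f 𝑸 s p ⟩
  apply (upd f (timesℤ 𝑸) s) p ∎
  where open RK

iterUp : ℕ → Slotℤ → Slotℤ
iterUp zero    g = g
iterUp (suc b) g = iterUp b (timesℤ one g)

upd-∘ : ∀ (f : Fin n) h h′ s g → upd f h (upd f h′ s) g ≡ upd f (λ x → h (h′ x)) s g
upd-∘ f h h′ s g with f Fin.≟ g
... | yes _ = ≡.refl
... | no _  = ≡.refl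

apply-upd-∘ : ∀ (f : Fin n) h h′ s p → apply (upd f h (upd f h′ s)) p ≅ apply (upd f (λ x → h (h′ x)) s) p
apply-upd-∘ f h h′ s p = apply-slots p (λ g v → K.reflexive (≡.cong (λ x → x v) (upd-∘ f h h′ s g)))

apply-power : ∀ (f : Fin n) b s p → apply s (((one ⊕ 𝒙 f) ^ᴾ b) ⊗ p) ≅ apply (upd f (iterUp b) s) p
apply-power f zero s p = K.trans (apply-cong s (𝓛.*-identityˡ p)) (apply-slots p (λ g v → K.reflexive (≡.cong (λ x → x v) (trivial g))))
  where
  trivial : ∀ g → s g ≡ upd f (iterUp 0) s g
  trivial g with does (f Fin.≟ g)
  ... | true  = ≡.refl
  ... | false = ≡.refl
apply-power f (suc b) s p = begin
  apply s (((one ⊕ 𝒙 f) ⊗ ((one ⊕ 𝒙 f) ^ᴾ b)) ⊗ p)   ≈⟨ apply-cong s (𝓛.*-assoc (one ⊕ 𝒙 f) ((one ⊕ 𝒙 f) ^ᴾ b) p) ⟩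
  apply s ((one ⊕ 𝒙 f) ⊗ (((one ⊕ 𝒙 f) ^ᴾ b) ⊗ p))   ≈⟨ apply-one+𝒙 f s (((one ⊕ 𝒙 f) ^ᴾ b) ⊗ p) ⟩
  apply (upd f (timesℤ one) s) (((one ⊕ 𝒙 f) ^ᴾ b) ⊗ p) ≈⟨ apply-power f b (upd f (timesℤ one) s) p ⟩
  apply (upd f (iterUp b) (upd f (timesℤ one) s)) p   ≈⟨ apply-upd-∘ f (iterUp b) (timesℤ one) s p ⟩
  apply (upd f (iterUp (suc b)) s) p ∎
  where open RK

updAll : ∀ {m} → (Fin n → Slotℤ → Slotℤ) → (Fin m → Fin n) → (Fin n → Slotℤ) → Fin n → Slotℤ
updAll {m = zero}  op ρ s = s
updAll {m = suc m} op ρ s = updAll op (ρ ∘ suc) (upd (ρ zero) (op (ρ zero)) s)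

updAll-miss : ∀ {m} op (ρ : Fin m → Fin n) s g → (∀ i → ρ i ≢ g) → updAll op ρ s g ≡ s g
updAll-miss {m = zero}  op ρ s g miss = ≡.refl
updAll-miss {m = suc m} op ρ s g miss = ≡.trans (updAll-miss op (ρ ∘ suc) (upd (ρ zero) (op (ρ zero)) s) g (miss ∘ suc)) (upd-≢ (ρ zero) g (op (ρ zero)) s (miss zero))

updAll-hit : ∀ {m} op (ρ : Fin m → Fin n) s → (∀ i j → ρ i ≡ ρ j → i ≡ j) → ∀ i → updAll op ρ s (ρ i) ≡ op (ρ i) (s (ρ i))
updAll-hit op ρ s inj zero = ≡.trans
  (updAll-miss op (ρ ∘ suc) (upd (ρ zero) (op (ρ zero)) s) (ρ zero) (λ i e → FinP.0≢1+n (≡.sym (inj (suc i) zero e)))) (upd-≡ (ρ zero) (op (ρ zero)) s)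
updAll-hit op ρ s inj (suc i) = ≡.trans
  (updAll-hit op (ρ ∘ suc) (upd (ρ zero) (op (ρ zero)) s) (λ i j e → FinP.suc-injective (inj (suc i) (suc j) e)) i)
  (≡.cong (op (ρ (suc i))) (upd-≢ (ρ zero) (ρ (suc i)) (op (ρ zero)) s (λ e → FinP.0≢1+n (inj zero (suc i) e))))

-- The factors act on distinct slots, so absorbing them one after another changes each slot exactly
-- once.
apply-prodF : ∀ (B : Fin n → Poly n) op → (∀ f s p → apply s (B f ⊗ p) ≅ apply (upd f (op f) s) p) →
  ∀ s p → apply s (F𝓛.prodF n B ⊗ p) ≅ apply (λ f → op f (s f)) p
apply-prodF {n} B op H s p = K.trans (go (λ f → f) s) (apply-slots p (λ f v → K.reflexive (≡.cong (λ x → x v)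
    (updAll-hit op (λ f → f) s (λ _ _ e → e) f))))
  where
  open RK
  go : ∀ {m} (ρ : Fin m → Fin n) s → apply s (F𝓛.prodF m (B ∘ ρ) ⊗ p) ≅ apply (updAll op ρ s) p
  go {zero}  ρ s = apply-cong s (𝓛.*-identityˡ p)
  go {suc m} ρ s = begin
    apply s ((B (ρ zero) ⊗ F𝓛.prodF m (B ∘ ρ ∘ suc)) ⊗ p) ≈⟨ apply-cong s (𝓛.*-assoc (B (ρ zero)) (F𝓛.prodF m (B ∘ ρ ∘ suc)) p) ⟩
    apply s (B (ρ zero) ⊗ (F𝓛.prodF m (B ∘ ρ ∘ suc) ⊗ p)) ≈⟨ H (ρ zero) s (F𝓛.prodF m (B ∘ ρ ∘ suc) ⊗ p) ⟩
    apply (upd (ρ zero) (op (ρ zero)) s) (F𝓛.prodF m (B ∘ ρ ∘ suc) ⊗ p) ≈⟨ go (ρ ∘ suc) (upd (ρ zero) (op (ρ zero)) s) ⟩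
    apply (updAll op ρ s) p ∎

module Emb (n : ℕ) where
  embed : Poly 0 → Poly n
  embed = List.map (λ t → proj₁ t , proj₁ (proj₂ t) , proj₁ (proj₂ (proj₂ t)) , zeroExp)

  private
    lift : Exps 0 → Exps n
    lift m = proj₁ m , proj₁ (proj₂ m) , zeroExp

    pair-embed : ∀ c φ → LA.pair n (embed c) φ ≡ LA.pair 0 c (λ m → φ (lift m))
    pair-embed c φ = RingKit.sum-map ℤP.+-*-commutativeRing _ c _

    lift-· : ∀ m m′ → lift (m · m′) ≡ lift m · lift m′
    lift-· m m′ = ≡.cong (λ e → proj₁ m ℕ.+ proj₁ m′ , proj₁ (proj₂ m) ℕ.+ proj₁ (proj₂ m′) , e)
      (≡.sym (VecP.zipWith-identityˡ ℤP.+-identityˡ zeroExp))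

  embedHom : Hom 𝕂 (𝓛 n)
  embedHom = record
    { ⟦_⟧    = embed
    ; +-homo = λ x y → 𝓛.reflexive (LP.map-++ _ x y)
    ; *-homo = λ x y → same λ φ _ → ≡.trans (pair-embed (x ⊗ y) φ) (≡.trans (LA.pair-⊛ 0 x y _)
        (≡.trans (LA.pair-cong 0 x (λ m → LA.pair-cong 0 y (λ m′ → ≡.cong φ (lift-· m m′))))
        (≡.sym (≡.trans (LA.pair-⊛ n (embed x) (embed y) φ) (≡.trans (pair-embed x _)
          (LA.pair-cong 0 x (λ m → pair-embed y _)))))))
    ; -‿homo = λ x → 𝓛.reflexive (≡.trans (≡.sym (LP.map-∘ x)) (LP.map-∘ x))
    ; 1-homo = 𝓛.refl }

  apply-embed : ∀ s c p → apply s (embed c ⊗ p) ≅ c ⊗ apply s p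
  apply-embed s []      p = K.refl
  apply-embed s (t@(z , a , b , []) ∷ c) p = begin
    apply s (List.map (mulT t′) p ++ embed c ⊗ p)
      ≈⟨ apply-⊕ s (List.map (mulT t′) p) (embed c ⊗ p) ⟩
    apply s (List.map (mulT t′) p) ⊕ apply s (embed c ⊗ p)
      ≈⟨ K.+-cong term (apply-embed s c p) ⟩
    (t ∷ []) ⊗ apply s p ⊕ c ⊗ apply s p
      ≈⟨ K.distribʳ (apply s p) (t ∷ []) c ⟨
    (t ∷ c) ⊗ apply s p ∎
    where
    open RK
    t′ : Term n
    t′ = z , a , b , zeroExp
    term : apply s (List.map (mulT t′) p) ≅ (t ∷ []) ⊗ apply s p
    term = begin
      apply s (List.map (mulT t′) p)
        ≡⟨ KK.sum-map (mulT t′) p _ ⟩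
      sumL p (λ u → scal (mulT t′ u) ⊗ tensℤ s (Vec.zipWith ℤ._+_ zeroExp (proj₂ (proj₂ (proj₂ u)))))
        ≈⟨ KK.sum-cong p (λ u → K.trans (K.*-congˡ {x = scal (mulT t′ u)} (K.reflexive (≡.cong (tensℤ s) (VecP.zipWith-identityˡ ℤP.+-identityˡ _))))
             (K.*-assoc (t ∷ []) (scal u) (tensℤ s (proj₂ (proj₂ (proj₂ u)))))) ⟩
      sumL p (λ u → (t ∷ []) ⊗ (scal u ⊗ tensℤ s (proj₂ (proj₂ (proj₂ u)))))
        ≈⟨ KK.sum-*ˡ p (t ∷ []) _ ⟩
      (t ∷ []) ⊗ apply s p ∎

open Polynomials 𝕂 using (module Evaluation; vars; Pol)
module SF = SlotFunctionals 𝕂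
module J = Junctions 𝕂
module Rec = Recursion 𝕂
module VK = Vandermonde 𝕂
open SF using (Slot)
open Rec using (sq; times1+; binom; _≐_; gogFormL)


-- Coefficients as functionals, and the product over pairs of variables

indicator : ∀ {n} → ℕ → ℕ → Vec ℤ n → Exps n → ℤ
indicator a b e m = if (proj₁ m ≡ᵇ a) ∧ (proj₁ (proj₂ m) ≡ᵇ b) ∧ does (VecP.≡-dec ℤ._≟_ (proj₂ (proj₂ m)) e) then + 1 else + 0

coeff-pair : ∀ (p : Poly n) a b e → coeff p a b e ≡ LA.pair n p (indicator a b e)
coeff-pair []      a b e = ≡.refl
coeff-pair (t ∷ p) a b e = ≡.cong₂ ℤ._+_ (times-if _ (proj₁ t)) (coeff-pair p a b e)
  where
  times-if : ∀ (c : Bool) z → (if c then z else + 0) ≡ z ℤ.* (if c then + 1 else + 0)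
  times-if true  z = ≡.sym (ℤP.*-identityʳ z)
  times-if false z = ≡.sym (ℤP.*-zeroʳ z)

coeff-cong : ∀ {p q : Poly n} a b e → p 𝓛.≈ q → coeff p a b e ≡ coeff q a b e
coeff-cong {p = p} {q} a b e eq = ≡.trans (coeff-pair p a b e) (≡.trans (at eq _ tt) (≡.sym (coeff-pair q a b e)))

δ : ℤ → Slotℤ
δ z v = if does (v ℤ.≟ z) then one else []

δ-prod : ∀ (e e′ : Vec ℤ n) →
  tensℤ (λ f → δ (lookup e f)) e′ ≅ (if does (VecP.≡-dec ℤ._≟_ e′ e) then one else [])
δ-prod []      []        = K.refl
δ-prod (z ∷ e) (z′ ∷ e′) = K.trans (K.*-congˡ {x = δ z z′} (δ-prod e e′)) (and (does (z′ ℤ.≟ z)) (does (VecP.≡-dec ℤ._≟_ e′ e)))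
  where
  and : ∀ (a b : Bool) → (if a then one {0} else []) ⊗ (if b then one else []) ≅ (if a ∧ b then one else [])
  and true  b = K.*-identityˡ (if b then one else [])
  and false b = K.zeroˡ (if b then one {0} else [])

-- The indicator of an exponent vector is a product of indicators, one per variable; only the
-- exponents of P and Q are left to be read afterwards.
coeff-apply : ∀ (p : Poly n) a b e → coeff p a b e ≡ coeff (apply (λ f → δ (lookup e f)) p) a b []
coeff-apply {n} p a b e = ≡.sym (≡.trans (coeff-pair (apply (λ f → δ (lookup e f)) p) a b [])
  (≡.trans (pair-apply (λ f → δ (lookup e f)) p (indicator a b []))
    (≡.trans (LA.pair-cong n p pointwise) (≡.sym (coeff-pair p a b e)))))
  where
  pointwise : ∀ m → LA.pair 0 (tensℤ (λ f → δ (lookup e f)) (proj₂ (proj₂ m)))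
                      (λ m′ → indicator a b [] ((proj₁ m , proj₁ (proj₂ m) , []) · m′)) ≡ indicator a b e m
  pointwise (i , j , e′) = ≡.trans (at (δ-prod e e′) _ tt) (value (does (VecP.≡-dec ℤ._≟_ e′ e)))
    where
    value : ∀ c → LA.pair 0 (if c then one else []) (λ m′ → indicator a b [] ((i , j , []) · m′))
                  ≡ (if (i ≡ᵇ a) ∧ (j ≡ᵇ b) ∧ c then + 1 else + 0)
    value true rewrite ℕP.+-identityʳ i | ℕP.+-identityʳ j with i ≡ᵇ a | j ≡ᵇ b
    ... | true  | true  = ≡.refl
    ... | true  | false = ≡.refl
    ... | false | _     = ≡.refl
    value false with i ≡ᵇ a | j ≡ᵇ b
    ... | true  | true  = ≡.refl
    ... | true  | false = ≡.refl
    ... | false | _     = ≡.refl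

𝐱 : ∀ n → Vec (Poly n) n
𝐱 n = Vec.tabulate 𝒙

apply-pow : ∀ (f : Fin n) j s p → apply s (V𝓛.pow (𝒙 f) j ⊗ p) ≅ apply (upd f (shift (+ j)) s) p
apply-pow f zero s p = K.trans (apply-cong s (𝓛.*-identityˡ p)) (apply-slots p (λ g v → K.reflexive (trivial g v)))
  where
  trivial : ∀ g v → s g v ≡ upd f (shift (+ 0)) s g v
  trivial g v with does (f Fin.≟ g)
  ... | true  = ≡.cong (s g) (≡.sym (ℤP.+-identityˡ v))
  ... | false = ≡.refl
apply-pow f (suc j) s p = begin
  apply s ((𝒙 f ⊗ V𝓛.pow (𝒙 f) j) ⊗ p)                  ≈⟨ apply-cong s (𝓛.*-assoc (𝒙 f) (V𝓛.pow (𝒙 f) j) p) ⟩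
  apply s (𝒙 f ⊗ (V𝓛.pow (𝒙 f) j ⊗ p))                  ≈⟨ apply-xpow f (+ 1) s (V𝓛.pow (𝒙 f) j ⊗ p) ⟩
  apply (upd f (shift (+ 1)) s) (V𝓛.pow (𝒙 f) j ⊗ p)    ≈⟨ apply-pow f j (upd f (shift (+ 1)) s) p ⟩
  apply (upd f (shift (+ j)) (upd f (shift (+ 1)) s)) p ≈⟨ apply-slots p (λ g v → K.reflexive (combine g v)) ⟩
  apply (upd f (shift (+ suc j)) s) p ∎
  where
  open RK
  combine : ∀ g v → upd f (shift (+ j)) (upd f (shift (+ 1)) s) g v ≡ upd f (shift (+ suc j)) s g v
  combine g v with f Fin.≟ g
  ... | yes _ = ≡.cong (s g) (≡.sym (ℤP.+-assoc (+ 1) (+ j) v))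
  ... | no _  = ≡.refl

tens-tabulate : ∀ n (h : Fin n → Slot) e → SF.tens (Vec.tabulate h) e ≡ FK.prodF n (λ f → h f (lookup e f))
tens-tabulate zero    h e       = ≡.refl
tens-tabulate (suc n) h (a ∷ e) = ≡.cong (h zero a ⊗_) (tens-tabulate n (h ∘ suc) e)

-- Once the single factors have been absorbed, only the product over pairs remains. It has no
-- negative exponents, so the slots matter only on ℕ.
restrict : (Fin n → Slotℤ) → Vec Slot n
restrict s = Vec.tabulate (λ f e → s f (+ e))

apply-mon : ∀ (s : Fin n → Slotℤ) e → apply s (V𝓛.mon (𝐱 n) e) ≅ SF.tens (restrict s) e
apply-mon {n} s e = begin
  apply s (V𝓛.mon (𝐱 n) e)
    ≈⟨ apply-cong s (𝓛.trans (F𝓛.mon-prodF n 𝒙 e) (𝓛.sym (𝓛.*-identityʳ (F𝓛.prodF n B)))) ⟩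
  apply s (F𝓛.prodF n B ⊗ one)
    ≈⟨ apply-prodF B (λ f → shift (+ lookup e f)) (λ f → apply-pow f (lookup e f)) s one ⟩
  apply (λ f → shift (+ lookup e f) (s f)) one
    ≈⟨ K.trans (K.+-identityʳ _) (K.*-identityˡ _) ⟩
  tensℤ (λ f → shift (+ lookup e f) (s f)) zeroExp
    ≈⟨ FK.prodF-cong n (λ f → K.reflexive (≡.cong (s f) (≡.trans (≡.cong (λ z → + lookup e f ℤ.+ z) (VecP.lookup-replicate f (+ 0)))
         (ℤP.+-identityʳ _)))) ⟩
  FK.prodF n (λ f → s f (+ lookup e f))
    ≡⟨ tens-tabulate n (λ f i → s f (+ i)) e ⟨
  SF.tens (restrict s) e ∎
  where
  open RK
  B : Fin n → Poly n
  B f = V𝓛.pow (𝒙 f) (lookup e f)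

gogProduct : ∀ n → Poly n
gogProduct n = prodP (concatMap (λ f → List.map (pairFactor f) (allFin n)) (allFin n))

prodP-++ : ∀ (ps qs : List (Poly n)) → prodP (ps ++ qs) 𝓛.≈ prodP ps ⊗ prodP qs
prodP-++ {n} []       qs = 𝓛.sym {n} {prodP [] ⊗ prodP qs} {prodP qs} (𝓛.*-identityˡ {n} (prodP qs))
prodP-++ {n} (p ∷ ps) qs = begin
  p ⊗ prodP (ps ++ qs)         ≈⟨ 𝓛.*-congˡ {n} {p} {prodP (ps ++ qs)} {prodP ps ⊗ prodP qs} (prodP-++ ps qs) ⟩
  p ⊗ (prodP ps ⊗ prodP qs)    ≈⟨ 𝓛.*-assoc {n} p (prodP ps) (prodP qs) ⟨
  (p ⊗ prodP ps) ⊗ prodP qs    ∎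
  where open Relation.Binary.Reasoning.Setoid (𝓛.setoid {n})

prodP-tabulate : ∀ m (ρ : Fin m → Fin n) (B : Fin n → Poly n) →
  prodP (List.map B (List.tabulate ρ)) ≡ F𝓛.prodF {n} m (λ i → B (ρ i))
prodP-tabulate     zero    ρ B = ≡.refl
prodP-tabulate {n} (suc m) ρ B = ≡.cong (λ x → B (ρ zero) ⊗ x) (prodP-tabulate m (λ i → ρ (suc i)) B)

prodP-concatMap : ∀ m (ρ : Fin m → Fin n) (h : Fin n → List (Poly n)) →
  prodP (concatMap h (List.tabulate ρ)) 𝓛.≈ F𝓛.prodF {n} m (λ i → prodP (h (ρ i)))
prodP-concatMap {n} zero    ρ h = 𝓛.refl {n} {one}
prodP-concatMap {n} (suc m) ρ h = 𝓛.trans {n}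
  (prodP-++ (h (ρ zero)) (concatMap h (List.tabulate (λ i → ρ (suc i)))))
  (𝓛.*-congˡ {n} {prodP (h (ρ zero))} (prodP-concatMap m (λ i → ρ (suc i)) h))

pairFactor-pairTerm : ∀ (f g : Fin n) →
  pairFactor f g ≡ (if toℕ f <ᵇ toℕ g then V𝓛.pairTerm {n} (𝒙 f) (𝒙 g) else one)
pairFactor-pairTerm {n} f g with toℕ f <ᵇ toℕ g
... | true  = ≡.refl
... | false = ≡.refl

gogProduct-prodD : ∀ n → gogProduct n 𝓛.≈ V𝓛.prodD {n} (𝐱 n)
gogProduct-prodD n = begin
  gogProduct n
    ≈⟨ prodP-concatMap n id (λ f → List.map (pairFactor f) (allFin n)) ⟩
  F𝓛.prodF {n} n (λ f → prodP (List.map (pairFactor f) (allFin n)))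
    ≈⟨ F𝓛.prodF-cong {n} n (λ f → 𝓛.reflexive {n} (prodP-tabulate n id (pairFactor f))) ⟩
  F𝓛.prodF {n} n (λ f → F𝓛.prodF {n} n (pairFactor f))
    ≈⟨ F𝓛.prodF-cong {n} n (λ f → F𝓛.prodF-cong {n} n (λ g → 𝓛.reflexive {n} (pairFactor-pairTerm f g))) ⟩
  F𝓛.prodF {n} n (λ f → F𝓛.prodF {n} n (λ g → if toℕ f <ᵇ toℕ g then V𝓛.pairTerm {n} (𝒙 f) (𝒙 g) else one))
    ≈⟨ F𝓛.prodD-prodF {n} n 𝒙 ⟩
  V𝓛.prodD {n} (𝐱 n) ∎
  where open Relation.Binary.Reasoning.Setoid (𝓛.setoid {n})

module Ev (n : ℕ) = Evaluation {S = 𝓛 n} (Emb.embedHom n)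

formalProduct : ∀ n → MonoidAlgebra.Elem 𝕂 {Vec ℕ n} _+ᵉ_ 0ᵉ (+ᵉ-isCommutativeMonoid n)
formalProduct n = Vandermonde.prodD (Pol n) (vars n)

gogProduct-ev : ∀ n → gogProduct n 𝓛.≈ Ev.ev n (𝐱 n) (formalProduct n)
gogProduct-ev n = 𝓛.trans {n} {gogProduct n} {V𝓛.prodD {n} (𝐱 n)} {Ev.ev n (𝐱 n) (formalProduct n)}
  (gogProduct-prodD n) (Ev.prodD-ev n (𝐱 n))

apply-sum : ∀ (s : Fin n → Slotℤ) {X : Set} (xs : List X) (f : X → Poly n) →
  apply s (RingKit.sumL (𝓛 n) xs f) ≅ KK.sumL xs (λ x → apply s (f x))
apply-sum     s []       f = K.refl
apply-sum {n} s (x ∷ xs) f = K.trans (apply-⊕ s (f x) (RingKit.sumL (𝓛 n) xs f)) (K.+-congˡ {x = apply s (f x)} (apply-sum s xs f))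

apply-ev : ∀ (s : Fin n → Slotℤ) x → apply s (Ev.ev n (𝐱 n) x) ≅ SF.umbral (restrict s) x
apply-ev {n} s x = K.trans (apply-sum s x (λ t → Emb.embed n (proj₁ t) ⊗ V𝓛.mon {n} (𝐱 n) (proj₂ t)))
  (KK.sum-cong x (λ t → K.trans (Emb.apply-embed n s (proj₁ t) (V𝓛.mon {n} (𝐱 n) (proj₂ t)))
    (K.*-congˡ {x = proj₁ t} (apply-mon s (proj₂ t)))))

apply-gogProduct : ∀ (s : Fin n → Slotℤ) → apply s (gogProduct n) ≅ SF.gogForm n (restrict s)
apply-gogProduct {n} s = begin
  apply s (gogProduct n)                       ≈⟨ apply-cong s {gogProduct n} {Ev.ev n (𝐱 n) (formalProduct n)} (gogProduct-ev n) ⟩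
  apply s (Ev.ev n (𝐱 n) (formalProduct n))    ≈⟨ apply-ev s (formalProduct n) ⟩
  SF.umbral (restrict s) (formalProduct n)     ≈⟨ J.gogForm-umbral n (restrict s) ⟨
  SF.gogForm n (restrict s) ∎
  where open RK

-- Single-variable factors read as slots of power series

singleOp : (m n k : ℕ) → Vec ℕ k → Fin n → Slotℤ → Slotℤ
singleOp m n k b f with toℕ f ℕ.<? k
... | yes p = λ g → shift (+ 1 ℤ.- + n) (iterUp (lookup b (Fin.fromℕ< p)) g)
... | no _  = λ g → shift (+ (toℕ f ℕ.+ 1) ℤ.- + n ℤ.- + k) (iterUp (m ℕ.+ k) (timesℤ 𝑸 g))

module _ (m n k : ℕ) (b : Vec ℕ k) (f : Fin n) where

  singleFactor-< : (p : toℕ f ℕ.< k) →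
    singleFactor m n k b f ≡ ((one ⊕ 𝒙 f) ^ᴾ lookup b (Fin.fromℕ< p)) ⊗ xpow f (+ 1 ℤ.- + n)
  singleFactor-< p with toℕ f ℕ.<? k
  ... | yes _ = ≡.refl
  ... | no ¬p = ⊥-elim (¬p p)

  singleFactor-≥ : k ℕ.≤ toℕ f → singleFactor m n k b f
    ≡ (one ⊕ (𝑸 ⊗ 𝒙 f)) ⊗ ((one ⊕ 𝒙 f) ^ᴾ (m ℕ.+ k)) ⊗ xpow f (+ (toℕ f ℕ.+ 1) ℤ.- + n ℤ.- + k)
  singleFactor-≥ k≤f with toℕ f ℕ.<? k
  ... | yes p = ⊥-elim (ℕP.<⇒≱ p k≤f)
  ... | no _  = ≡.refl

  singleOp-< : (p : toℕ f ℕ.< k) →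
    singleOp m n k b f ≡ λ g → shift (+ 1 ℤ.- + n) (iterUp (lookup b (Fin.fromℕ< p)) g)
  singleOp-< p with toℕ f ℕ.<? k
  ... | yes _ = ≡.refl
  ... | no ¬p = ⊥-elim (¬p p)

  singleOp-≥ : k ℕ.≤ toℕ f →
    singleOp m n k b f ≡ λ g → shift (+ (toℕ f ℕ.+ 1) ℤ.- + n ℤ.- + k) (iterUp (m ℕ.+ k) (timesℤ 𝑸 g))
  singleOp-≥ k≤f with toℕ f ℕ.<? k
  ... | yes p = ⊥-elim (ℕP.<⇒≱ p k≤f)
  ... | no _  = ≡.refl

apply-assoc : ∀ s (a b p : Poly n) → apply s ((a ⊗ b) ⊗ p) ≅ apply s (a ⊗ (b ⊗ p))
apply-assoc {n} s a b p = apply-cong s {(a ⊗ b) ⊗ p} {a ⊗ (b ⊗ p)} (𝓛.*-assoc {n} a b p)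

apply-power-xpow : ∀ (f : Fin n) e z s p →
  apply s (((one ⊕ 𝒙 f) ^ᴾ e) ⊗ (xpow f z ⊗ p)) ≅ apply (upd f (λ g → shift z (iterUp e g)) s) p
apply-power-xpow f e z s p = K.trans (apply-power f e s (xpow f z ⊗ p))
  (K.trans (apply-xpow f z (upd f (iterUp e) s) p) (apply-upd-∘ f (shift z) (iterUp e) s p))

apply-left : ∀ (f : Fin n) e z s p →
  apply s ((((one ⊕ 𝒙 f) ^ᴾ e) ⊗ xpow f z) ⊗ p) ≅ apply (upd f (λ g → shift z (iterUp e g)) s) p
apply-left f e z s p = K.trans (apply-assoc s ((one ⊕ 𝒙 f) ^ᴾ e) (xpow f z) p) (apply-power-xpow f e z s p)

apply-right : ∀ (f : Fin n) e z s p →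
  apply s (((one ⊕ (𝑸 ⊗ 𝒙 f)) ⊗ ((one ⊕ 𝒙 f) ^ᴾ e) ⊗ xpow f z) ⊗ p)
    ≅ apply (upd f (λ g → shift z (iterUp e (timesℤ 𝑸 g))) s) p
apply-right {n} f e z s p = begin
  apply s (((qx ⊗ pw) ⊗ xpow f z) ⊗ p)           ≈⟨ apply-assoc s (qx ⊗ pw) (xpow f z) p ⟩
  apply s ((qx ⊗ pw) ⊗ (xpow f z ⊗ p))           ≈⟨ apply-assoc s qx pw (xpow f z ⊗ p) ⟩
  apply s (qx ⊗ (pw ⊗ (xpow f z ⊗ p)))           ≈⟨ apply-one+𝑸𝒙 f s (pw ⊗ (xpow f z ⊗ p)) ⟩
  apply s₁ (pw ⊗ (xpow f z ⊗ p))                 ≈⟨ apply-power-xpow f e z s₁ p ⟩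
  apply (upd f (λ g → shift z (iterUp e g)) s₁) p ≈⟨ apply-upd-∘ f (λ g → shift z (iterUp e g)) (timesℤ 𝑸) s p ⟩
  apply (upd f (λ g → shift z (iterUp e (timesℤ 𝑸 g))) s) p ∎
  where
  open RK
  qx pw : Poly n
  qx = one ⊕ (𝑸 ⊗ 𝒙 f)
  pw = (one ⊕ 𝒙 f) ^ᴾ e
  s₁ : Fin n → Slotℤ
  s₁ = upd f (timesℤ 𝑸) s

apply-single : ∀ m k (b : Vec ℕ k) (f : Fin n) s p →
  apply s (singleFactor m n k b f ⊗ p) ≅ apply (upd f (singleOp m n k b f) s) p
apply-single {n} m k b f s p = go (ℕP.<-≤-connex (toℕ f) k)
  where
  by : ∀ {F : Poly n} {h} → singleFactor m n k b f ≡ F → singleOp m n k b f ≡ h →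
    apply s (F ⊗ p) ≅ apply (upd f h s) p → apply s (singleFactor m n k b f ⊗ p) ≅ apply (upd f (singleOp m n k b f) s) p
  by e e′ h = K.trans (K.reflexive (≡.cong (λ x → apply s (x ⊗ p)) e))
    (K.trans h (K.reflexive (≡.cong (λ x → apply (upd f x s) p) (≡.sym e′))))
  go : toℕ f ℕ.< k ⊎ k ℕ.≤ toℕ f → apply s (singleFactor m n k b f ⊗ p) ≅ apply (upd f (singleOp m n k b f) s) p
  go (inj₁ q)   = by (singleFactor-< m n k b f q) (singleOp-< m n k b f q)
    (apply-left f (lookup b (Fin.fromℕ< q)) (+ 1 ℤ.- + n) s p)
  go (inj₂ k≤f) = by (singleFactor-≥ m n k b f k≤f) (singleOp-≥ m n k b f k≤f)
    (apply-right f (m ℕ.+ k) (+ (toℕ f ℕ.+ 1) ℤ.- + n ℤ.- + k) s p)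

apply-gogCT : ∀ m n k (b : Vec ℕ k) s →
  apply s (gogCT m n k b) ≅ SF.gogForm n (restrict (λ f → singleOp m n k b f (s f)))
apply-gogCT m n k b s = begin
  apply s (prodP (List.map B (allFin n)) ⊗ gogProduct n)
    ≡⟨ ≡.cong (λ x → apply s (x ⊗ gogProduct n)) (prodP-tabulate n id B) ⟩
  apply s (F𝓛.prodF n B ⊗ gogProduct n)
    ≈⟨ apply-prodF B (singleOp m n k b) (apply-single m k b) s (gogProduct n) ⟩
  apply (λ f → singleOp m n k b f (s f)) (gogProduct n)
    ≈⟨ apply-gogProduct (λ f → singleOp m n k b f (s f)) ⟩
  SF.gogForm n (restrict (λ f → singleOp m n k b f (s f))) ∎
  where
  open RK
  B = singleFactor m n k b

open import Data.Integer.Tactic.RingSolver using (solve-∀)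
open import Data.Nat as ℕ using (_+_; _≤_; _<_)

open Rec using (sq; times1+; binom; _≐_; gogFormL; toSlots; tailSlots; tailSeries; firstSlot; firstSeries)

δ-iff : ∀ {w v w′ v′} → (v ≡ w → v′ ≡ w′) → (v′ ≡ w′ → v ≡ w) → δ w v ≡ δ w′ v′
δ-iff {w} {v} {w′} {v′} f g = ≡.cong (λ c → if c then one else []) (does-⇔ (mk⇔ f g) (v ℤ.≟ w) (v′ ℤ.≟ w′))

-- The factor x^(1-n) alone: the constant term of x^(1-n+i) is 1 exactly at i = n - 1, which is the
-- slot of the series 1 at level n.
δ-sq : ∀ n i → δ (+ 0) ((+ 1 ℤ.- + n) ℤ.+ + i) ≡ sq (binom 0) n i
δ-sq zero    i       = ≡.refl
δ-sq (suc zero)    zero = ≡.refl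
δ-sq (suc (suc n)) zero = ≡.refl
δ-sq (suc n) (suc i) = ≡.trans (≡.cong (δ (+ 0)) (step (+ n) (+ i))) (δ-sq n i)
  where
  step : ∀ n i → (+ 1 ℤ.- (+ 1 ℤ.+ n)) ℤ.+ (+ 1 ℤ.+ i) ≡ (+ 1 ℤ.- n) ℤ.+ i
  step = solve-∀

δ-shifted : ∀ j z e → δ (ℤ.- + j) (z ℤ.+ + e) ≡ δ (+ 0) (z ℤ.+ + (j + e))
δ-shifted j z e = δ-iff
  (λ eq → ≡.trans (into z (+ j) (+ e)) (≡.trans (≡.cong (λ x → x ℤ.+ + j) eq) (ℤP.+-inverseˡ (+ j))))
  (λ eq → ≡.trans (back z (+ j) (+ e)) (≡.trans (≡.cong (λ x → x ℤ.+ ℤ.- + j) eq) (ℤP.+-identityˡ _)))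
  where
  into : ∀ z j e → z ℤ.+ (j ℤ.+ e) ≡ (z ℤ.+ e) ℤ.+ j
  into = solve-∀
  back : ∀ z j e → z ℤ.+ e ≡ (z ℤ.+ (j ℤ.+ e)) ℤ.+ ℤ.- j
  back = solve-∀

-- From the exponent z on, g is the slot of the power series xʲ h at level N.
record Reads (g : Slotℤ) (z : ℤ) (j : ℕ) (h : ℕ → Poly 0) (N : ℕ) : Set where
  constructor reads
  field value : ∀ e → g (z ℤ.+ + e) ≅ sq h N (j + e)
open Reads

Reads-timesℤ : ∀ w {g z j h N} → Reads g z j h N → Reads (timesℤ w g) z j (times1+ w h) N
Reads-timesℤ w {g} {z} {j} {h} {N} rd .value e = begin
  g (z ℤ.+ + e) ⊕ w ⊗ g (+ 1 ℤ.+ (z ℤ.+ + e))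
    ≡⟨ ≡.cong (λ x → g (z ℤ.+ + e) ⊕ w ⊗ g x) (move z (+ e)) ⟩
  g (z ℤ.+ + e) ⊕ w ⊗ g (z ℤ.+ + suc e)
    ≈⟨ K.+-cong (value rd e) (K.*-congˡ {x = w} (K.trans (value rd (suc e)) (K.reflexive (≡.cong (sq h N) (ℕP.+-suc j e))))) ⟩
  sq h N (j + e) ⊕ w ⊗ sq h N (suc (j + e))
    ≈⟨ Rec.sq-times1+ w h N (j + e) ⟨
  sq (times1+ w h) N (j + e) ∎
  where
  open RK
  move : ∀ z e → + 1 ℤ.+ (z ℤ.+ e) ≡ z ℤ.+ (+ 1 ℤ.+ e)
  move = solve-∀

Reads-cong : ∀ {g z j h h′ N} → (∀ i → h i ≅ h′ i) → Reads g z j h N → Reads g z j h′ N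
Reads-cong {j = j} {N = N} e rd .value i = K.trans (value rd i) (Rec.sq-cong N e (j + i))

Reads-binom : ∀ b c {g z j N} → Reads g z j (binom c) N → Reads (iterUp b g) z j (binom (b + c)) N
Reads-binom zero    c rd = rd
Reads-binom (suc b) c {g} {z} {j} {N} rd = ≡.subst (λ x → Reads (iterUp (suc b) g) z j (binom x) N) (ℕP.+-suc b c)
  (Reads-binom b (suc c) (Reads-timesℤ one rd))

Reads-tail : ∀ b c {g z j N} → Reads g z j (tailSeries 𝑸 c) N → Reads (iterUp b g) z j (tailSeries 𝑸 (b + c)) N
Reads-tail zero    c rd = rd
Reads-tail (suc b) c {g} {z} {j} {N} rd = ≡.subst (λ x → Reads (iterUp (suc b) g) z j (tailSeries 𝑸 x) N) (ℕP.+-suc b c)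
  (Reads-tail b (suc c) (Reads-cong (Rec.tailSeries-up 𝑸 c) (Reads-timesℤ one rd)))

Reads-δ : ∀ j N → Reads (δ (ℤ.- + j)) (+ 1 ℤ.- + N) j (binom 0) N
Reads-δ j N .value e = K.reflexive (≡.trans (δ-shifted j (+ 1 ℤ.- + N) e) (δ-sq N (j + e)))

singleOp-low : ∀ m n k (b : Vec ℕ k) (f : Fin n) j (p : toℕ f < k) e →
  singleOp m n k b f (δ (ℤ.- + j)) (+ e) ≅ sq (binom (lookup b (Fin.fromℕ< p))) n (j + e)
singleOp-low m n k b f j p e = K.trans (K.reflexive (≡.cong (λ op → op (δ (ℤ.- + j)) (+ e)) (singleOp-< m n k b f p)))
  (≡.subst (λ x → iterUp (lookup b (Fin.fromℕ< p)) (δ (ℤ.- + j)) ((+ 1 ℤ.- + n) ℤ.+ + e) ≅ sq (binom x) n (j + e))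
    (ℕP.+-identityʳ (lookup b (Fin.fromℕ< p))) (value (Reads-binom (lookup b (Fin.fromℕ< p)) 0 (Reads-δ j n)) e))

singleOp-high : ∀ m n k (b : Vec ℕ k) (f : Fin n) → k ≤ toℕ f → ∀ e →
  singleOp m n k b f (δ (+ 0)) (+ e) ≅ sq (tailSeries 𝑸 (m + k)) (n ∸ (toℕ f ∸ k)) e
singleOp-high m n k b f k≤f e = K.trans (K.reflexive (≡.cong (λ op → op (δ (+ 0)) (+ e)) (singleOp-≥ m n k b f k≤f)))
  (≡.subst₂ (λ z x → iterUp (m + k) (timesℤ 𝑸 (δ (+ 0))) (z ℤ.+ + e) ≅ sq (tailSeries 𝑸 x) N e)
    (≡.sym exponent) (ℕP.+-identityʳ (m + k)) (value (Reads-tail (m + k) 0 (Reads-cong (λ _ → K.refl) (Reads-timesℤ 𝑸 (Reads-δ 0 N)))) e))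
  where
  -- The index f counts from zero, so the exponent (f + 1) - n - k equals 1 - N for this level N.
  N = n ∸ (toℕ f ∸ k)
  i = toℕ f ∸ k
  f≡ : toℕ f ≡ k + i
  f≡ = ≡.sym (ℕP.m+[n∸m]≡n k≤f)
  n≡ : n ≡ N + i
  n≡ = ≡.sym (ℕP.m∸n+n≡m (ℕP.≤-trans (ℕP.m∸n≤m (toℕ f) k) (ℕP.<⇒≤ (FinP.toℕ<n f))))
  arith : ∀ k i N → ((k ℤ.+ i) ℤ.+ + 1) ℤ.- (N ℤ.+ i) ℤ.- k ≡ + 1 ℤ.- N
  arith = solve-∀
  exponent : + (toℕ f + 1) ℤ.- + n ℤ.- + k ≡ + 1 ℤ.- + N
  exponent = ≡.trans (≡.cong₂ (λ x y → + (x + 1) ℤ.- + y ℤ.- + k) f≡ n≡) (arith (+ k) (+ i) (+ N))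

tabulate-tail : ∀ t N (g : ℕ → Poly 0) (F : Fin t → Slot) → (∀ f → F f ≐ sq g (N ∸ toℕ f)) →
  PointwiseL _≐_ (toList (Vec.tabulate F)) (toList (tailSlots t N g))
tabulate-tail zero    N g F e = []
tabulate-tail (suc t) N g F e = e zero ∷ tabulate-tail t (N ∸ 1) g (λ f → F (suc f))
  (λ f → ≡.subst (λ x → F (suc f) ≐ sq g x) (≡.sym (ℕP.∸-+-assoc N 1 (toℕ f))) (e (suc f)))

tabulate-slots : ∀ {r} t (bs : Vec ℕ r) N (g : ℕ → Poly 0) (F : Fin (r + t) → Slot) →
  (∀ f (p : toℕ f < r) → F f ≐ sq (binom (lookup bs (Fin.fromℕ< p))) N) →
  (∀ f → r ≤ toℕ f → F f ≐ sq g (N ∸ (toℕ f ∸ r))) →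
  PointwiseL _≐_ (toList (Vec.tabulate F)) (toList (toSlots bs N) ++ toList (tailSlots t N g))
tabulate-slots t []       N g F low high = tabulate-tail t N g F (λ f → high f z≤n)
tabulate-slots t (b ∷ bs) N g F low high = low zero (s≤s z≤n)
  ∷ tabulate-slots t bs N g (λ f → F (suc f)) (λ f p → low (suc f) (s≤s p)) (λ f le → high (suc f) (s≤s le))

-- An additional factor x₁ʲ is included, for the expansion of 1 / (1 + P x₁).
ctSlots : ∀ {k′} → ℕ → ℕ → ℕ → ℕ → Vec ℕ (suc k′) → List Slot
ctSlots {k′} j m n t (b ∷ bs) =
  (λ e → sq (binom b) n (j + e)) ∷ toList (toSlots bs n) ++ toList (tailSlots t n (tailSeries 𝑸 (m + suc k′)))

apply-gogCT-shifted : ∀ m k′ t (b : Vec ℕ (suc k′)) j →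
  apply (λ f → δ (lookup (shift₁ (ℤ.- + j) (zeroExp {suc (k′ + t)})) f)) (gogCT m (suc (k′ + t)) (suc k′) b)
    ≅ gogFormL (ctSlots j m (suc (k′ + t)) t b)
apply-gogCT-shifted m k′ t b@(b₁ ∷ bs) j = begin
  apply s (gogCT m N k b)                 ≈⟨ apply-gogCT m N k b s ⟩
  SF.gogForm N (Vec.tabulate F)           ≈⟨ Rec.gogFormL-toList (Vec.tabulate F) ⟨
  gogFormL (toList (Vec.tabulate F))      ≈⟨ Rec.gogFormL-cong slots ⟩
  gogFormL (ctSlots j m N t b) ∎
  where
  open RK
  N k : ℕ
  N = suc (k′ + t)
  k = suc k′
  s : Fin N → Slotℤ
  s f = δ (lookup (shift₁ (ℤ.- + j) (zeroExp {N})) f)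
  F : Fin N → Slot
  F f e = singleOp m N k b f (s f) (+ e)
  s-zero : s zero ≡ δ (ℤ.- + j)
  s-zero = ≡.cong δ (ℤP.+-identityˡ (ℤ.- + j))
  s-suc : ∀ f → s (suc f) ≡ δ (+ 0)
  s-suc f = ≡.cong δ (VecP.lookup-replicate f (+ 0))
  slots : PointwiseL _≐_ (toList (Vec.tabulate F)) (ctSlots j m N t b)
  slots = (λ e → K.trans (K.reflexive (≡.cong (λ g → singleOp m N k b zero g (+ e)) s-zero)) (singleOp-low m N k b zero j (s≤s z≤n) e))
    ∷ tabulate-slots t bs N (tailSeries 𝑸 (m + k)) (λ f → F (suc f))
        (λ f p e → K.trans (K.reflexive (≡.cong (λ g → singleOp m N k b (suc f) g (+ e)) (s-suc f))) (singleOp-low m N k b (suc f) 0 (s≤s p) e))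
        (λ f le e → K.trans (K.reflexive (≡.cong (λ g → singleOp m N k b (suc f) g (+ e)) (s-suc f))) (singleOp-high m N k b (suc f) (s≤s le) e))

-- Coefficients in P and Q, and the geometric series in the first variable

coef : ℕ → ℕ → Poly 0 → ℤ
coef a c x = coeff x a c []

coef-cong : ∀ a c {x y} → x ≅ y → coef a c x ≡ coef a c y
coef-cong a c {x} {y} e = coeff-cong {p = x} {y} a c [] e

coeff-gogCT : ∀ m k′ t (b : Vec ℕ (suc k′)) a c →
  coeff (gogCT m (suc (k′ + t)) (suc k′) b) a c zeroExp ≡ coef a c (gogFormL (ctSlots 0 m (suc (k′ + t)) t b))
coeff-gogCT m k′ t b a c = ≡.trans (coeff-apply (gogCT m (suc (k′ + t)) (suc k′) b) a c zeroExp)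
  (coef-cong a c (apply-gogCT-shifted m k′ t b 0))

coef-⊕ : ∀ a c x y → coef a c (x ⊕ y) ≡ coef a c x ℤ.+ coef a c y
coef-⊕ a c x y = ≡.trans (coeff-pair (x ⊕ y) a c []) (≡.trans (LA.pair-++ 0 x y _)
  (≡.sym (≡.cong₂ ℤ._+_ (coeff-pair x a c []) (coeff-pair y a c []))))

coef-𝑷 : ∀ a c x → coef a c (𝑷 ⊗ x) ≡ LA.pair 0 x (λ m → indicator a c [] ((1 , 0 , []) · m))
coef-𝑷 a c x = ≡.trans (coeff-pair (𝑷 ⊗ x) a c []) (≡.trans (LA.pair-⊛ 0 𝑷 x (indicator a c []))
  (≡.trans (LA.pair-mono 0 (+ 1) (1 , 0 , []) (λ m → LA.pair 0 x (λ m′ → indicator a c [] (m · m′)))) (ℤP.*-identityˡ (LA.pair 0 x (λ m → indicator a c [] ((1 , 0 , []) · m))))))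

coef-0-𝑷 : ∀ c x → coef 0 c (𝑷 ⊗ x) ≡ + 0
coef-0-𝑷 c x = ≡.trans (coef-𝑷 0 c x) (LA.pair-0 0 x)

coef-suc-𝑷 : ∀ a c x → coef (suc a) c (𝑷 ⊗ x) ≡ coef a c x
coef-suc-𝑷 a c x = ≡.trans (coef-𝑷 (suc a) c x)
  (≡.trans (LA.pair-cong 0 x (λ { (_ , _ , []) → ≡.refl })) (≡.sym (coeff-pair x a c [])))

-1ℤ : ℤ
-1ℤ = ℤ.- (+ 1)

-- If Gᵢ + P Gᵢ₊₁ = Aᵢ then G₀ = Σⱼ (-P)ʲ Aⱼ, a finite sum in each degree in P.
coef-alternating : ∀ c (G A : ℕ → Poly 0) → (∀ i → G i ⊕ 𝑷 ⊗ G (suc i) ≅ A i) → ∀ a i →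
  coef a c (G i) ≡ sumℤ (List.map (λ j → -1ℤ ℤ.^ j ℤ.* coef (a ∸ j) c (A (i + j))) (upTo (suc a)))
coef-alternating c G A e zero i = begin
  coef 0 c (G i)                                ≡⟨ ℤP.+-identityʳ _ ⟨
  coef 0 c (G i) ℤ.+ + 0                        ≡⟨ ≡.cong (λ x → coef 0 c (G i) ℤ.+ x) (coef-0-𝑷 c (G (suc i))) ⟨
  coef 0 c (G i) ℤ.+ coef 0 c (𝑷 ⊗ G (suc i))   ≡⟨ coef-⊕ 0 c (G i) (𝑷 ⊗ G (suc i)) ⟨
  coef 0 c (G i ⊕ 𝑷 ⊗ G (suc i))                ≡⟨ coef-cong 0 c (e i) ⟩
  coef 0 c (A i)                                ≡⟨ ≡.cong (λ x → coef 0 c (A x)) (ℕP.+-identityʳ i) ⟨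
  coef 0 c (A (i + 0))                          ≡⟨ ≡.trans (ℤP.+-identityʳ (+ 1 ℤ.* coef 0 c (A (i + 0)))) (ℤP.*-identityˡ (coef 0 c (A (i + 0)))) ⟨
  + 1 ℤ.* coef 0 c (A (i + 0)) ℤ.+ + 0          ∎
  where open ≡.≡-Reasoning
coef-alternating c G A e (suc a) i = begin
  coef (suc a) c (G i)
    ≡⟨ isolate (coef (suc a) c (G i)) (coef a c (G (suc i))) ⟩
  (coef (suc a) c (G i) ℤ.+ coef a c (G (suc i))) ℤ.+ -1ℤ ℤ.* coef a c (G (suc i))
    ≡⟨ ≡.cong (λ x → x ℤ.+ -1ℤ ℤ.* coef a c (G (suc i))) head ⟩
  coef (suc a) c (A (i + 0)) ℤ.+ -1ℤ ℤ.* coef a c (G (suc i))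
    ≡⟨ ≡.cong (λ x → coef (suc a) c (A (i + 0)) ℤ.+ -1ℤ ℤ.* x) (coef-alternating c G A e a (suc i)) ⟩
  coef (suc a) c (A (i + 0)) ℤ.+ -1ℤ ℤ.* sumℤ (List.map (term a (suc i)) (upTo (suc a)))
    ≡⟨ ≡.cong₂ ℤ._+_ (≡.sym (ℤP.*-identityˡ (coef (suc a) c (A (i + 0))))) (tail (upTo (suc a))) ⟩
  + 1 ℤ.* coef (suc a) c (A (i + 0)) ℤ.+ sumℤ (List.map (term (suc a) i) (List.map suc (upTo (suc a))))
    ≡⟨ ≡.cong (λ xs → sumℤ (List.map (term (suc a) i) (0 ∷ xs))) (LP.map-upTo suc (suc a)) ⟩
  sumℤ (List.map (term (suc a) i) (upTo (suc (suc a)))) ∎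
  where
  open ≡.≡-Reasoning
  term : ℕ → ℕ → ℕ → ℤ
  term a i j = -1ℤ ℤ.^ j ℤ.* coef (a ∸ j) c (A (i + j))
  isolate : ∀ x y → x ≡ (x ℤ.+ y) ℤ.+ -1ℤ ℤ.* y
  isolate = solve-∀
  head : coef (suc a) c (G i) ℤ.+ coef a c (G (suc i)) ≡ coef (suc a) c (A (i + 0))
  head = ≡.trans (≡.cong (λ x → coef (suc a) c (G i) ℤ.+ x) (≡.sym (coef-suc-𝑷 a c (G (suc i)))))
    (≡.trans (≡.sym (coef-⊕ (suc a) c (G i) (𝑷 ⊗ G (suc i))))
    (≡.trans (coef-cong (suc a) c (e i)) (≡.cong (λ x → coef (suc a) c (A x)) (≡.sym (ℕP.+-identityʳ i)))))
  tail : ∀ xs → -1ℤ ℤ.* sumℤ (List.map (term a (suc i)) xs) ≡ sumℤ (List.map (term (suc a) i) (List.map suc xs))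
  tail []       = ≡.refl
  tail (j ∷ xs) = ≡.trans (ℤP.*-distribˡ-+ -1ℤ (term a (suc i) j) _) (≡.cong₂ ℤ._+_
    (≡.trans (≡.sym (ℤP.*-assoc -1ℤ (-1ℤ ℤ.^ j) _))
      (≡.cong (λ x → -1ℤ ℤ.^ suc j ℤ.* coef (a ∸ j) c (A x)) (≡.sym (ℕP.+-suc i j)))) (tail xs))

gogFormL-combine : ∀ (g h : Slot) w L → gogFormL (g ∷ L) ⊕ w ⊗ gogFormL (h ∷ L) ≅ gogFormL ((λ e → g e ⊕ w ⊗ h e) ∷ L)
gogFormL-combine g h w L = K.sym (K.trans (slot-+ g (λ e → w ⊗ h e) (Vec.fromList L)) (K.+-congˡ {x = gogFormL (g ∷ L)} (slot-* w h (Vec.fromList L))))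
  where open J.LinearFirst (proj₁ (J.gogForm-multilinear (suc (List.length L))))

gogFormL-scale : ∀ (g : Slot) w L → w ⊗ gogFormL (g ∷ L) ≅ gogFormL ((λ e → w ⊗ g e) ∷ L)
gogFormL-scale g w L = K.sym (slot-* w g (Vec.fromList L))
  where open J.LinearFirst (proj₁ (J.gogForm-multilinear (suc (List.length L))))

sq-first-shift : ∀ N i e → sq (firstSeries 𝑷) N (i + e) ⊕ 𝑷 ⊗ sq (firstSeries 𝑷) N (suc i + e) ≅ 𝑷 ⊗ sq (binom 2) N (i + e)
sq-first-shift N i e = Rec.sq-first 𝑷 N (i + e)

-- `A i` is the constant term with first series x^i P(1 + x)^2, and `G i` the one with x^i φ for φ =
-- P(1 + x)^2/(1 + Px). Hence φ + P x φ = P(1 + x)^2 gives the recursion whose alternating solution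
-- is the definition of `coeffGeom`. The first entry 2 supplies the square.
coeffGeom-gogCT : ∀ m k′ t (bs : Vec ℕ k′) a c →
  coeffGeom (𝑷 ⊗ gogCT m (suc (k′ + t)) (suc k′) (2 ∷ bs)) a c zeroExp
    ≡ coef a c (gogFormL (sq (firstSeries 𝑷) (suc (k′ + t)) ∷ toList (toSlots bs (suc (k′ + t)))
                  ++ toList (tailSlots t (suc (k′ + t)) (tailSeries 𝑸 (m + suc k′)))))
coeffGeom-gogCT m k′ t bs a c = ≡.sym (≡.trans (coef-alternating c G A recursion a 0)
  (≡.cong sumℤ (LP.map-cong (λ j → ≡.cong (λ x → -1ℤ ℤ.^ j ℤ.* x) (≡.sym (shifted-coeff j))) (upTo (suc a)))))
  where
  N : ℕ
  N = suc (k′ + t)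
  X : Poly N
  X = gogCT m N (suc k′) (2 ∷ bs)
  L : List Slot
  L = toList (toSlots bs N) ++ toList (tailSlots t N (tailSeries 𝑸 (m + suc k′)))
  G A : ℕ → Poly 0
  G i = gogFormL ((λ e → sq (firstSeries 𝑷) N (i + e)) ∷ L)
  A i = 𝑷 ⊗ gogFormL (ctSlots i m N t (2 ∷ bs))
  recursion : ∀ i → G i ⊕ 𝑷 ⊗ G (suc i) ≅ A i
  recursion i = K.trans (gogFormL-combine _ _ 𝑷 L) (K.trans
    (Rec.gogFormL-cong ((λ e → sq-first-shift N i e) ∷ LPW.refl (λ _ → K.refl)))
    (K.sym (gogFormL-scale _ 𝑷 L)))
  shifted-coeff : ∀ j → coeff (𝑷 ⊗ X) (a ∸ j) c (shift₁ (ℤ.- + j) zeroExp) ≡ coef (a ∸ j) c (A j)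
  shifted-coeff j = ≡.trans (coeff-apply (𝑷 ⊗ X) (a ∸ j) c (shift₁ (ℤ.- + j) zeroExp))
    (coef-cong (a ∸ j) c (K.trans (apply-𝑷 (λ f → δ (lookup (shift₁ (ℤ.- + j) zeroExp) f)) X) (K.*-congˡ {x = 𝑷} (apply-gogCT-shifted m k′ t (2 ∷ bs) j))))

map-sum : ∀ {X : Set} (xs : List X) (h : X → Term 0) → List.map h xs ≡ KK.sumL xs (λ x → h x ∷ [])
map-sum []       h = ≡.refl
map-sum (x ∷ xs) h = ≡.cong (h x ∷_) (map-sum xs h)

pow-𝑷 : ∀ i → VK.pow 𝑷 i ≅ (+ 1 , i , 0 , []) ∷ []
pow-𝑷 zero    = K.refl
pow-𝑷 (suc i) = K.*-congˡ {x = 𝑷} (pow-𝑷 i)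

pow-𝑸 : ∀ i → VK.pow 𝑸 i ≅ (+ 1 , 0 , i , []) ∷ []
pow-𝑸 zero    = K.refl
pow-𝑸 (suc i) = K.*-congˡ {x = 𝑸} (pow-𝑸 i)

pow-one : ∀ i → VK.pow one i ≅ one
pow-one zero    = K.refl
pow-one (suc i) = K.trans (K.*-identityˡ (VK.pow one i)) (pow-one i)

genPQ-sum : ∀ m n k bs → genPQ m n k bs ≅ KK.sumL (gogs m n k bs) (λ T → VK.pow 𝑷 (#minima m n k T) ⊗ VK.pow 𝑸 (#maxima m n k T))
genPQ-sum m n k bs = K.trans (K.reflexive (map-sum (gogs m n k bs) _))
  (KK.sum-cong (gogs m n k bs) (λ T → K.sym (K.trans (K.*-cong (pow-𝑷 (#minima m n k T)) (pow-𝑸 (#maxima m n k T)))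
    (K.reflexive (≡.cong (λ i → (+ 1 , i , #maxima m n k T , []) ∷ []) (ℕP.+-identityʳ _))))))

genQ-sum : ∀ m n k bs → genQ m n k bs ≅ KK.sumL (gogs m n k bs) (λ T → VK.pow one (#minima m n k T) ⊗ VK.pow 𝑸 (#maxima m n k T))
genQ-sum m n k bs = K.trans (K.reflexive (map-sum (gogs m n k bs) _))
  (KK.sum-cong (gogs m n k bs) (λ T → K.sym (K.*-cong (pow-one (#minima m n k T)) (pow-𝑸 (#maxima m n k T)))))

linked-chain : ∀ prev b (bs : Vec ℕ r) C → prev < b → Linked _<_ (toList (b ∷ bs)) → last (b ∷ bs) ≤ C → Chain prev (b ∷ bs) C
linked-chain prev b []       C lt _         le = lt , le
linked-chain prev b (x ∷ bs) C lt (b<x ∷ l) le = lt , linked-chain b x bs C b<x l le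

-- The weight p is left free so that both parts can share the formula: P marks minima, and `one`
-- forgets them. Here t counts the tail variables.
gogs-formula : ∀ p m k′ t (b : Vec ℕ (suc k′)) → Chain 0 b (m + suc k′) →
  KK.sumL (gogs m (suc (k′ + t)) (suc k′) (toList b))
      (λ T → VK.pow p (#minima m (suc (k′ + t)) (suc k′) T) ⊗ VK.pow 𝑸 (#maxima m (suc (k′ + t)) (suc k′) T))
    ≅ gogFormL (firstSlot p (suc (k′ + t)) (Vec.head b) ∷ toList (toSlots (Vec.tail b) (suc (k′ + t)))
                  ++ toList (tailSlots t (suc (k′ + t)) (tailSeries 𝑸 (m + suc k′))))
gogs-formula p m k′ t b@(b₁ ∷ bs) ch = K.trans
  (GogSum.gogs-total 𝕂 p 𝑸 k (s≤s z≤n) m N b k≡ (chain-mono 0 b (ℕP.+-monoʳ-≤ m (s≤s (ℕP.m≤m+n k′ t))) ch))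
  (K.trans (Counting.claim 𝕂 p 𝑸 (m + N) k (s≤s z≤n) N k′ b t ≡.refl k≡ (ℕP.m≤n+m N m)
      (≡.subst (λ x → Chain 0 b (x + k)) (≡.sym (ℕP.m+n∸n≡m m N)) ch))
    (K.reflexive (≡.cong (λ x → gogFormL (firstSlot p N b₁ ∷ toList (toSlots bs N) ++ toList (tailSlots t N (tailSeries 𝑸 (x + k)))))
      (ℕP.m+n∸n≡m m N))))
  where
  N k : ℕ
  N = suc (k′ + t)
  k = suc k′
  k≡ : k ≡ N ⊓ k
  k≡ = ≡.sym (ℕP.m≥n⇒m⊓n≡n (s≤s (ℕP.m≤m+n k′ t)))

-- At p = 1 the quotient (1 + x)^2/(1 + x) is 1 + x, so an entry 1 loses its special role.
firstSeries-one : ∀ i → firstSeries one i ≅ binom 1 i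
firstSeries-one zero    = K.*-identityˡ one
firstSeries-one (suc i) = K.trans
  (K.+-congˡ {x = one ⊗ binom 2 (suc i)} (K.-‿cong (K.*-congˡ {x = one} (firstSeries-one i))))
  (KK.solve 2 (λ x y → KK.:1 KK.:* (x KK.:+ KK.:1 KK.:* y) KK.:- KK.:1 KK.:* y KK.:= x) K.refl (binom 1 (suc i)) (binom 1 i))

firstSlot-one : ∀ n b → firstSlot one n b ≐ sq (binom b) n
firstSlot-one n zero          e = K.refl
firstSlot-one n (suc zero)    e = Rec.sq-cong n firstSeries-one e
firstSlot-one n (suc (suc b)) e = K.refl

theorem3p3 : (m n k : ℕ) → 1 ≤ k → k ≤ n →
    ((k' : ℕ) → k ≡ suc k' → (bs : Vec ℕ k') →
    Linked _<_ (toList (1 ∷ bs)) → last (1 ∷ bs) ≤ m + k →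
    (a c : ℕ) →
    coeff (genPQ m n k (toList (1 ∷ bs))) a c zeroExp
    ≡ coeffGeom (𝑷 ⊗ gogCT m n (suc k') (2 ∷ bs)) a c zeroExp)
    × ((k' : ℕ) → k ≡ suc k' → (b : Vec ℕ (suc k')) →
    All (1 ≤_) b → Linked _<_ (toList b) → last b ≤ m + k →
    (a c : ℕ) →
    coeff (genQ m n k (toList b)) a c zeroExp
    ≡ coeff (gogCT m n (suc k') b) a c zeroExp)
-- Replacing n by k + t gives the number of variables the form `suc (k′ + t)`, in which the first k
-- slots and the t tail slots can be separated by computation.
theorem3p3 m n k 1≤k k≤n with n ∸ k | ℕP.m+[n∸m]≡n k≤n
... | t | ≡.refl =
  (λ { k′ ≡.refl bs linked last≤ a c → ≡.trans
      (coef-cong a c (K.trans (genPQ-sum m (suc (k′ + t)) (suc k′) (toList (1 ∷ bs)))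
        (gogs-formula 𝑷 m k′ t (1 ∷ bs) (linked-chain 0 1 bs _ (s≤s z≤n) linked last≤))))
      (≡.sym (coeffGeom-gogCT m k′ t bs a c)) }) ,
  (λ { k′ ≡.refl (b ∷ bs) (1≤b ∷ _) linked last≤ a c → ≡.trans
      (coef-cong a c (K.trans (genQ-sum m (suc (k′ + t)) (suc k′) (toList (b ∷ bs)))
        (K.trans (gogs-formula one m k′ t (b ∷ bs) (linked-chain 0 b bs _ 1≤b linked last≤))
          (Rec.gogFormL-cong (firstSlot-one (suc (k′ + t)) b ∷ LPW.refl (λ _ → K.refl))))))
      (≡.sym (coeff-gogCT m k′ t (b ∷ bs) a c)) })
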